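{- Let $n\ge2$ and let $\mathscr A$ be an orientation of $A_{n-1}$. The intersection of $H$ with all $\mathscr A$-admissible half spaces is a polytope combinatorially equivalent to the $(n-1)$-dimensional associahedron, and its vertex set is exactly $\{M_{\mathscr A}(T):T\in\mathcal T_{n+2}\}$.
   Context: Let $[n]=\{1,\dots,n\}$. $A_{n-1}$ is the path with vertices $\tau_1,\dots,\tau_{n-1}$ and edges $\{\tau_i,\tau_{i+1}\}$; an orientation $\mathscr A$ directs each edge. $i\in\{2,\dots,n-1\}$ is up if $\{\tau_{i-1},\tau_i\}$ is directed from $\tau_i$ to $\tau_{i-1}$, down otherwise; $1,n$ are down; $\mathrm{Do}_{\mathscr A},\mathrm{Up}_{\mathscr A}$ are the sets of down/up elements, $\overline{\mathrm{Do}}_{\mathscr A}=\mathrm{Do}_{\mathscr A}\cup\{0,n+1\}$. Labelled polygon: in a convex $(n+2)$-gon $P$ label a vertex $0$, then counterclockwise the down elements increasingly, then $n+1$, then the up elements decreasingly. A triangulation $T$ is a set of $n-1$ non-crossing diagonals, viewed as a graph with the boundary edges of $P$; $\{a,b\}\in T$ means it is an edge; $\mathcal T_{n+2}$ is the set of triangulations. $\mu_i(j)$ ($i\in[n]$, $0\le j\le n+1$) counts edges of the boundary path from $i$ to $j$ using only labels $\le i$ if $j<i$, only labels $\ge i$ if $j\ge i$. $p^T_\ell(i)=\max\{\mu_i(a):0\le a<i,\{a,i\}\in T\}$, $p^T_r(i)=\max\{\mu_i(b):i<b\le n+1,\{i,b\}\in T\}$, $\omega_i=p^T_\ell(i)p^T_r(i)$,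 $x_i=\omega_i$ ($i$ down) or $n+1-\omega_i$ ($i$ up); $M_{\mathscr A}(T)=(x_1,\dots,x_n)$. For a diagonal $D=\{a,b\}$, $0\le a<b\le n+1$: $K_{\mathscr A}(D)=\{i\in\mathrm{Do}_{\mathscr A}:a<i<b\}$ if $a,b\in\overline{\mathrm{Do}}_{\mathscr A}$; $=\{i\in\mathrm{Do}_{\mathscr A}:a<i\}\cup\{i\in\mathrm{Up}_{\mathscr A}:b\le i\}$ if $a\in\overline{\mathrm{Do}}_{\mathscr A},b\in\mathrm{Up}_{\mathscr A}$; $=\mathrm{Do}_{\mathscr A}\cup\{i\in\mathrm{Up}_{\mathscr A}:i\le a\text{ or }b\le i\}$ if $a,b\in\mathrm{Up}_{\mathscr A}$; $=\{i\in\mathrm{Do}_{\mathscr A}:i<b\}\cup\{i\in\mathrm{Up}_{\mathscr A}:i\le a\}$ if $a\in\mathrm{Up}_{\mathscr A},b\in\overline{\mathrm{Do}}_{\mathscr A}$. $H=\{x\in\mathbb R^n:\sum_ix_i=n(n+1)/2\}$; for $\varnothing\ne K\subsetneq[n]$, $k=|K|$: $\mathscr H_K=\{x:(n-k)\sum_{i\in K}x_i-k\sum_{i\notin K}x_i+\tfrac{nk(n-k)}2\ge0\}$. $\mathscr H_K$ is $\mathscr A$-admissible if $K=K_{\mathscr A}(D)$ for some diagonal $D$ of $P$. The associahedron is the simple polytope whose face lattice is isomorphic to the poset of sets of non-crossing diagonals of an $(n+2)$-gon under reverse inclusion.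
   Formalization: The hyperplane H, the admissible half spaces, and the faces and vertices of their intersection are taken in rational n-space instead of real n-space; supporting functionals are rational as well. -}

module Defs where

open import Data.Bool using (Bool; true; false; not; _∧_; _∨_; if_then_else_)
open import Data.Nat using (ℕ; zero; suc; _+_; _*_; _∸_; _⊔_; _<_; _≤_; _<ᵇ_; _≤ᵇ_; _≡ᵇ_)
open import Data.Nat.DivMod using (_%_)
open import Data.Fin using (Fin; toℕ)
open import Data.List using (List; []; _∷_; map; foldr; upTo; applyUpTo; allFin)
open import Data.Vec using (Vec; toList; lookup; zipWith; tabulate)
open import Data.Integer using (ℤ; +_) renaming (_-_ to _-ℤ_)
open import Data.Rational using (ℚ; _/_; 0ℚ; -_) renaming (_+_ to _+ℚ_; _*_ to _*ℚ_; _-_ to _-ℚ_; _≤_ to _≤ℚ_)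
open import Data.Product using (Σ; _×_; _,_; proj₁)
open import Function.Bundles using (_⇔_)
open import Relation.Binary.PropositionalEquality using (_≡_)

-- An orientation of the path A_{n-1} (vertices τ_1..τ_{n-1}, edges
-- {τ_k,τ_{k+1}}, k = 1..n-2).  Entry number k-1 (0-based) of the vector
-- describes the edge {τ_k, τ_{k+1}}:  true  means it is directed from
-- τ_{k+1} to τ_k (so k+1 is "up"), false means from τ_k to τ_{k+1}.
record Orientation (n : ℕ) : Set where
  constructor orientation
  field edges : Vec Bool (n ∸ 2)
open Orientation public

nth : List Bool → ℕ → Bool
nth []       _       = false
nth (b ∷ _)  zero    = b
nth (_ ∷ bs) (suc k) = nth bs k

-- isUp 𝒜 i = true iff i ∈ Up_𝒜.  (0, 1, n, n+1 are never up.)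
isUp : ∀ {n} → Orientation n → ℕ → Bool
isUp 𝒜 zero          = false
isUp 𝒜 (suc zero)    = false
isUp 𝒜 (suc (suc k)) = nth (toList (edges 𝒜)) k

-- membership in the extended down set  Do ∪ {0, n+1}  (for labels 0..n+1)
isDoBar : ∀ {n} → Orientation n → ℕ → Bool
isDoBar 𝒜 i = not (isUp 𝒜 i)

countIn : (ℕ → Bool) → ℕ → ℕ → ℕ
countIn p a zero    = 0
countIn p a (suc l) = (if p a then 1 else 0) + countIn p (suc a) l

-- The labelled (n+2)-gon.  Vertices are numbered by their position
-- 0..n+1 in counterclockwise order; pos gives the position of a label.
-- Order: 0, down elements increasing, n+1, up elements decreasing.

pos : ∀ {n} → Orientation n → ℕ → ℕ
pos {n} 𝒜 ℓ =
  if isUp 𝒜 ℓ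
  then suc (countIn (isDoBar 𝒜) 1 n) + countIn (isUp 𝒜) ℓ (suc n ∸ ℓ)
  else countIn (isDoBar 𝒜) 1 ℓ

findLabel : ∀ {n} → Orientation n → ℕ → List ℕ → ℕ
findLabel 𝒜 p []       = 0
findLabel 𝒜 p (ℓ ∷ ls) = if pos 𝒜 ℓ ≡ᵇ p then ℓ else findLabel 𝒜 p ls

labelAt : ∀ {n} → Orientation n → ℕ → ℕ
labelAt {n} 𝒜 p = findLabel 𝒜 p (upTo (suc (suc n)))

adjacent : ∀ {n} → Orientation n → ℕ → ℕ → Bool
adjacent {n} 𝒜 a b =
  (suc (pos 𝒜 a) ≡ᵇ pos 𝒜 b) ∨ (suc (pos 𝒜 b) ≡ᵇ pos 𝒜 a)
  ∨ ((pos 𝒜 a ≡ᵇ 0) ∧ (pos 𝒜 b ≡ᵇ suc n))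
  ∨ ((pos 𝒜 b ≡ᵇ 0) ∧ (pos 𝒜 a ≡ᵇ suc n))

IsDiagonal : ∀ {n} → Orientation n → ℕ → ℕ → Set
IsDiagonal {n} 𝒜 a b = a < b × b ≤ suc n × adjacent 𝒜 a b ≡ false

min′ max′ : ℕ → ℕ → ℕ
min′ x y = if x ≤ᵇ y then x else y
max′ x y = if x ≤ᵇ y then y else x

crosses : ∀ {n} → Orientation n → ℕ → ℕ → ℕ → ℕ → Bool
crosses 𝒜 a b c d =
  let p₁ = min′ (pos 𝒜 a) (pos 𝒜 b) ; q₁ = max′ (pos 𝒜 a) (pos 𝒜 b)
      p₂ = min′ (pos 𝒜 c) (pos 𝒜 d) ; q₂ = max′ (pos 𝒜 c) (pos 𝒜 d)
  in ((p₁ <ᵇ p₂) ∧ (p₂ <ᵇ q₁) ∧ (q₁ <ᵇ q₂))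
     ∨ ((p₂ <ᵇ p₁) ∧ (p₁ <ᵇ q₂) ∧ (q₂ <ᵇ q₁))

-- a set of diagonals, given by its characteristic function on pairs (a,b), a < b
DiagSet : Set
DiagSet = ℕ → ℕ → Bool

IsNonCrossing : ∀ {n} → Orientation n → DiagSet → Set
IsNonCrossing 𝒜 S =
  (∀ a b → S a b ≡ true → IsDiagonal 𝒜 a b)
  × (∀ a b c d → S a b ≡ true → S c d ≡ true → crosses 𝒜 a b c d ≡ false)

sumℕ : List ℕ → ℕ
sumℕ = foldr _+_ 0

card : ℕ → DiagSet → ℕ
card n S = sumℕ (map (λ a → countIn (S a) 0 (suc (suc n))) (upTo (suc (suc n))))

NCSet : ∀ {n} → Orientation n → Set
NCSet 𝒜 = Σ DiagSet (IsNonCrossing 𝒜)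

_⊆D_ : DiagSet → DiagSet → Set
S ⊆D S′ = ∀ a b → S a b ≡ true → S′ a b ≡ true

Triangulation : ∀ {n} → Orientation n → Set
Triangulation {n} 𝒜 = Σ DiagSet λ T → IsNonCrossing 𝒜 T × card n T ≡ n ∸ 1

edgeT : ∀ {n} → Orientation n → DiagSet → ℕ → ℕ → Bool
edgeT 𝒜 T a b = adjacent 𝒜 a b ∨ T a b

-- μ_i(j): length of the boundary path from i to j using only labels ≤ i
-- (if j < i) or only labels ≥ i (if j ≥ i).  We walk from i to j in the
-- counterclockwise direction; if that walk only uses allowed labels its
-- length is μ_i(j), otherwise the clockwise walk is the path.

filterB : (ℕ → Bool) → List ℕ → List ℕ
filterB p = foldr (λ k r → if p k then k ∷ r else r) []

allB : (ℕ → Bool) → List ℕ → Bool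
allB p = foldr (λ k r → p k ∧ r) true

μ : ∀ {n} → Orientation n → ℕ → ℕ → ℕ
μ {n} 𝒜 i j =
  let N = suc (suc n)
      pi = pos 𝒜 i ; pj = pos 𝒜 j
      allowed : ℕ → Bool
      allowed ℓ = if j <ᵇ i then ℓ ≤ᵇ i else i ≤ᵇ ℓ
      dccw = (pj + N ∸ pi) % N
      dcw  = (pi + N ∸ pj) % N
      ccwOK = allB (λ k → allowed (labelAt 𝒜 ((pi + k) % N))) (upTo (suc dccw))
  in if ccwOK then dccw else dcw

maxList : List ℕ → ℕ
maxList = foldr _⊔_ 0

pℓ : ∀ {n} → Orientation n → DiagSet → ℕ → ℕ
pℓ 𝒜 T i = maxList (map (μ 𝒜 i) (filterB (λ a → edgeT 𝒜 T a i) (upTo i)))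

pr : ∀ {n} → Orientation n → DiagSet → ℕ → ℕ
pr {n} 𝒜 T i =
  maxList (map (μ 𝒜 i) (filterB (λ b → edgeT 𝒜 T i b) (applyUpTo (λ k → suc i + k) (suc n ∸ i))))

ω : ∀ {n} → Orientation n → DiagSet → ℕ → ℕ
ω 𝒜 T i = pℓ 𝒜 T i * pr 𝒜 T i

xcoord : ∀ {n} → Orientation n → DiagSet → ℕ → ℤ
xcoord {n} 𝒜 T i = if isUp 𝒜 i then + (suc n) -ℤ + ω 𝒜 T i else + ω 𝒜 T i

-- M_𝒜(T) = (x_1, …, x_n);  coordinate index i : Fin n stands for label i+1
M : ∀ {n} → (𝒜 : Orientation n) → Triangulation 𝒜 → Vec ℚ n
M 𝒜 (T , _) = tabulate (λ i → xcoord 𝒜 T (suc (toℕ i)) / 1)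

inK : ∀ {n} → Orientation n → ℕ → ℕ → ℕ → Bool
inK 𝒜 a b i =
  let dn = isDoBar 𝒜 i ; up = isUp 𝒜 i in
  if isDoBar 𝒜 a
  then (if isDoBar 𝒜 b
        then dn ∧ (a <ᵇ i) ∧ (i <ᵇ b)
        else (dn ∧ (a <ᵇ i)) ∨ (up ∧ (b ≤ᵇ i)))
  else (if isUp 𝒜 b
        then dn ∨ (up ∧ ((i ≤ᵇ a) ∨ (b ≤ᵇ i)))
        else (dn ∧ (i <ᵇ b)) ∨ (up ∧ (i ≤ᵇ a)))

sumℚ : List ℚ → ℚ
sumℚ = foldr _+ℚ_ 0ℚ

ℕtoℚ : ℕ → ℚ
ℕtoℚ k = + k / 1

InH : ∀ {n} → Vec ℚ n → Set
InH {n} x = sumℚ (toList x) ≡ + (n * suc n) / 2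

InHalf : ∀ {n} → (ℕ → Bool) → Vec ℚ n → Set
InHalf {n} K x =
  let inKf : Fin n → Bool
      inKf i = K (suc (toℕ i))
      k = countIn K 1 n
      sIn  = sumℚ (map (λ i → if inKf i then lookup x i else 0ℚ) (allFin n))
      sOut = sumℚ (map (λ i → if inKf i then 0ℚ else lookup x i) (allFin n))
  in 0ℚ ≤ℚ (ℕtoℚ (n ∸ k) *ℚ sIn -ℚ ℕtoℚ k *ℚ sOut +ℚ + (n * k * (n ∸ k)) / 2)

InP : ∀ {n} → Orientation n → Vec ℚ n → Set
InP 𝒜 x = InH x × (∀ a b → IsDiagonal 𝒜 a b → InHalf (inK 𝒜 a b) x)

dot : ∀ {n} → Vec ℚ n → Vec ℚ n → ℚ
dot c y = sumℚ (toList (zipWith _*ℚ_ c y))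

IsFace : ∀ {n} → Orientation n → (Vec ℚ n → Set) → Set
IsFace {n} 𝒜 F =
  Σ (Vec ℚ n) λ c → Σ ℚ λ d →
    (∀ y → InP 𝒜 y → dot c y ≤ℚ d)
    × (∀ y → F y ⇔ (InP 𝒜 y × dot c y ≡ d))

IsVertex : ∀ {n} → Orientation n → Vec ℚ n → Set
IsVertex 𝒜 x = IsFace 𝒜 (λ y → y ≡ x)

Bounded : ∀ {n} → Orientation n → Set
Bounded {n} 𝒜 = Σ ℚ λ B → ∀ y → InP 𝒜 y → ∀ (i : Fin n) → (- B ≤ℚ lookup y i) × (lookup y i ≤ℚ B)

-- the poset of nonempty faces (ordered by inclusion) is isomorphic to the
-- poset of non-crossing diagonal sets of P under reverse inclusion
CombEquivAssociahedron : ∀ {n} → Orientation n → Set₁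
CombEquivAssociahedron {n} 𝒜 =
  Σ (NCSet 𝒜 → Vec ℚ n → Set) λ φ →
    (∀ S → IsFace 𝒜 (φ S) × Σ (Vec ℚ n) (φ S))
    × (∀ (F : Vec ℚ n → Set) → IsFace 𝒜 F → Σ (Vec ℚ n) F →
         Σ (NCSet 𝒜) λ S → ∀ y → F y ⇔ φ S y)
    × (∀ (S S′ : NCSet 𝒜) →
         (proj₁ S ⊆D proj₁ S′) ⇔ (∀ y → φ S′ y → φ S y))

{-# OPTIONS --safe #-}

-- With N = n+2, write pos a for the position of label a, r(b) = pos b, and l(a) = pos a
-- if a is down, pos a - N if a is up.  For a < b the indicator of K(a,b) is the difference
-- of a vector depending on b and a vector depending on a, and |K(a,b)| + 1 = r(b) - l(a).
-- For the doubled slacks δ(a,b) = 2 x(K(a,b)) - |K|(|K|+1) this gives two identities.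
-- (1) A triangle a < j < b contributes exactly the coordinate x_j = ω_j (or n+1-ω_j) when
--     its sides are tight; so all diagonals of T are tight at M(T).
-- (2) For labels w < y < z < v, δ(w,z) + δ(y,v) - δ(w,v) - δ(y,z) = 2(r(v)-r(z))(l(y)-l(w)),
--     and the sign says which of the two pairs of chords crosses.  Hence, crossing
--     diagonals of T step by step, every diagonal not in T has positive slack at M(T),
--     and tightness on T determines the point.
-- Faces: a linear functional c is an affine combination of the indicators of its level
-- sets {c < u}; each such set is, modulo the all-one vector, the sum of the K(a,b) over
-- the edges of a path from 0 to n+1, and paths of nested sets do not cross.  So the
-- maximal face of c is cut out by a non-crossing set of tight diagonals.
module Submission where

open import Defs
open import Data.Bool using (Bool; true; false; not; _∧_; _∨_; if_then_else_; T)
import Data.Bool.Properties as 𝔹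
open import Data.Empty using (⊥; ⊥-elim)
open import Data.Fin using (Fin; toℕ; fromℕ<; punchOut)
import Data.Fin.Properties as Finₚ
open import Data.Integer using (ℤ) renaming (+_ to +ℤ_; _-_ to _-ℤ_)
import Data.Integer as ℤ
import Data.Integer.Properties as Z
open import Data.List using (List; []; _∷_; map; upTo; applyUpTo; allFin; cartesianProduct)
import Data.List as List
import Data.List.Membership.Propositional as Mem
import Data.List.Membership.Propositional.Properties as Memₚ
open import Data.List.Relation.Binary.Permutation.Propositional using (↭-sym)
open import Data.List.Relation.Binary.Permutation.Propositional.Properties using (∈-resp-↭)
import Data.List.Relation.Unary.All as All
open import Data.List.Relation.Unary.Any using (here; there)
open import Data.List.Relation.Unary.Linked using (Linked; _∷_)
open import Data.Nat using (ℕ; zero; suc; _+_; _*_; _∸_; _<_; _≤_; _<ᵇ_; _≤ᵇ_; _≡ᵇ_; z≤n; s≤s)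
open import Data.Nat.DivMod using (_%_)
import Data.Nat.DivMod as DivMod
open import Data.Nat.Properties using (+-assoc; +-cancelʳ-<; +-cancelʳ-≤; +-cancelˡ-<; +-cancelˡ-≡; +-comm; +-identityʳ; +-monoʳ-<; +-monoʳ-≤; +-monoˡ-≤; +-suc; +-∸-assoc; 0≢1+n; 1+n≰n; <-asym; <-cmp; <-irrefl; <-trans; <-≤-trans; <ᵇ⇒<; <⇒<ᵇ; <⇒≢; <⇒≤; <⇒≱; m+[n∸m]≡n; m<m+n; m<n⇒0<n∸m; m∸n+n≡m; m∸n≤m; m≤m+n; m≤m⊔n; m≤n+m; m≤n+o⇒m∸n≤o; m≤n⇒m<n∨m≡n; m≤n⇒m≤1+n; m≤n⊔m; n≤1+n; suc-injective; _≟_; ≡ᵇ⇒≡; ≡⇒≡ᵇ; ≤-<-connex; ≤-<-trans; ≤-antisym; ≤-pred; ≤-refl; ≤-reflexive; ≤-total; ≤-trans; _≤?_; ≤ᵇ⇒≤; ≤⇒≯; ≤∧≢⇒<; ≮⇒≥; ⊔-lub)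
open import Data.Product using (Σ; ∃; _×_; _,_; proj₁; proj₂; map₂)
open import Data.Rational using (ℚ; _/_; 0ℚ; 1ℚ; -_; toℚᵘ) renaming (_+_ to _+ℚ_; _*_ to _*ℚ_; _-_ to _-ℚ_; _≤_ to _≤ℚ_; _<_ to _<ℚ_)
import Data.Rational as ℚ
import Data.Rational.Properties as Q
import Data.Rational.Unnormalised as ℚᵘ
import Data.Rational.Unnormalised.Properties as Qᵘ
open import Data.List.Sort Q.≤-decTotalOrder using (sort; sort-↗; sort-↭)
open import Data.Sum using (_⊎_; inj₁; inj₂; [_,_]′) renaming (swap to ⊎-swap)
open import Data.Unit using (tt)
open import Data.Vec using (Vec; toList; lookup; tabulate)
import Data.Vec as Vec
open import Function using (_∘_; case_of_)
open import Function.Bundles using (_⇔_; mk⇔; Equivalence)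
open import Level using (0ℓ)
open import Relation.Binary.Definitions using (tri<; tri≈; tri>)
open import Relation.Binary.PropositionalEquality using (_≡_; _≢_; refl; sym; trans; cong; cong₂; subst; subst₂; module ≡-Reasoning)
open import Relation.Nullary using (¬_; Dec; yes; no; contradiction)
open import Relation.Nullary.Decidable using (dec⇒maybe; ⌊_⌋; _→-dec_; _⊎-dec_; _×-dec_)
open import Tactic.RingSolver using (solve-∀)
open import Tactic.RingSolver.Core.AlmostCommutativeRing using (AlmostCommutativeRing; fromCommutativeRing)

-- Two orders compete. Crossings, triangles and the recursion over a triangulation live in the order
-- of positions, cut open so that the side between the first and the last position becomes a root
-- edge. Slacks and the sets K depend on which label of a chord is smaller. The dictionary between
-- the two is the pair of types of the two middle labels of a crossing quadruple, and the same pair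
-- gives the sign in (2). An up label in the middle of a triangle makes the two arcs overshoot by N,
-- and (1) then picks up the deviation from H. That deviation is therefore carried along and seen to
-- vanish at the root edge; the coordinates are never summed up directly. Faces are treated through
-- maximisation. The set of diagonals attached to a functional is optimal relative to any point
-- tight on it, and M(T) is such a point for every triangulation T containing the set. Boundedness,
-- the list of faces and the vertices all follow from this. That smaller faces have larger diagonal
-- sets needs one more construction: a triangulation that extends S and avoids a given diagonal
-- outside S, obtained by a flip.

ℚ-ring : AlmostCommutativeRing 0ℓ 0ℓ
ℚ-ring = fromCommutativeRing Q.+-*-commutativeRing (λ x → dec⇒maybe (0ℚ Q.≟ x))

-- Arithmetic and order of integers embedded in the rationals.

fromℤ : ℤ → ℚ
fromℤ z = z / 1

fromℤ-homo-+ : ∀ a b → fromℤ (a ℤ.+ b) ≡ fromℤ a +ℚ fromℤ b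
fromℤ-homo-+ a b = Q.toℚᵘ-injective (begin
  toℚᵘ (fromℤ (a ℤ.+ b))                       ≈⟨ Q.toℚᵘ-fromℚᵘ (ℚᵘ.mkℚᵘ (a ℤ.+ b) 0) ⟩
  ℚᵘ.mkℚᵘ (a ℤ.+ b) 0                          ≈⟨ ℚᵘ.*≡* (cong₂ (λ u v → (u ℤ.+ v) ℤ.* ℤ.1ℤ) (sym (Z.*-identityʳ a)) (sym (Z.*-identityʳ b))) ⟩
  ℚᵘ.mkℚᵘ a 0 ℚᵘ.+ ℚᵘ.mkℚᵘ b 0                 ≈⟨ Qᵘ.+-cong (Q.toℚᵘ-fromℚᵘ (ℚᵘ.mkℚᵘ a 0)) (Q.toℚᵘ-fromℚᵘ (ℚᵘ.mkℚᵘ b 0)) ⟨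
  toℚᵘ (fromℤ a) ℚᵘ.+ toℚᵘ (fromℤ b)           ≈⟨ Q.toℚᵘ-homo-+ (fromℤ a) (fromℤ b) ⟨
  toℚᵘ (fromℤ a +ℚ fromℤ b)                    ∎)
  where open Qᵘ.≃-Reasoning

fromℤ-homo-* : ∀ a b → fromℤ (a ℤ.* b) ≡ fromℤ a *ℚ fromℤ b
fromℤ-homo-* a b = Q.toℚᵘ-injective (begin
  toℚᵘ (fromℤ (a ℤ.* b))                       ≈⟨ Q.toℚᵘ-fromℚᵘ (ℚᵘ.mkℚᵘ (a ℤ.* b) 0) ⟩
  ℚᵘ.mkℚᵘ a 0 ℚᵘ.* ℚᵘ.mkℚᵘ b 0                 ≈⟨ Qᵘ.*-cong (Q.toℚᵘ-fromℚᵘ (ℚᵘ.mkℚᵘ a 0)) (Q.toℚᵘ-fromℚᵘ (ℚᵘ.mkℚᵘ b 0)) ⟨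
  toℚᵘ (fromℤ a) ℚᵘ.* toℚᵘ (fromℤ b)           ≈⟨ Q.toℚᵘ-homo-* (fromℤ a) (fromℤ b) ⟨
  toℚᵘ (fromℤ a *ℚ fromℤ b)                    ∎)
  where open Qᵘ.≃-Reasoning

fromℤ-homo-sub : ∀ a b → fromℤ (a -ℤ b) ≡ fromℤ a -ℚ fromℤ b
fromℤ-homo-sub a b = begin
  fromℤ (a -ℤ b)                             ≡⟨ lem (fromℤ (a -ℤ b)) (fromℤ b) ⟩
  (fromℤ (a -ℤ b) +ℚ fromℤ b) -ℚ fromℤ b     ≡⟨ cong (_-ℚ fromℤ b) (fromℤ-homo-+ (a -ℤ b) b) ⟨
  fromℤ ((a -ℤ b) ℤ.+ b) -ℚ fromℤ b          ≡⟨ cong (λ z → fromℤ z -ℚ fromℤ b) a-b+b≡a ⟩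
  fromℤ a -ℚ fromℤ b                         ∎
  where
  open ≡-Reasoning
  lem : ∀ x y → x ≡ (x +ℚ y) -ℚ y
  lem = solve-∀ ℚ-ring
  a-b+b≡a : (a -ℤ b) ℤ.+ b ≡ a
  a-b+b≡a = trans (Z.+-assoc a (ℤ.- b) b) (trans (cong (λ z → a ℤ.+ z) (Z.+-inverseˡ b)) (Z.+-identityʳ a))

-- Opaque on purpose: unfolding `ι` would expose the gcd normalisation inside `_/_` to conversion
-- checking. Outside this block it is handled through the laws stated here.
abstract
  ι : ℕ → ℚ
  ι = ℕtoℚ

  ι≡ℕtoℚ : ∀ a → ι a ≡ ℕtoℚ a
  ι≡ℕtoℚ a = refl

  ι-0 : ι 0 ≡ 0ℚ
  ι-0 = refl

  ι-1 : ι 1 ≡ 1ℚ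
  ι-1 = refl

  ι-+ : ∀ a b → ι (a + b) ≡ ι a +ℚ ι b
  ι-+ a b = fromℤ-homo-+ (+ℤ a) (+ℤ b)

  ι-* : ∀ a b → ι (a * b) ≡ ι a *ℚ ι b
  ι-* a b = trans (cong fromℤ (Z.pos-* a b)) (fromℤ-homo-* (+ℤ a) (+ℤ b))

  0≤ι : ∀ a → 0ℚ ≤ℚ ι a
  0≤ι a = Q.nonNegative⁻¹ (ι a) {{Q.normalize-nonNeg a 1}}

  0<ι-suc : ∀ a → 0ℚ <ℚ ι (suc a)
  0<ι-suc a = Q.positive⁻¹ (ι (suc a)) {{Q.normalize-pos (suc a) 1}}

ι-suc : ∀ a → ι (suc a) ≡ 1ℚ +ℚ ι a
ι-suc a = trans (ι-+ 1 a) (cong (_+ℚ ι a) ι-1)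

ι-∸ : ∀ {a b} → b ≤ a → ι (a ∸ b) ≡ ι a -ℚ ι b
ι-∸ {a} {b} b≤a = trans (lem (ι (a ∸ b)) (ι b)) (cong (_-ℚ ι b) (trans (sym (ι-+ (a ∸ b) b)) (cong ι (m∸n+n≡m b≤a))))
  where
  lem : ∀ x y → x ≡ (x +ℚ y) -ℚ y
  lem = solve-∀ ℚ-ring

0≤-diff : ∀ {x y} → x ≤ℚ y → 0ℚ ≤ℚ y -ℚ x
0≤-diff {x} {y} p = subst (_≤ℚ y -ℚ x) (Q.+-inverseʳ x) (Q.+-monoˡ-≤ (- x) p)

diff-0≤ : ∀ {x y} → 0ℚ ≤ℚ y -ℚ x → x ≤ℚ y
diff-0≤ {x} {y} p = subst₂ _≤ℚ_ (Q.+-identityˡ x) (lem y x) (Q.+-monoˡ-≤ x p)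
  where
  lem : ∀ y x → (y -ℚ x) +ℚ x ≡ y
  lem = solve-∀ ℚ-ring

0<-diff : ∀ {x y} → x <ℚ y → 0ℚ <ℚ y -ℚ x
0<-diff {x} {y} p = subst (_<ℚ y -ℚ x) (Q.+-inverseʳ x) (Q.+-monoˡ-< (- x) p)

diff-0< : ∀ {x y} → 0ℚ <ℚ y -ℚ x → x <ℚ y
diff-0< {x} {y} p = subst₂ _<ℚ_ (Q.+-identityˡ x) (lem y x) (Q.+-monoˡ-< x p)
  where
  lem : ∀ y x → (y -ℚ x) +ℚ x ≡ y
  lem = solve-∀ ℚ-ring

diff≡0 : ∀ {x y} → x -ℚ y ≡ 0ℚ → x ≡ y
diff≡0 {x} {y} e = trans (lem x y) (trans (cong (_+ℚ y) e) (Q.+-identityˡ y))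
  where
  lem : ∀ x y → x ≡ (x -ℚ y) +ℚ y
  lem = solve-∀ ℚ-ring

0≤+ : ∀ {x y} → 0ℚ ≤ℚ x → 0ℚ ≤ℚ y → 0ℚ ≤ℚ x +ℚ y
0≤+ = Q.+-mono-≤

0<+ʳ : ∀ {x y} → 0ℚ ≤ℚ x → 0ℚ <ℚ y → 0ℚ <ℚ x +ℚ y
0<+ʳ = Q.+-mono-≤-<

0≤* : ∀ {x y} → 0ℚ ≤ℚ x → 0ℚ ≤ℚ y → 0ℚ ≤ℚ x *ℚ y
0≤* {x} {y} p q = Q.nonNegative⁻¹ _ {{Q.nonNeg*nonNeg⇒nonNeg x {{ℚ.nonNegative p}} y {{ℚ.nonNegative q}}}}

0<* : ∀ {x y} → 0ℚ <ℚ x → 0ℚ <ℚ y → 0ℚ <ℚ x *ℚ y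
0<* {x} {y} p q = Q.positive⁻¹ _ {{Q.pos*pos⇒pos x {{ℚ.positive p}} y {{ℚ.positive q}}}}

0≤*⁻ : ∀ {x y} → 0ℚ <ℚ x → 0ℚ ≤ℚ x *ℚ y → 0ℚ ≤ℚ y
0≤*⁻ {x} {y} p q = Q.*-cancelˡ-≤-pos x {{ℚ.positive p}} (subst (_≤ℚ x *ℚ y) (sym (Q.*-zeroʳ x)) q)

*≡0⁻ : ∀ {x y} → 0ℚ <ℚ x → x *ℚ y ≡ 0ℚ → y ≡ 0ℚ
*≡0⁻ {x} {y} p e = Q.≤-antisym
  (Q.*-cancelˡ-≤-pos x {{ℚ.positive p}} (Q.≤-reflexive (trans e (sym (Q.*-zeroʳ x)))))
  (Q.*-cancelˡ-≤-pos x {{ℚ.positive p}} (Q.≤-reflexive (trans (Q.*-zeroʳ x) (sym e))))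

0≤+≡0 : ∀ {x y} → 0ℚ ≤ℚ x → 0ℚ ≤ℚ y → x +ℚ y ≡ 0ℚ → x ≡ 0ℚ × y ≡ 0ℚ
0≤+≡0 {x} {y} p q e =
  Q.≤-antisym (subst₂ _≤ℚ_ (Q.+-identityʳ x) e (Q.+-monoʳ-≤ x q)) p ,
  Q.≤-antisym (subst₂ _≤ℚ_ (Q.+-identityˡ y) e (Q.+-monoˡ-≤ y p)) q

ι-mono-< : ∀ {a b} → a < b → ι a <ℚ ι b
ι-mono-< {a} {suc b} (s≤s a≤b) = diff-0< (subst (0ℚ <ℚ_) (ι-∸ (m≤n⇒m≤1+n a≤b))
  (subst (λ k → 0ℚ <ℚ ι k) (sym (+-∸-assoc 1 a≤b)) (0<ι-suc (b ∸ a))))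

ι-injective : ∀ {a b} → ι a ≡ ι b → a ≡ b
ι-injective {a} {b} e with <-cmp a b
... | tri< a<b _ _ = contradiction e (Q.<⇒≢ (ι-mono-< a<b))
... | tri≈ _ a≡b _ = a≡b
... | tri> _ _ b<a = contradiction (sym e) (Q.<⇒≢ (ι-mono-< b<a))

2ℚ : ℚ
2ℚ = 1ℚ +ℚ 1ℚ

0<2ℚ : 0ℚ <ℚ 2ℚ
0<2ℚ = Q.positive⁻¹ 2ℚ

-- Clears the halves in `InH` and `InHalf`; slacks are doubled throughout for this reason.
2*half : ∀ m → 2ℚ *ℚ (+ℤ m / 2) ≡ ι m
2*half m = trans (Q.toℚᵘ-injective (begin
  toℚᵘ (2ℚ *ℚ (+ℤ m / 2))            ≈⟨ Q.toℚᵘ-homo-* 2ℚ (+ℤ m / 2) ⟩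
  toℚᵘ 2ℚ ℚᵘ.* toℚᵘ (+ℤ m / 2)       ≈⟨ Qᵘ.*-congˡ {toℚᵘ 2ℚ} (Q.toℚᵘ-fromℚᵘ (ℚᵘ.mkℚᵘ (+ℤ m) 1)) ⟩
  toℚᵘ 2ℚ ℚᵘ.* ℚᵘ.mkℚᵘ (+ℤ m) 1      ≈⟨ ℚᵘ.*≡* (trans (Z.*-identityʳ _) (Z.*-comm (+ℤ 2) (+ℤ m))) ⟩
  ℚᵘ.mkℚᵘ (+ℤ m) 0                   ≈⟨ Q.toℚᵘ-fromℚᵘ (ℚᵘ.mkℚᵘ (+ℤ m) 0) ⟨
  toℚᵘ (ℕtoℚ m)                      ∎)) (sym (ι≡ℕtoℚ m))
  where open Qᵘ.≃-Reasoning

-- Finite sums over intervals of naturals.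

ind : Bool → ℚ
ind b = if b then 1ℚ else 0ℚ

∑ : ℕ → ℕ → (ℕ → ℚ) → ℚ
∑ a zero    f = 0ℚ
∑ a (suc l) f = f a +ℚ ∑ (suc a) l f

∑-cong : ∀ a l {f g} → (∀ i → a ≤ i → i < a + l → f i ≡ g i) → ∑ a l f ≡ ∑ a l g
∑-cong a zero    h = refl
∑-cong a (suc l) h = cong₂ _+ℚ_ (h a ≤-refl (m<m+n a (s≤s z≤n)))
  (∑-cong (suc a) l (λ i a<i i< → h i (<⇒≤ a<i) (subst (i <_) (sym (+-suc a l)) i<)))

∑-+ : ∀ a l f g → ∑ a l (λ i → f i +ℚ g i) ≡ ∑ a l f +ℚ ∑ a l g
∑-+ a zero    f g = refl
∑-+ a (suc l) f g = trans (cong ((f a +ℚ g a) +ℚ_) (∑-+ (suc a) l f g)) (lem (f a) (g a) (∑ (suc a) l f) (∑ (suc a) l g))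
  where
  lem : ∀ w x y z → (w +ℚ x) +ℚ (y +ℚ z) ≡ (w +ℚ y) +ℚ (x +ℚ z)
  lem = solve-∀ ℚ-ring

∑-* : ∀ a l c f → ∑ a l (λ i → c *ℚ f i) ≡ c *ℚ ∑ a l f
∑-* a zero    c f = sym (Q.*-zeroʳ c)
∑-* a (suc l) c f = trans (cong (c *ℚ f a +ℚ_) (∑-* (suc a) l c f)) (sym (Q.*-distribˡ-+ c (f a) _))

∑-sub : ∀ a l f g → ∑ a l (λ i → f i -ℚ g i) ≡ ∑ a l f -ℚ ∑ a l g
∑-sub a zero    f g = refl
∑-sub a (suc l) f g = trans (cong ((f a -ℚ g a) +ℚ_) (∑-sub (suc a) l f g)) (lem (f a) (g a) (∑ (suc a) l f) (∑ (suc a) l g))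
  where
  lem : ∀ w x y z → (w -ℚ x) +ℚ (y -ℚ z) ≡ (w +ℚ y) -ℚ (x +ℚ z)
  lem = solve-∀ ℚ-ring

∑-zero : ∀ a l {f} → (∀ i → a ≤ i → i < a + l → f i ≡ 0ℚ) → ∑ a l f ≡ 0ℚ
∑-zero a zero    h = refl
∑-zero a (suc l) h = cong₂ _+ℚ_ (h a ≤-refl (m<m+n a (s≤s z≤n)))
  (∑-zero (suc a) l (λ i a<i i< → h i (<⇒≤ a<i) (subst (i <_) (sym (+-suc a l)) i<)))

∑-delta : ∀ a l j f → a ≤ j → j < a + l → (∀ i → i ≢ j → f i ≡ 0ℚ) → ∑ a l f ≡ f j
∑-delta a zero    j f a≤j j< h = contradiction (≤-<-trans a≤j (subst (j <_) (+-identityʳ a) j<)) (<-irrefl refl)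
∑-delta a (suc l) j f a≤j j< h with m≤n⇒m<n∨m≡n a≤j
... | inj₂ refl = trans (cong (f a +ℚ_) (∑-zero (suc a) l (λ i a<i _ → h i (λ e → <-irrefl (sym e) a<i)))) (Q.+-identityʳ (f a))
... | inj₁ a<j = trans (cong₂ _+ℚ_ (h a (<⇒≢ a<j)) (∑-delta (suc a) l j f a<j (subst (j <_) (+-suc a l) j<) h)) (Q.+-identityˡ (f j))

∑-split : ∀ a k l f → ∑ a (k + l) f ≡ ∑ a k f +ℚ ∑ (a + k) l f
∑-split a zero    l f = trans (cong (λ b → ∑ b l f) (sym (+-identityʳ a))) (sym (Q.+-identityˡ _))
∑-split a (suc k) l f = trans (cong (f a +ℚ_) (trans (∑-split (suc a) k l f) (cong (λ b → ∑ (suc a) k f +ℚ ∑ b l f) (sym (+-suc a k)))))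
  (sym (Q.+-assoc (f a) _ _))

∑-0≤ : ∀ a l {f} → (∀ i → 0ℚ ≤ℚ f i) → 0ℚ ≤ℚ ∑ a l f
∑-0≤ a zero    h = Q.≤-refl
∑-0≤ a (suc l) h = 0≤+ (h a) (∑-0≤ (suc a) l h)

∑≡0⇒≡0 : ∀ a l {f} → (∀ i → 0ℚ ≤ℚ f i) → ∑ a l f ≡ 0ℚ → ∀ i → a ≤ i → i < a + l → f i ≡ 0ℚ
∑≡0⇒≡0 a zero    h e i a≤i i< = contradiction (≤-<-trans a≤i (subst (i <_) (+-identityʳ a) i<)) (<-irrefl refl)
∑≡0⇒≡0 a (suc l) h e i a≤i i< with 0≤+≡0 (h a) (∑-0≤ (suc a) l h) e | m≤n⇒m<n∨m≡n a≤i
... | e₁ , _  | inj₂ refl = e₁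
... | _  , e₂ | inj₁ a<i  = ∑≡0⇒≡0 (suc a) l h e₂ i a<i (subst (i <_) (+-suc a l) i<)

ι-countIn : ∀ p a l → ι (countIn p a l) ≡ ∑ a l (λ i → ind (p i))
ι-countIn p a zero    = ι-0
ι-countIn p a (suc l) with p a
... | true  = trans (ι-suc (countIn p (suc a) l)) (cong (1ℚ +ℚ_) (ι-countIn p (suc a) l))
... | false = trans (ι-countIn p (suc a) l) (sym (Q.+-identityˡ _))

∑-one : ∀ a l → ∑ a l (λ _ → 1ℚ) ≡ ι l
∑-one a zero    = sym ι-0
∑-one a (suc l) = trans (cong (1ℚ +ℚ_) (∑-one (suc a) l)) (sym (ι-suc l))

-- Booleans, comparisons and counting.

<≤⇒≤ : ∀ {a b c} → a < b → b ≤ c → a ≤ c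
<≤⇒≤ a<b b≤c = <⇒≤ (<-≤-trans a<b b≤c)

≡false : ∀ {b} → b ≢ true → b ≡ false
≡false {true}  h = contradiction refl h
≡false {false} h = refl

bool : ∀ b → b ≡ true ⊎ b ≡ false
bool true  = inj₁ refl
bool false = inj₂ refl

true≢false : ∀ {b} → b ≡ true → b ≡ false → ⊥
true≢false refl ()

countIn-+ : ∀ p a k l → countIn p a (k + l) ≡ countIn p a k + countIn p (a + k) l
countIn-+ p a zero    l = cong (λ b → countIn p b l) (sym (+-identityʳ a))
countIn-+ p a (suc k) l = trans (cong ((if p a then 1 else 0) +_)
  (trans (countIn-+ p (suc a) k l) (cong (λ b → countIn p (suc a) k + countIn p b l) (sym (+-suc a k)))))
  (sym (+-assoc (if p a then 1 else 0) _ _))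

countIn-true : ∀ p a l → p a ≡ true → countIn p a (suc l) ≡ suc (countIn p (suc a) l)
countIn-true p a l e rewrite e = refl

countIn-∸ : ∀ p {a b c} → a ≤ b → b ≤ c → countIn p a (c ∸ a) ≡ countIn p a (b ∸ a) + countIn p b (c ∸ b)
countIn-∸ p {a} {b} {c} a≤b b≤c = trans (cong (countIn p a) c-a≡) (trans (countIn-+ p a (b ∸ a) (c ∸ b))
  (cong (λ d → countIn p a (b ∸ a) + countIn p d (c ∸ b)) (m+[n∸m]≡n a≤b)))
  where
  c-a≡ : c ∸ a ≡ (b ∸ a) + (c ∸ b)
  c-a≡ = sym (+-cancelˡ-≡ a _ _ (trans (sym (+-assoc a (b ∸ a) (c ∸ b)))
    (trans (cong (_+ (c ∸ b)) (m+[n∸m]≡n a≤b)) (trans (m+[n∸m]≡n b≤c) (sym (m+[n∸m]≡n (≤-trans a≤b b≤c)))))))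

countIn-complement : ∀ p a l → countIn p a l + countIn (not ∘ p) a l ≡ l
countIn-complement p a zero    = refl
countIn-complement p a (suc l) with p a
... | true  = cong suc (countIn-complement p (suc a) l)
... | false = trans (+-suc _ _) (cong suc (countIn-complement p (suc a) l))

nth-beyond : ∀ {m} (v : Vec Bool m) k → m ≤ k → nth (toList v) k ≡ false
nth-beyond Vec.[]       k       m≤k       = refl
nth-beyond (x Vec.∷ v)  (suc k) (s≤s m≤k) = nth-beyond v k m≤k

-- Pigeonhole: if `p` were missed, punching it out of the codomain would leave an injection from
-- `Fin (suc m)` to `Fin m`.
injective⇒surjective : ∀ m (f : ℕ → ℕ) → (∀ a → a ≤ m → f a ≤ m) → (∀ a b → a ≤ m → b ≤ m → f a ≡ f b → a ≡ b) →
  ∀ p → p ≤ m → ∃ λ a → a ≤ m × f a ≡ p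
injective⇒surjective m f bound inj p p≤m with Finₚ.any? (λ (i : Fin (suc m)) → f (toℕ i) ≟ p)
... | yes (i , e) = toℕ i , Finₚ.toℕ≤pred[n] i , e
... | no ¬∃ = contradiction (Finₚ.injective⇒≤ g-injective) 1+n≰n
  where
  f′ : Fin (suc m) → Fin (suc m)
  f′ i = fromℕ< (s≤s (bound (toℕ i) (Finₚ.toℕ≤pred[n] i)))
  toℕ-f′ : ∀ i → toℕ (f′ i) ≡ f (toℕ i)
  toℕ-f′ i = Finₚ.toℕ-fromℕ< _
  p′ : Fin (suc m)
  p′ = fromℕ< (s≤s p≤m)
  p′≢f′ : ∀ i → p′ ≢ f′ i
  p′≢f′ i e = ¬∃ (i , trans (sym (toℕ-f′ i)) (trans (cong toℕ (sym e)) (Finₚ.toℕ-fromℕ< _)))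
  g : Fin (suc m) → Fin m
  g i = punchOut (p′≢f′ i)
  g-injective : ∀ {i j} → g i ≡ g j → i ≡ j
  g-injective {i} {j} e = Finₚ.toℕ-injective (inj _ _ (Finₚ.toℕ≤pred[n] i) (Finₚ.toℕ≤pred[n] j)
    (trans (sym (toℕ-f′ i)) (trans (cong toℕ (Finₚ.punchOut-injective (p′≢f′ i) (p′≢f′ j) e)) (toℕ-f′ j))))

<⇒<ᵇ-true : ∀ {m n} → m < n → (m <ᵇ n) ≡ true
<⇒<ᵇ-true {m} {n} p with m <ᵇ n | <⇒<ᵇ p
... | true | _ = refl

<ᵇ-true⇒< : ∀ {m n} → (m <ᵇ n) ≡ true → m < n
<ᵇ-true⇒< {m} {n} e = <ᵇ⇒< m n (subst T (sym e) tt)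

≤ᵇ≡not<ᵇ : ∀ m n → (m ≤ᵇ n) ≡ not (n <ᵇ m)
≤ᵇ≡not<ᵇ zero    n       = refl
≤ᵇ≡not<ᵇ (suc m) zero    = refl
≤ᵇ≡not<ᵇ (suc m) (suc n) = trans (suc≤ᵇsuc m n) (≤ᵇ≡not<ᵇ m n)
  where
  suc≤ᵇsuc : ∀ m n → (suc m ≤ᵇ suc n) ≡ (m ≤ᵇ n)
  suc≤ᵇsuc zero    n = refl
  suc≤ᵇsuc (suc m) n = refl

≥⇒<ᵇ-false : ∀ {m n} → n ≤ m → (m <ᵇ n) ≡ false
≥⇒<ᵇ-false n≤m = ≡false λ e → <⇒≱ (<ᵇ-true⇒< e) n≤m

≤⇒≤ᵇ-true : ∀ {m n} → m ≤ n → (m ≤ᵇ n) ≡ true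
≤⇒≤ᵇ-true {m} {n} p = trans (≤ᵇ≡not<ᵇ m n) (cong not (≥⇒<ᵇ-false p))

>⇒≤ᵇ-false : ∀ {m n} → n < m → (m ≤ᵇ n) ≡ false
>⇒≤ᵇ-false {m} {n} p = trans (≤ᵇ≡not<ᵇ m n) (cong not (<⇒<ᵇ-true p))

≤ᵇ-true⇒≤ : ∀ {m n} → (m ≤ᵇ n) ≡ true → m ≤ n
≤ᵇ-true⇒≤ {m} {n} e = ≤ᵇ⇒≤ m n (subst T (sym e) tt)

≡ᵇ-true⇒≡ : ∀ {m n} → (m ≡ᵇ n) ≡ true → m ≡ n
≡ᵇ-true⇒≡ {m} {n} e = ≡ᵇ⇒≡ m n (subst T (sym e) tt)

≡⇒≡ᵇ-true : ∀ {m n} → m ≡ n → (m ≡ᵇ n) ≡ true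
≡⇒≡ᵇ-true {m} {n} p with m ≡ᵇ n | ≡⇒≡ᵇ m n p
... | true | _ = refl

≢⇒≡ᵇ-false : ∀ {m n} → m ≢ n → (m ≡ᵇ n) ≡ false
≢⇒≡ᵇ-false m≢n = ≡false λ e → m≢n (≡ᵇ-true⇒≡ e)

∧-true : ∀ {a b} → a ∧ b ≡ true → a ≡ true × b ≡ true
∧-true {true} {true} e = refl , refl

∨-true : ∀ {a b} → a ∨ b ≡ true → a ≡ true ⊎ b ≡ true
∨-true {true}  e = inj₁ refl
∨-true {false} e = inj₂ e

∨-trueˡ : ∀ {a} b → a ≡ true → a ∨ b ≡ true
∨-trueˡ b refl = refl

∨-trueʳ : ∀ a {b} → b ≡ true → a ∨ b ≡ true
∨-trueʳ true  e = refl
∨-trueʳ false e = e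

min′-≤ : ∀ {x y} → x ≤ y → min′ x y ≡ x
min′-≤ {x} {y} x≤y = cong (λ b → if b then x else y) (≤⇒≤ᵇ-true x≤y)

max′-≤ : ∀ {x y} → x ≤ y → max′ x y ≡ y
max′-≤ {x} {y} x≤y = cong (λ b → if b then y else x) (≤⇒≤ᵇ-true x≤y)

min′-comm : ∀ x y → min′ x y ≡ min′ y x
min′-comm x y with <-cmp x y
... | tri≈ _ refl _ = refl
... | tri< x<y _ _ = trans (min′-≤ (<⇒≤ x<y)) (sym (cong (λ b → if b then y else x) (>⇒≤ᵇ-false x<y)))
... | tri> _ _ y<x = trans (cong (λ b → if b then x else y) (>⇒≤ᵇ-false y<x)) (sym (min′-≤ (<⇒≤ y<x)))

max′-comm : ∀ x y → max′ x y ≡ max′ y x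
max′-comm x y with <-cmp x y
... | tri≈ _ refl _ = refl
... | tri< x<y _ _ = trans (max′-≤ (<⇒≤ x<y)) (sym (cong (λ b → if b then x else y) (>⇒≤ᵇ-false x<y)))
... | tri> _ _ y<x = trans (cong (λ b → if b then y else x) (>⇒≤ᵇ-false y<x)) (sym (max′-≤ (<⇒≤ y<x)))

∑-prefix : ∀ p n b → b ≤ n → ∑ 1 n (λ i → ind (p i ∧ (i ≤ᵇ b))) ≡ ι (countIn p 1 b)
∑-prefix p n b b≤n = trans (cong (λ k → ∑ 1 k f) (sym (m+[n∸m]≡n b≤n))) (trans (∑-split 1 b (n ∸ b) f)
  (trans (cong₂ _+ℚ_ inside outside) (trans (Q.+-identityʳ _) (sym (ι-countIn p 1 b)))))
  where
  f : ℕ → ℚ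
  f i = ind (p i ∧ (i ≤ᵇ b))
  inside : ∑ 1 b f ≡ ∑ 1 b (λ i → ind (p i))
  inside = ∑-cong 1 b λ { i _ (s≤s i≤b) → cong ind (trans (cong (p i ∧_) (≤⇒≤ᵇ-true i≤b)) (𝔹.∧-identityʳ (p i))) }
  outside : ∑ (suc b) (n ∸ b) f ≡ 0ℚ
  outside = ∑-zero (suc b) (n ∸ b) λ i b<i _ → cong ind (trans (cong (p i ∧_) (>⇒≤ᵇ-false b<i)) (𝔹.∧-zeroʳ (p i)))

∑-suffix : ∀ p n b → b ≤ n → ∑ 1 n (λ i → ind (p i ∧ (suc b ≤ᵇ i))) ≡ ι (countIn p (suc b) (n ∸ b))
∑-suffix p n b b≤n = trans (cong (λ k → ∑ 1 k f) (sym (m+[n∸m]≡n b≤n))) (trans (∑-split 1 b (n ∸ b) f)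
  (trans (cong₂ _+ℚ_ outside inside) (trans (Q.+-identityˡ _) (sym (ι-countIn p (suc b) (n ∸ b))))))
  where
  f : ℕ → ℚ
  f i = ind (p i ∧ (suc b ≤ᵇ i))
  outside : ∑ 1 b f ≡ 0ℚ
  outside = ∑-zero 1 b λ { i _ i<1+b → cong ind (trans (cong (p i ∧_) (>⇒≤ᵇ-false i<1+b)) (𝔹.∧-zeroʳ (p i))) }
  inside : ∑ (suc b) (n ∸ b) f ≡ ∑ (suc b) (n ∸ b) (λ i → ind (p i))
  inside = ∑-cong (suc b) (n ∸ b) λ i b<i _ → cong ind (trans (cong (p i ∧_) (≤⇒≤ᵇ-true b<i)) (𝔹.∧-identityʳ (p i)))

0<-*-neg : ∀ {x y} → x <ℚ 0ℚ → y <ℚ 0ℚ → 0ℚ <ℚ x *ℚ y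
0<-*-neg {x} {y} p q = Q.positive⁻¹ _ {{Q.neg*neg⇒pos x {{ℚ.negative p}} y {{ℚ.negative q}}}}

<-diff-neg : ∀ {x y} → x <ℚ y → x -ℚ y <ℚ 0ℚ
<-diff-neg {x} {y} p = subst (x -ℚ y <ℚ_) (Q.+-inverseʳ y) (Q.+-monoˡ-< (- y) p)

-- Non-crossing chords on a line of positions.

searchMax : ∀ {P : ℕ → Set} → (∀ k → Dec (P k)) → ∀ q →
            (∃ λ m → m < q × P m × (∀ k → m < k → k < q → ¬ P k)) ⊎ (∀ k → k < q → ¬ P k)
searchMax P? zero = inj₂ λ _ ()
searchMax P? (suc q) with P? q
... | yes Pq = inj₁ (q , ≤-refl , Pq , λ { k q<k (s≤s k≤q) → contradiction q<k (≤⇒≯ k≤q) })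
... | no ¬Pq with searchMax P? q
...   | inj₁ (m , m<q , Pm , max) = inj₁ (m , m≤n⇒m≤1+n m<q , Pm , still)
  where
  still : ∀ k → m < k → k < suc q → ¬ _
  still k m<k (s≤s k≤q) with m≤n⇒m<n∨m≡n k≤q
  ... | inj₁ k<q  = max k m<k k<q
  ... | inj₂ refl = ¬Pq
...   | inj₂ none = inj₂ none′
  where
  none′ : ∀ k → k < suc q → ¬ _
  none′ k (s≤s k≤q) with m≤n⇒m<n∨m≡n k≤q
  ... | inj₁ k<q  = none k k<q
  ... | inj₂ refl = ¬Pq

module Chords (top : ℕ) (C : ℕ → ℕ → Set) (C? : ∀ p q → Dec (C p q))
  (bound : ∀ p q → C p q → q ≤ top)
  (noncrossing : ∀ p q r s → C p q → C r s → p < r → r < q → q < s → ⊥) where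

  -- Chords together with all sides of the polygon; the last disjunct is the side that joins the two
  -- ends of the line.
  E : ℕ → ℕ → Set
  E p q = q ≡ suc p ⊎ C p q ⊎ (p ≡ 0 × q ≡ top)

  E? : ∀ p q → Dec (E p q)
  E? p q = (q ≟ suc p) ⊎-dec (C? p q ⊎-dec ((p ≟ 0) ×-dec (q ≟ top)))

  E-noncrossing : ∀ {p q r s} → E p q → E r s → p < r → r < q → q < s → ⊥
  E-noncrossing (inj₁ refl) _ p<r (s≤s r≤p) q<s = <⇒≱ p<r r≤p
  E-noncrossing (inj₂ _) (inj₁ refl) p<r r<q (s≤s q≤r) = <⇒≱ r<q q≤r
  E-noncrossing (inj₂ _) (inj₂ (inj₂ (refl , _))) () r<q q<s
  E-noncrossing {r = r} {s} (inj₂ (inj₂ (_ , refl))) (inj₂ (inj₁ c)) p<r r<q q<s = <⇒≱ q<s (bound r s c)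
  E-noncrossing {p} {q} {r} {s} (inj₂ (inj₁ c)) (inj₂ (inj₁ c′)) p<r r<q q<s = noncrossing p q r s c c′ p<r r<q q<s

  Compatible : ℕ → ℕ → Set
  Compatible p q = (∀ r s → C r s → r < p → p < s → s < q → ⊥) × (∀ r s → C r s → p < r → r < q → q < s → ⊥)

  -- Finds the vertex next to `p` of the region just inside `p`-`q`; the side from `p` to `suc p`
  -- guarantees a candidate.
  furthest : ∀ p q → suc p < q → ∃ λ m → p < m × m < q × E p m × (∀ k → m < k → k < q → ¬ E p k)
  furthest p q 1+p<q with searchMax (λ k → (suc p ≤? k) ×-dec E? p k) q
  ... | inj₁ (m , m<q , (p<m , e) , max) = m , p<m , m<q , e , λ k m<k k<q e′ → max k m<k k<q (<-trans p<m m<k , e′)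
  ... | inj₂ none = ⊥-elim (none (suc p) 1+p<q (≤-refl , inj₁ refl))

  -- The missing chord `p`-`q` is a diagonal of one region of the dissection. With `u` next to `p`
  -- on its inner side and `v` next to `q` on its outer side, both on the boundary of that region,
  -- `u`-`v` crosses `p`-`q` but no chord.
  flip : ∀ p q → p < q → q ≤ top → ¬ E p q → Compatible p q →
         ∃ λ u → ∃ λ v → u < v × v ≤ top × ((u < p × p < v × v < q) ⊎ (p < u × u < q × q < v)) × Compatible u v
  flip p q p<q q≤ ¬e (d₁ , d₂) with furthest p q (≤∧≢⇒< p<q λ e → ¬e (inj₁ (sym e)))
  -- Outer neighbours of `q` are tried from `p` downwards and, failing that, from `top` downwards:
  -- the cyclic order in which they move away from `p`.
  ... | u , p<u , u<q , epu , maxu with searchMax (λ k → E? k q) p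
  ...   | inj₁ (v , v<p , evq , maxv) =
    v , u , <-trans v<p p<u , <≤⇒≤ u<q q≤ , inj₁ (v<p , p<u , u<q) ,
    (λ r s c r<v v<s s<u → E-noncrossing (inj₂ (inj₁ c)) evq r<v v<s (<-trans s<u u<q)) , right
    where
    right : ∀ r s → C r s → v < r → r < u → u < s → ⊥
    right r s c v<r r<u u<s with <-cmp s q | <-cmp r p
    ... | tri> _ _ q<s  | _              = E-noncrossing evq (inj₂ (inj₁ c)) v<r (<-trans r<u u<q) q<s
    ... | tri< s<q _ _  | tri< r<p _ _   = d₁ r s c r<p (<-trans p<u u<s) s<q
    ... | tri≈ _ refl _ | tri< r<p _ _   = maxv r v<r r<p (inj₂ (inj₁ c))
    ... | tri< s<q _ _  | tri≈ _ refl _  = maxu s u<s s<q (inj₂ (inj₁ c))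
    ... | tri≈ _ refl _ | tri≈ _ refl _  = ¬e (inj₂ (inj₁ c))
    ... | _             | tri> _ _ p<r   = E-noncrossing epu (inj₂ (inj₁ c)) p<r r<u u<s
  ...   | inj₂ none with m≤n⇒m<n∨m≡n q≤
  -- With `q` at the end of the line, the root edge either is `p`-`q` itself or supplies position 0
  -- as a neighbour of `q` below `p`.
  flip zero    q p<q q≤ ¬e (d₁ , d₂) | u , p<u , u<q , epu , maxu | inj₂ none | inj₂ q≡top = ⊥-elim (¬e (inj₂ (inj₂ (refl , q≡top))))
  flip (suc p) q p<q q≤ ¬e (d₁ , d₂) | u , p<u , u<q , epu , maxu | inj₂ none | inj₂ q≡top = ⊥-elim (none 0 (s≤s z≤n) (inj₂ (inj₂ (refl , q≡top))))
  flip p q p<q q≤ ¬e (d₁ , d₂) | u , p<u , u<q , epu , maxu | inj₂ none | inj₁ q<top with furthest q (suc top) (s≤s q<top)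
  ... | v , q<v , s≤s v≤top , eqv , maxv =
    u , v , <-trans u<q q<v , v≤top , inj₂ (p<u , u<q , q<v) , left , right
    where
    left : ∀ r s → C r s → r < u → u < s → s < v → ⊥
    left r s c r<u u<s s<v with <-cmp s q | <-cmp r p
    ... | tri> _ _ q<s  | _             = E-noncrossing (inj₂ (inj₁ c)) eqv (<-trans r<u u<q) q<s s<v
    ... | tri< s<q _ _  | tri< r<p _ _  = d₁ r s c r<p (<-trans p<u u<s) s<q
    ... | tri≈ _ refl _ | tri< r<p _ _  = none r r<p (inj₂ (inj₁ c))
    ... | tri< s<q _ _  | tri≈ _ refl _ = maxu s u<s s<q (inj₂ (inj₁ c))
    ... | tri≈ _ refl _ | tri≈ _ refl _ = ¬e (inj₂ (inj₁ c))
    ... | _             | tri> _ _ p<r  = E-noncrossing epu (inj₂ (inj₁ c)) p<r r<u u<s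
    right : ∀ r s → C r s → u < r → r < v → v < s → ⊥
    right r s c u<r r<v v<s with <-cmp r q
    ... | tri< r<q _ _  = d₂ r s c (<-trans p<u u<r) r<q (<-trans q<v v<s)
    ... | tri≈ _ refl _ = maxv s v<s (s≤s (bound r s c)) (inj₂ (inj₁ c))
    ... | tri> _ _ q<r  = E-noncrossing eqv (inj₂ (inj₁ c)) q<r r<v v<s

  module Maximal (0<top : 0 < top) (maximal : ∀ p q → suc p < q → q ≤ top → ¬ (p ≡ 0 × q ≡ top) → Compatible p q → C p q) where

    -- Let `m` be the furthest neighbour of `p`. A chord crossing `m`-`q` would cross `p`-`q` or
    -- `p`-`m`, or would lead from `p` to a still further neighbour; so maximality supplies the
    -- third side.
    apex : ∀ {p q} → E p q → suc p < q → q ≤ top → ∃ λ m → p < m × m < q × E p m × E m q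
    apex {p} {q} e 1+p<q q≤ with furthest p q 1+p<q
    ... | m , p<m , m<q , epm , max with m≤n⇒m<n∨m≡n m<q
    ...   | inj₂ refl  = m , p<m , m<q , epm , inj₁ refl
    ...   | inj₁ 1+m<q = m , p<m , m<q , epm , inj₂ (inj₁ (maximal m q 1+m<q q≤ (λ { (refl , _) → <⇒≱ p<m z≤n }) (left , right)))
      where
      left : ∀ r s → C r s → r < m → m < s → s < q → ⊥
      left r s c r<m m<s s<q with <-cmp r p
      ... | tri< r<p _ _  = E-noncrossing (inj₂ (inj₁ c)) e r<p (<-trans p<m m<s) s<q
      ... | tri≈ _ refl _ = max s m<s s<q (inj₂ (inj₁ c))
      ... | tri> _ _ p<r  = E-noncrossing epm (inj₂ (inj₁ c)) p<r r<m m<s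
      right : ∀ r s → C r s → m < r → r < q → q < s → ⊥
      right r s c m<r r<q q<s = E-noncrossing e (inj₂ (inj₁ c)) (<-trans p<m m<r) r<q q<s

    -- Descends from an edge to the other two sides of its inner triangle. The fuel `k` bounds the
    -- length through `q < p + k`, which both shorter edges satisfy with one unit less.
    edge-induction : ∀ (P : ℕ → ℕ → Set) → (∀ p → suc p ≤ top → P p (suc p)) →
      (∀ p m q → p < m → m < q → q ≤ top → E p m → E m q → E p q → P p m → P m q → P p q) →
      ∀ {p q} → E p q → p < q → q ≤ top → P p q
    edge-induction P base step {p} {q} e p<q q≤ = go (suc q) e p<q q≤ (m≤n+m (suc q) p)
      where
      go : ∀ k {p q} → E p q → p < q → q ≤ top → q < p + k → P p q
      go zero    {p} e p<q q≤ q<p+0 = ⊥-elim (<-asym p<q (subst (_ <_) (+-identityʳ p) q<p+0))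
      go (suc k) {p} {q} e p<q q≤ q<p+k with m≤n⇒m<n∨m≡n p<q
      ... | inj₂ refl = base p q≤
      ... | inj₁ 1+p<q with apex e 1+p<q q≤
      ...   | m , p<m , m<q , epm , emq = step p m q p<m m<q q≤ epm emq e
        (go k epm p<m (<≤⇒≤ m<q q≤) (≤-trans m<q (≤-pred q<1+p+k)))
        (go k emq m<q q≤ (<-≤-trans q<1+p+k (+-monoˡ-≤ k p<m)))
        where
        q<1+p+k : suc q ≤ suc (p + k)
        q<1+p+k = subst (suc q ≤_) (+-suc p k) q<p+k

    -- Inside an edge p–q with apex m, a chord p–y with m < y < q crosses only the edge m–q
    -- of the triangle, and a chord x–y with p < x < m < y crosses the edge p–m.
    chord-induction : ∀ (Q : ℕ → ℕ → Set) → (∀ {p q} → E p q → p < q → q ≤ top → Q p q) →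
      (∀ p q r s → p < q → q < r → r < s → s ≤ top → Q p q → Q q r → Q r s → Q p s → E p r → Q q s) →
      (∀ p q r s → p < q → q < r → r < s → s ≤ top → Q p q → Q q r → Q r s → Q p s → E q s → Q p r) →
      ∀ {p q} → p < q → q ≤ top → Q p q
    chord-induction Q edge step₁ step₂ p<q q≤ = edge-induction Inside base step (inj₂ (inj₂ (refl , refl))) 0<top ≤-refl _ _ z≤n p<q q≤
      where
      Inside : ℕ → ℕ → Set
      Inside p q = ∀ x y → p ≤ x → x < y → y ≤ q → Q x y
      base : ∀ p → suc p ≤ top → Inside p (suc p)
      base p 1+p≤ x y p≤x x<y y≤1+p = edge (inj₁ (≤-antisym (≤-trans y≤1+p (s≤s p≤x)) x<y)) x<y (≤-trans y≤1+p 1+p≤)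
      fromLeft : ∀ p m q y → p < m → m < q → q ≤ top → E m q → E p q → Inside p m → Inside m q → m < y → y ≤ q → Q p y
      fromLeft p m q y p<m m<q q≤ emq epq inl inr m<y y≤q with m≤n⇒m<n∨m≡n y≤q
      ... | inj₂ refl = edge epq (<-trans p<m m<q) q≤
      ... | inj₁ y<q  = step₂ p m y q p<m m<y y<q q≤ (inl p m ≤-refl p<m ≤-refl) (inr m y ≤-refl m<y y≤q)
                          (inr y q (<⇒≤ m<y) y<q ≤-refl) (edge epq (<-trans p<m m<q) q≤) emq
      step : ∀ p m q → p < m → m < q → q ≤ top → E p m → E m q → E p q → Inside p m → Inside m q → Inside p q
      step p m q p<m m<q q≤ epm emq epq inl inr x y p≤x x<y y≤q with <-cmp y m | <-cmp x m
      ... | tri< y<m _ _  | _             = inl x y p≤x x<y (<⇒≤ y<m)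
      ... | tri≈ _ refl _ | _             = inl x y p≤x x<y ≤-refl
      ... | tri> _ _ m<y  | tri≈ _ refl _ = inr x y ≤-refl x<y y≤q
      ... | tri> _ _ m<y  | tri> _ _ m<x  = inr x y (<⇒≤ m<x) x<y y≤q
      ... | tri> _ _ m<y  | tri< x<m _ _ with m≤n⇒m<n∨m≡n p≤x
      ...   | inj₂ refl = fromLeft p m q y p<m m<q q≤ emq epq inl inr m<y y≤q
      ...   | inj₁ p<x  = step₁ p x m y p<x x<m m<y (≤-trans y≤q q≤) (inl p x ≤-refl p<x (<⇒≤ x<m)) (inl x m p≤x x<m ≤-refl)
                            (inr m y ≤-refl m<y y≤q) (fromLeft p m q y p<m m<q q≤ emq epq inl inr m<y y≤q) epm

-- List operations and residues in terms of sums and bounds.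

ι-sumℕ : ∀ (f : ℕ → ℕ) (g : ℕ → ℕ) a l → (∀ i → g i ≡ a + i) → ι (sumℕ (map f (applyUpTo g l))) ≡ ∑ a l (λ i → ι (f i))
ι-sumℕ f g a zero    h = ι-0
ι-sumℕ f g a (suc l) h = trans (ι-+ (f (g 0)) _) (cong₂ _+ℚ_ (cong (λ i → ι (f i)) (trans (h 0) (+-identityʳ a)))
  (ι-sumℕ f (g ∘ suc) (suc a) l (λ i → trans (h (suc i)) (+-suc a i))))

allB-true : ∀ p f m → (∀ k → k < m → p (f k) ≡ true) → allB p (applyUpTo f m) ≡ true
allB-true p f zero    h = refl
allB-true p f (suc m) h = cong₂ _∧_ (h 0 (s≤s z≤n)) (allB-true p (f ∘ suc) m (λ k k<m → h (suc k) (s≤s k<m)))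

allB-false : ∀ p f m k → k < m → p (f k) ≡ false → allB p (applyUpTo f m) ≡ false
allB-false p f (suc m) zero    _         h = cong (_∧ allB p (applyUpTo (f ∘ suc) m)) h
allB-false p f (suc m) (suc k) (s≤s k<m) h = trans (cong (p (f 0) ∧_) (allB-false p (f ∘ suc) m k k<m h)) (𝔹.∧-zeroʳ (p (f 0)))

filterB-∈⁻ : ∀ p ls {x} → x Mem.∈ filterB p ls → x Mem.∈ ls × p x ≡ true
filterB-∈⁻ p (y ∷ ls) m with p y in e
filterB-∈⁻ p (y ∷ ls) (here refl) | true = here refl , e
filterB-∈⁻ p (y ∷ ls) (there m)   | true with filterB-∈⁻ p ls m
... | m′ , h = there m′ , h
filterB-∈⁻ p (y ∷ ls) m | false with filterB-∈⁻ p ls m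
... | m′ , h = there m′ , h

filterB-∈⁺ : ∀ p ls {x} → x Mem.∈ ls → p x ≡ true → x Mem.∈ filterB p ls
filterB-∈⁺ p (y ∷ ls) (here refl) h rewrite h = here refl
filterB-∈⁺ p (y ∷ ls) (there m) h with p y
... | true  = there (filterB-∈⁺ p ls m h)
... | false = filterB-∈⁺ p ls m h

maxList-map : ∀ (f : ℕ → ℕ) ls {x} → x Mem.∈ ls → (∀ {y} → y Mem.∈ ls → f y ≤ f x) → maxList (map f ls) ≡ f x
maxList-map f ls {x} m h = ≤-antisym (upper ls h) (lower ls m)
  where
  upper : ∀ ls → (∀ {y} → y Mem.∈ ls → f y ≤ f x) → maxList (map f ls) ≤ f x
  upper []       h = z≤n
  upper (y ∷ ls) h = ⊔-lub (h (here refl)) (upper ls (h ∘ there))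
  lower : ∀ ls → x Mem.∈ ls → f x ≤ maxList (map f ls)
  lower (y ∷ ls) (here refl) = m≤m⊔n _ _
  lower (y ∷ ls) (there m)   = ≤-trans (lower ls m) (m≤n⊔m (f y) _)

sub-mod : ∀ N′ {p q} → p ≤ q → q < suc N′ → (q + suc N′ ∸ p) % suc N′ ≡ q ∸ p
sub-mod N′ {p} {q} p≤q q< = trans (cong (_% suc N′) (trans (cong (_∸ p) (+-comm q (suc N′))) (trans (+-∸-assoc (suc N′) p≤q) (+-comm (suc N′) (q ∸ p)))))
  (trans (DivMod.[m+n]%n≡m%n (q ∸ p) (suc N′)) (DivMod.m<n⇒m%n≡m (≤-<-trans (m∸n≤m q p) q<)))

sub-mod-wrap : ∀ N′ {p q} → q < p → p < suc N′ → (q + suc N′ ∸ p) % suc N′ ≡ q + suc N′ ∸ p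
sub-mod-wrap N′ {p} {q} q<p p< = DivMod.m<n⇒m%n≡m (+-cancelʳ-< p _ _ (subst (_< suc N′ + p)
  (sym (m∸n+n≡m (≤-trans (<⇒≤ p<) (m≤n+m (suc N′) q)))) (subst (_< suc N′ + p) (+-comm (suc N′) q) (+-monoʳ-< (suc N′) q<p))))

does-true : ∀ {P : Set} (d : Dec P) → ⌊ d ⌋ ≡ true → P
does-true (yes p) _ = p

true-does : ∀ {P : Set} (d : Dec P) → P → ⌊ d ⌋ ≡ true
true-does (yes _) _ = refl
true-does (no ¬p) p = ⊥-elim (¬p p)

last : ℚ → List ℚ → ℚ
last v []       = v
last v (u ∷ us) = last u us

-- Layer-cake decomposition: t is the last threshold minus the gaps u - v with t < u.
drop : ℚ → List ℚ → ℚ → ℚ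
drop v []       t = 0ℚ
drop v (u ∷ us) t = (u -ℚ v) *ℚ ind ⌊ t Q.<? u ⌋ +ℚ drop u us t

drop-below : ∀ {v us t} → Linked _≤ℚ_ (v ∷ us) → t ≤ℚ v → drop v us t ≡ last v us -ℚ v
drop-below {v} {[]} s t≤v = sym (Q.+-inverseʳ v)
drop-below {v} {u ∷ us} {t} (v≤u ∷ s) t≤v = trans (cong₂ _+ℚ_ step (drop-below s (Q.≤-trans t≤v v≤u))) (lem u v (last u us))
  where
  lem : ∀ u v w → (u -ℚ v) +ℚ (w -ℚ u) ≡ w -ℚ v
  lem = solve-∀ ℚ-ring
  step : (u -ℚ v) *ℚ ind ⌊ t Q.<? u ⌋ ≡ u -ℚ v
  step with t Q.<? u
  ... | yes _ = Q.*-identityʳ (u -ℚ v)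
  -- Thresholds may repeat: here `u` and `v` coincide, and the gap is zero whatever the indicator
  -- is.
  ... | no t≮u with Q.≤-antisym v≤u (Q.≤-trans (Q.≮⇒≥ t≮u) t≤v)
  ...   | refl = trans (Q.*-zeroʳ (v -ℚ v)) (sym (Q.+-inverseʳ v))

head-≤ : ∀ {v us t} → Linked _≤ℚ_ (v ∷ us) → t Mem.∈ (v ∷ us) → v ≤ℚ t
head-≤ s (here refl) = Q.≤-refl
head-≤ (v≤u ∷ s) (there m) = Q.≤-trans v≤u (head-≤ s m)

-- By sortedness the thresholds up to `t` contribute nothing, and the gaps after `t` telescope.
drop-∈ : ∀ {v us t} → Linked _≤ℚ_ (v ∷ us) → t Mem.∈ (v ∷ us) → drop v us t ≡ last v us -ℚ t
drop-∈ s (here refl) = drop-below s Q.≤-refl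
drop-∈ {v} {u ∷ us} {t} (v≤u ∷ s) (there m) = trans (cong₂ _+ℚ_ step (drop-∈ s m)) (Q.+-identityˡ _)
  where
  step : (u -ℚ v) *ℚ ind ⌊ t Q.<? u ⌋ ≡ 0ℚ
  step with t Q.<? u
  ... | no _    = Q.*-zeroʳ (u -ℚ v)
  ... | yes t<u = ⊥-elim (Q.<-irrefl refl (Q.<-≤-trans t<u (head-≤ s m)))

-- Double sums, and vectors as functions on labels.

∑-swap : ∀ a k b l (f : ℕ → ℕ → ℚ) → ∑ a k (λ i → ∑ b l (f i)) ≡ ∑ b l (λ j → ∑ a k (λ i → f i j))
∑-swap a zero    b l f = sym (∑-zero b l λ _ _ _ → refl)
∑-swap a (suc k) b l f = trans (cong (∑ b l (f a) +ℚ_) (∑-swap (suc a) k b l f)) (sym (∑-+ b l (f a) (λ j → ∑ (suc a) k (λ i → f i j))))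

∑-shift : ∀ a l f → ∑ (suc a) l f ≡ ∑ a l (λ i → f (suc i))
∑-shift a zero    f = refl
∑-shift a (suc l) f = cong (f (suc a) +ℚ_) (∑-shift (suc a) l f)

term≤∑ : ∀ a l {f} → (∀ i → 0ℚ ≤ℚ f i) → ∀ j → a ≤ j → j < a + l → f j ≤ℚ ∑ a l f
term≤∑ a zero    h j a≤j j< = contradiction (≤-<-trans a≤j (subst (j <_) (+-identityʳ a) j<)) (<-irrefl refl)
term≤∑ a (suc l) {f} h j a≤j j< with m≤n⇒m<n∨m≡n a≤j
... | inj₂ refl = subst (_≤ℚ f a +ℚ ∑ (suc a) l f) (Q.+-identityʳ (f a)) (Q.+-monoʳ-≤ (f a) (∑-0≤ (suc a) l h))
... | inj₁ a<j = Q.≤-trans (term≤∑ (suc a) l h j a<j (subst (j <_) (+-suc a l) j<))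
  (subst (_≤ℚ f a +ℚ ∑ (suc a) l f) (Q.+-identityˡ _) (Q.+-monoˡ-≤ (∑ (suc a) l f) (h a)))

entry : ∀ {n} → Vec ℚ n → ℕ → ℚ
entry Vec.[]       i       = 0ℚ
entry (x Vec.∷ xs) zero    = x
entry (x Vec.∷ xs) (suc i) = entry xs i

-- Labels start at 1; the value at 0 and beyond n is junk.
coord : ∀ {n} → Vec ℚ n → ℕ → ℚ
coord y zero    = 0ℚ
coord y (suc i) = entry y i

entry-lookup : ∀ {n} (y : Vec ℚ n) i → lookup y i ≡ entry y (toℕ i)
entry-lookup (x Vec.∷ xs) Fin.zero    = refl
entry-lookup (x Vec.∷ xs) (Fin.suc i) = entry-lookup xs i

entry-tabulate : ∀ {n} (f : ℕ → ℚ) i → i < n → entry (tabulate {n = n} (λ k → f (toℕ k))) i ≡ f i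
entry-tabulate {suc n} f zero    _         = refl
entry-tabulate {suc n} f (suc i) (s≤s i<n) = entry-tabulate (λ k → f (suc k)) i i<n

entry-injective : ∀ {n} (x y : Vec ℚ n) → (∀ i → i < n → entry x i ≡ entry y i) → x ≡ y
entry-injective Vec.[]       Vec.[]       h = refl
entry-injective (x Vec.∷ xs) (y Vec.∷ ys) h = cong₂ Vec._∷_ (h 0 (s≤s z≤n)) (entry-injective xs ys λ i i<n → h (suc i) (s≤s i<n))

sumℚ-entry : ∀ {n} (y : Vec ℚ n) → sumℚ (toList y) ≡ ∑ 0 n (entry y)
sumℚ-entry Vec.[] = refl
sumℚ-entry {suc n} (x Vec.∷ xs) = cong (x +ℚ_) (trans (sumℚ-entry xs) (sym (∑-shift 0 n (entry (x Vec.∷ xs)))))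

dot-entry : ∀ {n} (c y : Vec ℚ n) → dot c y ≡ ∑ 0 n (λ i → entry c i *ℚ entry y i)
dot-entry Vec.[] Vec.[] = refl
dot-entry {suc n} (c Vec.∷ cs) (y Vec.∷ ys) = cong (c *ℚ y +ℚ_) (trans (dot-entry cs ys)
  (sym (∑-shift 0 n (λ i → entry (c Vec.∷ cs) i *ℚ entry (y Vec.∷ ys) i))))

sumℚ-tabulate : ∀ {A : Set} m (f : A → ℚ) (h : Fin m → A) g → (∀ i → f (h i) ≡ g (toℕ i)) → sumℚ (map f (List.tabulate h)) ≡ ∑ 0 m g
sumℚ-tabulate zero    f h g e = refl
sumℚ-tabulate (suc m) f h g e = cong₂ _+ℚ_ (e Fin.zero) (trans (sumℚ-tabulate m f (h ∘ Fin.suc) (g ∘ suc) (λ i → e (Fin.suc i))) (sym (∑-shift 0 m g)))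

-- Positions of the labels around the polygon.

module Construction {n : ℕ} (1≤n : 1 ≤ n) (𝒜 : Orientation n) where

  N : ℕ
  N = suc (suc n)

  up dn : ℕ → Bool
  up = isUp 𝒜
  dn = isDoBar 𝒜

  ps : ℕ → ℕ
  ps = pos 𝒜

  up⇒≤n : ∀ a → up a ≡ true → a ≤ n
  up⇒≤n (suc (suc k)) e = ≮⇒≥ λ { (s≤s n≤1+k) → true≢false e (nth-beyond (edges 𝒜) k (m≤n+o⇒m∸n≤o n 2 (m≤n⇒m≤1+n n≤1+k))) }

  up-top : up (suc n) ≡ false
  up-top = ≡false λ e → 1+n≰n (up⇒≤n (suc n) e)

  dn-true : ∀ a → up a ≡ false → dn a ≡ true
  dn-true a = cong not

  downs : ℕ → ℕ
  downs a = countIn dn 1 a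

  ups : ℕ → ℕ
  ups a = countIn up a (suc n ∸ a)

  ps-down : ∀ a → up a ≡ false → ps a ≡ downs a
  ps-down a e rewrite e = refl

  ps-up : ∀ a → up a ≡ true → ps a ≡ suc (downs n) + ups a
  ps-up a e rewrite e = refl

  downs-top : downs (suc n) ≡ suc (downs n)
  downs-top = trans (cong (countIn dn 1) (sym (+-comm n 1))) (trans (countIn-+ dn 1 n 1)
    (trans (cong (λ b → downs n + ((if b then 1 else 0) + 0)) (dn-true (suc n) up-top)) (+-comm (downs n) 1)))

  downs-mono : ∀ {a b} → a ≤ b → downs a ≤ downs b
  downs-mono {a} {b} a≤b = subst (downs a ≤_)
    (trans (sym (countIn-+ dn 1 a (b ∸ a))) (cong downs (m+[n∸m]≡n a≤b))) (m≤m+n _ _)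

  downs-suc : ∀ b → up (suc b) ≡ false → downs (suc b) ≡ suc (downs b)
  downs-suc b e = trans (cong downs (sym (+-comm b 1))) (trans (countIn-+ dn 1 b 1)
    (trans (cong (λ c → downs b + ((if c then 1 else 0) + 0)) (dn-true (suc b) e)) (+-comm (downs b) 1)))

  downs-< : ∀ {a b} → a < b → up b ≡ false → downs a < downs b
  downs-< {a} {suc b} (s≤s a≤b) e = subst (downs a <_) (sym (downs-suc b e)) (s≤s (downs-mono a≤b))

  ups-split : ∀ {a b} → a ≤ b → b ≤ suc n → ups a ≡ countIn up a (b ∸ a) + ups b
  ups-split = countIn-∸ up

  ups-up : ∀ a → up a ≡ true → ups a ≡ suc (ups (suc a))
  ups-up a e = trans (cong (countIn up a) (+-∸-assoc 1 (up⇒≤n a e))) (countIn-true up a (n ∸ a) e)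

  ups-< : ∀ {a b} → a < b → b ≤ suc n → up a ≡ true → ups b < ups a
  ups-< {a} {b} a<b b≤ e = subst (ups b <_) (sym (ups-up a e))
    (s≤s (subst (ups b ≤_) (sym (ups-split a<b b≤)) (m≤n+m _ _)))

  ups+downs : ups 1 + downs n ≡ n
  ups+downs = countIn-complement up 1 n

  1≤up : ∀ a → up a ≡ true → 1 ≤ a
  1≤up (suc a) e = s≤s z≤n

  ps≤ : ∀ {a} → a ≤ suc n → ps a ≤ suc n
  ps≤ {a} a≤ with bool (up a)
  ... | inj₂ e = subst (_≤ suc n) (sym (ps-down a e)) (≤-trans (downs-mono a≤) (subst (_≤ suc n) (sym downs-top) (s≤s (subst (downs n ≤_) ups+downs (m≤n+m _ _)))))
  ... | inj₁ e = subst (_≤ suc n) (sym (ps-up a e)) (s≤s (subst (downs n + ups a ≤_) (trans (+-comm (downs n) (ups 1)) ups+downs)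
                  (+-monoʳ-≤ (downs n) (subst (ups a ≤_) (sym (ups-split (1≤up a e) a≤)) (m≤n+m _ _)))))

  -- Counterclockwise from 0 the down labels come first, increasing, and the up labels after `n+1`,
  -- decreasing. Hence, here and in `above`, the type of the smaller label alone decides which of
  -- two labels comes first.
  below : ∀ {a b} → a < b → up a ≡ false → ps a < ps b
  below {a} {b} a<b e with bool (up b)
  ... | inj₂ f = subst₂ _<_ (sym (ps-down a e)) (sym (ps-down b f)) (downs-< a<b f)
  ... | inj₁ f  = subst₂ _<_ (sym (ps-down a e)) (sym (ps-up b f))
                  (s≤s (≤-trans (downs-mono (≤-trans (<⇒≤ a<b) (up⇒≤n b f))) (m≤m+n _ _)))

  above : ∀ {a b} → a < b → b ≤ suc n → up a ≡ true → ps b < ps a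
  above {a} {b} a<b b≤ e with bool (up b)
  ... | inj₁ f  = subst₂ _<_ (sym (ps-up b f)) (sym (ps-up a e)) (+-monoʳ-< (suc (downs n)) (ups-< a<b b≤ e))
  ... | inj₂ f = subst₂ _<_ (sym (ps-down b f)) (sym (ps-up a e)) (≤-<-trans (subst (downs b ≤_) downs-top (downs-mono b≤))
                  (m<m+n _ (subst (0 <_) (sym (ups-up a e)) (s≤s z≤n))))

  ps-injective : ∀ a b → a ≤ suc n → b ≤ suc n → ps a ≡ ps b → a ≡ b
  ps-injective a b a≤ b≤ e with <-cmp a b
  ... | tri≈ _ a≡b _ = a≡b
  ... | tri< a<b _ _ with bool (up a)
  ...   | inj₂ f = contradiction e (<⇒≢ (below {a} {b} a<b f))
  ...   | inj₁ f  = contradiction (sym e) (<⇒≢ (above {a} {b} a<b b≤ f))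
  ps-injective a b a≤ b≤ e | tri> _ _ b<a with bool (up b)
  ...   | inj₂ f = contradiction (sym e) (<⇒≢ (below {b} {a} b<a f))
  ...   | inj₁ f  = contradiction e (<⇒≢ (above {b} {a} b<a a≤ f))

  ps-surjective : ∀ p → p ≤ suc n → ∃ λ a → a ≤ suc n × ps a ≡ p
  ps-surjective = injective⇒surjective (suc n) ps (λ a → ps≤) ps-injective

  data PosOrder (a b : ℕ) : Set where
    rising  : a < b → up a ≡ false → PosOrder a b
    falling : b < a → up b ≡ true → PosOrder a b

  posOrder : ∀ {a b} → a ≤ suc n → b ≤ suc n → ps a < ps b → PosOrder a b
  posOrder {a} {b} a≤ b≤ p with <-cmp a b
  ... | tri≈ _ refl _ = contradiction p (<-irrefl refl)
  ... | tri< a<b _ _ with bool (up a)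
  ...   | inj₂ f = rising a<b f
  ...   | inj₁ f  = contradiction p (<-asym (above {a} {b} a<b b≤ f))
  posOrder {a} {b} a≤ b≤ p | tri> _ _ b<a with bool (up b)
  ...   | inj₁ f  = falling b<a f
  ...   | inj₂ f = contradiction p (<-asym (below {b} {a} b<a f))

  findLabel-spec : ∀ p ls a → a Mem.∈ ls → ps a ≡ p → ps (findLabel 𝒜 p ls) ≡ p × findLabel 𝒜 p ls Mem.∈ ls
  findLabel-spec p (ℓ ∷ ls) a a∈ e with ps ℓ ≡ᵇ p in f
  ... | true = ≡ᵇ⇒≡ (ps ℓ) p (subst T (sym f) tt) , here refl
  findLabel-spec p (ℓ ∷ ls) a (here refl) e | false = ⊥-elim (subst T f (≡⇒≡ᵇ (ps ℓ) p e))
  findLabel-spec p (ℓ ∷ ls) a (there a∈) e  | false with findLabel-spec p ls a a∈ e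
  ... | e′ , m = e′ , there m

  labelAt-spec : ∀ {p} → p ≤ suc n → ps (labelAt 𝒜 p) ≡ p × labelAt 𝒜 p ≤ suc n
  labelAt-spec {p} p≤ with ps-surjective p p≤
  ... | a , a≤ , e with findLabel-spec p (upTo N) a (Memₚ.∈-upTo⁺ (s≤s a≤)) e
  ... | e′ , m with Memₚ.∈-upTo⁻ m
  ... | s≤s ℓ≤ = e′ , ℓ≤

  abstract
    lab : ℕ → ℕ
    lab = labelAt 𝒜

    lab-spec : ∀ {p} → p ≤ suc n → ps (lab p) ≡ p × lab p ≤ suc n
    lab-spec = labelAt-spec

  ps-lab : ∀ {p} → p ≤ suc n → ps (lab p) ≡ p
  ps-lab p≤ = proj₁ (lab-spec p≤)

  lab≤ : ∀ {p} → p ≤ suc n → lab p ≤ suc n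
  lab≤ p≤ = proj₂ (lab-spec p≤)

  lab-ps : ∀ {a} → a ≤ suc n → lab (ps a) ≡ a
  lab-ps {a} a≤ = ps-injective _ _ (lab≤ (ps≤ a≤)) a≤ (ps-lab (ps≤ a≤))

  lab-0 : lab 0 ≡ 0
  lab-0 = lab-ps {0} z≤n

  -- Crossing chords, by position and by label.

  -- The chords A–C and B–D cross.  The last three constructors close the base
  -- case under the symmetries of a pair of unordered chords.
  data Interleaved : ℕ → ℕ → ℕ → ℕ → Set where
    asc   : ∀ {A B C D} → D ≤ suc n → ps A < ps B → ps B < ps C → ps C < ps D →
            A ≤ suc n → B ≤ suc n → C ≤ suc n → Interleaved A B C D
    flip₁ : ∀ {A B C D} → Interleaved A B C D → Interleaved C B A D
    flip₂ : ∀ {A B C D} → Interleaved A B C D → Interleaved A D C B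
    swap  : ∀ {A B C D} → Interleaved A B C D → Interleaved B A D C

  -- The same relation read off from labels w < y < z < v: the types of the two
  -- middle labels decide which two chords cross.
  data Quad : ℕ → ℕ → ℕ → ℕ → Set where
    alt   : ∀ {w y z v} → w < y → y < z → z < v → v ≤ suc n → up y ≡ up z → Quad w y z v
    nest  : ∀ {w y z v} → w < y → y < z → z < v → v ≤ suc n → up y ≢ up z → Quad w y v z
    flip₁ : ∀ {A B C D} → Quad A B C D → Quad C B A D
    flip₂ : ∀ {A B C D} → Quad A B C D → Quad A D C B
    swap  : ∀ {A B C D} → Quad A B C D → Quad B A D C

  bounds : ∀ {w y z v} → w < y → y < z → z < v → v ≤ suc n → w ≤ suc n × y ≤ suc n × z ≤ suc n
  bounds w<y y<z z<v v≤ = <≤⇒≤ w<y y≤ , y≤ , z≤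
    where
    z≤ = <≤⇒≤ z<v v≤
    y≤ = <≤⇒≤ y<z z≤

  -- Each combination of types of the three smaller labels fixes the cyclic order by `below` and
  -- `above`. An up `w` takes the last of the four positions, so the ascending quadruple then starts
  -- elsewhere and the symmetries rotate it back.
  quad⇒interleaved : ∀ {A B C D} → Quad A B C D → Interleaved A B C D
  quad⇒interleaved (flip₁ q) = flip₁ (quad⇒interleaved q)
  quad⇒interleaved (flip₂ q) = flip₂ (quad⇒interleaved q)
  quad⇒interleaved (swap q)  = swap (quad⇒interleaved q)
  quad⇒interleaved (alt {w} {y} {z} {v} w<y y<z z<v v≤ e) with bool (up w) | bool (up y) | bool (up z) | bounds w<y y<z z<v v≤
  ... | _ | inj₁ f | inj₂ g | _ = ⊥-elim (true≢false f (trans e g))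
  ... | _ | inj₂ f | inj₁ g | _ = ⊥-elim (true≢false g (trans (sym e) f))
  ... | inj₂ h | inj₂ f | inj₂ g | w≤ , y≤ , z≤ = asc v≤ (below w<y h) (below y<z f) (below z<v g) w≤ y≤ z≤
  ... | inj₁ h | inj₂ f | inj₂ g | w≤ , y≤ , z≤ = flip₁ (swap (asc w≤ (below y<z f) (below z<v g) (above (<-trans w<y (<-trans y<z z<v)) v≤ h) y≤ z≤ v≤))
  ... | inj₂ h | inj₁ f | inj₁ g | w≤ , y≤ , z≤ = flip₂ (asc y≤ (below (<-trans w<y (<-trans y<z z<v)) h) (above z<v v≤ g) (above y<z z≤ f) w≤ v≤ z≤)
  ... | inj₁ h | inj₁ f | inj₁ g | w≤ , y≤ , z≤ = swap (flip₂ (flip₁ (asc w≤ (above z<v v≤ g) (above y<z z≤ f) (above w<y y≤ h) v≤ z≤ y≤)))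
  quad⇒interleaved (nest {w} {y} {z} {v} w<y y<z z<v v≤ e) with bool (up w) | bool (up y) | bool (up z) | bounds w<y y<z z<v v≤
  ... | _ | inj₁ f | inj₁ g | _ = ⊥-elim (e (trans f (sym g)))
  ... | _ | inj₂ f | inj₂ g | _ = ⊥-elim (e (trans f (sym g)))
  ... | inj₂ h | inj₂ f | inj₁ g | w≤ , y≤ , z≤ = asc z≤ (below w<y h) (below (<-trans y<z z<v) f) (above z<v v≤ g) w≤ y≤ v≤
  ... | inj₁ h | inj₂ f | inj₁ g | w≤ , y≤ , z≤ = flip₁ (swap (asc w≤ (below (<-trans y<z z<v) f) (above z<v v≤ g) (above (<-trans w<y y<z) z≤ h) y≤ v≤ z≤))
  ... | inj₂ h | inj₁ f | inj₂ g | w≤ , y≤ , z≤ = flip₂ (asc y≤ (below (<-trans w<y y<z) h) (below z<v g) (above (<-trans y<z z<v) v≤ f) w≤ z≤ v≤)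
  ... | inj₁ h | inj₁ f | inj₂ g | w≤ , y≤ , z≤ = swap (flip₂ (flip₁ (asc w≤ (below z<v g) (above (<-trans y<z z<v) v≤ f) (above w<y y≤ h) z≤ v≤ y≤)))

  -- Labels read in order of position are unimodal: a fall ends at an up label and a rise starts at
  -- a down one, so no rise follows a fall. Comparing the ends of the rising and of the falling part
  -- then sorts the four labels.
  ascending⇒quad : ∀ {A B C D} → A ≤ suc n → B ≤ suc n → C ≤ suc n → D ≤ suc n →
                   ps A < ps B → ps B < ps C → ps C < ps D → Quad A B C D
  ascending⇒quad {A} {B} {C} {D} A≤ B≤ C≤ D≤ AB BC CD with posOrder A≤ B≤ AB | posOrder B≤ C≤ BC | posOrder C≤ D≤ CD
  ... | falling _ b | rising _ b′ | _ = ⊥-elim (true≢false b b′)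
  ... | _ | falling _ c | rising _ c′ = ⊥-elim (true≢false c c′)
  ... | rising A<B a | rising B<C b | rising C<D c = alt A<B B<C C<D D≤ (trans b (sym c))
  ... | falling B<A b | falling C<B c | falling D<C d = swap (flip₂ (flip₁ (alt D<C C<B B<A A≤ (trans c (sym b)))))
  ... | rising A<B a | rising B<C b | falling D<C d with posOrder B≤ D≤ (<-trans BC CD)
  ...   | rising B<D _ = nest A<B B<D D<C C≤ (λ e → true≢false d (trans (sym e) b))
  ...   | falling D<B _ with posOrder A≤ D≤ (<-trans AB (<-trans BC CD))
  ...     | rising A<D _ = flip₂ (nest A<D D<B B<C C≤ (λ e → true≢false d (trans e b)))
  ...     | falling D<A _ = flip₂ (swap (alt D<A A<B B<C C≤ (trans a (sym b))))
  ascending⇒quad {A} {B} {C} {D} A≤ B≤ C≤ D≤ AB BC CD | rising A<B a | falling C<B c | falling D<C d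
    with posOrder A≤ C≤ (<-trans AB BC)
  ...   | falling C<A _ = swap (flip₂ (flip₁ (nest D<C C<A A<B B≤ (λ e → true≢false c (trans e a)))))
  ...   | rising A<C _ with posOrder A≤ D≤ (<-trans AB (<-trans BC CD))
  ...     | rising A<D _ = flip₂ (alt A<D D<C C<B B≤ (trans d (sym c)))
  ...     | falling D<A _ = flip₂ (swap (nest D<A A<C C<B B≤ (λ e → true≢false c (trans (sym e) a))))

  interleaved⇒quad : ∀ {A B C D} → Interleaved A B C D → Quad A B C D
  interleaved⇒quad (asc D≤ AB BC CD A≤ B≤ C≤) = ascending⇒quad A≤ B≤ C≤ D≤ AB BC CD
  interleaved⇒quad (flip₁ i) = flip₁ (interleaved⇒quad i)
  interleaved⇒quad (flip₂ i) = flip₂ (interleaved⇒quad i)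
  interleaved⇒quad (swap i)  = swap (interleaved⇒quad i)

  linked : ℕ → ℕ → ℕ → ℕ → Bool
  linked p₁ q₁ p₂ q₂ = ((p₁ <ᵇ p₂) ∧ (p₂ <ᵇ q₁) ∧ (q₁ <ᵇ q₂)) ∨ ((p₂ <ᵇ p₁) ∧ (p₁ <ᵇ q₂) ∧ (q₂ <ᵇ q₁))

  crosses-flip₁ : ∀ a b c d → crosses 𝒜 a b c d ≡ crosses 𝒜 b a c d
  crosses-flip₁ a b c d = cong₂ (λ p q → linked p q (min′ (ps c) (ps d)) (max′ (ps c) (ps d))) (min′-comm (ps a) (ps b)) (max′-comm (ps a) (ps b))

  crosses-flip₂ : ∀ a b c d → crosses 𝒜 a b c d ≡ crosses 𝒜 a b d c
  crosses-flip₂ a b c d = cong₂ (λ p q → linked (min′ (ps a) (ps b)) (max′ (ps a) (ps b)) p q) (min′-comm (ps c) (ps d)) (max′-comm (ps c) (ps d))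

  crosses-swap : ∀ a b c d → crosses 𝒜 a b c d ≡ crosses 𝒜 c d a b
  crosses-swap a b c d = 𝔹.∨-comm _ ((min′ (ps c) (ps d) <ᵇ min′ (ps a) (ps b)) ∧ _)

  interleaved⇒crosses : ∀ {A B C D} → Interleaved A B C D → crosses 𝒜 A C B D ≡ true
  interleaved⇒crosses (asc {A} {B} {C} {D} _ AB BC CD _ _ _)
    rewrite min′-≤ (<⇒≤ (<-trans AB BC)) | max′-≤ (<⇒≤ (<-trans AB BC))
          | min′-≤ (<⇒≤ (<-trans BC CD)) | max′-≤ (<⇒≤ (<-trans BC CD))
          | <⇒<ᵇ-true AB | <⇒<ᵇ-true BC | <⇒<ᵇ-true CD = refl
  interleaved⇒crosses (flip₁ {A} {B} {C} {D} i) = trans (crosses-flip₁ C A B D) (interleaved⇒crosses i)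
  interleaved⇒crosses (flip₂ {A} {B} {C} {D} i) = trans (crosses-flip₂ A C D B) (interleaved⇒crosses i)
  interleaved⇒crosses (swap {A} {B} {C} {D} i) = trans (crosses-swap B D A C) (interleaved⇒crosses i)

  sorted-crosses⇒interleaved : ∀ {a b c d} → a ≤ suc n → b ≤ suc n → c ≤ suc n → d ≤ suc n → ps a ≤ ps b → ps c ≤ ps d →
           crosses 𝒜 a b c d ≡ true → Interleaved a c b d
  sorted-crosses⇒interleaved {a} {b} {c} {d} a≤ b≤ c≤ d≤ ab cd e
    rewrite min′-≤ ab | max′-≤ ab | min′-≤ cd | max′-≤ cd with ∨-true {(ps a <ᵇ ps c) ∧ _} e
  ... | inj₁ f with ∧-true {ps a <ᵇ ps c} f
  ...   | f₁ , g with ∧-true {ps c <ᵇ ps b} g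
  ...   | f₂ , f₃ = asc d≤ (<ᵇ-true⇒< f₁) (<ᵇ-true⇒< f₂) (<ᵇ-true⇒< f₃) a≤ c≤ b≤
  sorted-crosses⇒interleaved {a} {b} {c} {d} a≤ b≤ c≤ d≤ ab cd e | inj₂ f with ∧-true {ps c <ᵇ ps a} f
  ...   | f₁ , g with ∧-true {ps a <ᵇ ps d} g
  ...   | f₂ , f₃ = swap (asc b≤ (<ᵇ-true⇒< f₁) (<ᵇ-true⇒< f₂) (<ᵇ-true⇒< f₃) c≤ a≤ d≤)

  crosses⇒interleaved : ∀ {a b c d} → a ≤ suc n → b ≤ suc n → c ≤ suc n → d ≤ suc n →
                        crosses 𝒜 a b c d ≡ true → Interleaved a c b d
  crosses⇒interleaved {a} {b} {c} {d} a≤ b≤ c≤ d≤ e with ≤-total (ps a) (ps b) | ≤-total (ps c) (ps d)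
  ... | inj₁ ab | inj₁ cd = sorted-crosses⇒interleaved a≤ b≤ c≤ d≤ ab cd e
  ... | inj₁ ab | inj₂ dc = flip₂ (sorted-crosses⇒interleaved a≤ b≤ d≤ c≤ ab dc (trans (crosses-flip₂ a b d c) e))
  ... | inj₂ ba | inj₁ cd = flip₁ (sorted-crosses⇒interleaved b≤ a≤ c≤ d≤ ba cd (trans (crosses-flip₁ b a c d) e))
  ... | inj₂ ba | inj₂ dc = flip₁ (flip₂ (sorted-crosses⇒interleaved b≤ a≤ d≤ c≤ ba dc
    (trans (crosses-flip₁ b a d c) (trans (crosses-flip₂ a b d c) e))))

  -- Indicators and cardinalities of the sets K.

  -- The indicator of K(a,b) splits as R b - L a with each term depending on one
  -- end only; this makes all linear relations between the K's telescoping sums.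
  R L : ℕ → ℕ → ℚ
  R b i = if up b then ind (dn i) +ℚ ind (up i ∧ (b ≤ᵇ i)) else ind (dn i ∧ (i <ᵇ b))
  L a i = if up a then - ind (up i ∧ (i ≤ᵇ a)) else ind (dn i ∧ (i ≤ᵇ a))

  ind-inK : ∀ {a b} i → a < b → ind (inK 𝒜 a b i) ≡ R b i -ℚ L a i
  ind-inK {a} {b} i a<b with up a | up b | up i | a <ᵇ i in f | i <ᵇ b in g
  ... | false | false | false | true  | true  rewrite ≤ᵇ≡not<ᵇ i a | f = refl
  ... | false | false | false | true  | false rewrite ≤ᵇ≡not<ᵇ i a | f = refl
  ... | false | false | false | false | true  rewrite ≤ᵇ≡not<ᵇ i a | f = refl
  ... | false | false | true  | _     | _     = refl
  ... | false | true  | false | true  | _     rewrite ≤ᵇ≡not<ᵇ i a | f = refl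
  ... | false | true  | false | false | _     rewrite ≤ᵇ≡not<ᵇ i a | f = refl
  ... | false | true  | true  | _     | true  rewrite ≤ᵇ≡not<ᵇ b i | g = refl
  ... | false | true  | true  | _     | false rewrite ≤ᵇ≡not<ᵇ b i | g = refl
  ... | true  | false | false | _     | true  = refl
  ... | true  | false | false | _     | false = refl
  ... | true  | false | true  | true  | _     rewrite ≤ᵇ≡not<ᵇ i a | f = refl
  ... | true  | false | true  | false | _     rewrite ≤ᵇ≡not<ᵇ i a | f = refl
  ... | true  | true  | false | _     | _     = refl
  ... | true  | true  | true  | true  | true  rewrite ≤ᵇ≡not<ᵇ i a | f | ≤ᵇ≡not<ᵇ b i | g = refl
  ... | true  | true  | true  | true  | false rewrite ≤ᵇ≡not<ᵇ i a | f | ≤ᵇ≡not<ᵇ b i | g = refl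
  ... | true  | true  | true  | false | true  rewrite ≤ᵇ≡not<ᵇ i a | f | ≤ᵇ≡not<ᵇ b i | g = refl
  -- Both comparisons failing would give `b ≤ i ≤ a`.
  ... | _     | _     | _     | false | false =
    ⊥-elim (<⇒≱ a<b (≤-trans (≮⇒≥ λ p → true≢false (<⇒<ᵇ-true p) g) (≮⇒≥ λ p → true≢false (<⇒<ᵇ-true p) f)))

  -- The correction for gluing chords at `j`: the indicators of K(a,j) and K(j,b) add up to that of
  -- K(a,b) plus `R j - L j`. A down `j` lies in K(a,b) but in neither part.
  R-L-down : ∀ j i → up j ≡ false → R j i -ℚ L j i ≡ - ind (i ≡ᵇ j)
  R-L-down j i e with <-cmp i j
  ... | tri< i<j i≢j _ rewrite e | <⇒<ᵇ-true i<j | ≤⇒≤ᵇ-true (<⇒≤ i<j) | ≢⇒≡ᵇ-false i≢j = Q.+-inverseʳ (ind (dn i ∧ true))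
  ... | tri≈ _ refl _ rewrite e | ≥⇒<ᵇ-false (≤-refl {i}) | ≤⇒≤ᵇ-true (≤-refl {i}) | ≡⇒≡ᵇ-true (refl {x = i}) = refl
  ... | tri> _ i≢j j<i rewrite e | ≥⇒<ᵇ-false (<⇒≤ j<i) | >⇒≤ᵇ-false j<i | ≢⇒≡ᵇ-false i≢j with dn i
  ...   | true  = refl
  ...   | false = refl

  -- At an up `j` the two parts cover, besides K(a,b), every label once and `j` once more. The
  -- all-one vector is constant on H; this is where `total` enters.
  R-L-up : ∀ j i → up j ≡ true → R j i -ℚ L j i ≡ 1ℚ +ℚ ind (i ≡ᵇ j)
  R-L-up j i e with <-cmp i j
  ... | tri≈ _ refl _ rewrite e | ≤⇒≤ᵇ-true (≤-refl {i}) | ≡⇒≡ᵇ-true (refl {x = i}) = refl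
  ... | tri< i<j i≢j _ rewrite e | >⇒≤ᵇ-false i<j | ≤⇒≤ᵇ-true (<⇒≤ i<j) | ≢⇒≡ᵇ-false i≢j with up i
  ...   | true  = refl
  ...   | false = refl
  R-L-up j i e | tri> _ i≢j j<i rewrite e | ≤⇒≤ᵇ-true (<⇒≤ j<i) | >⇒≤ᵇ-false j<i | ≢⇒≡ᵇ-false i≢j with up i
  ...   | true  = refl
  ...   | false = refl

  sumK : (ℕ → ℚ) → (ℕ → Bool) → ℚ
  sumK y K = ∑ 1 n (λ i → ind (K i) *ℚ y i)

  total : (ℕ → ℚ) → ℚ
  total y = ∑ 1 n y

  ρ ƛ : (ℕ → ℚ) → ℕ → ℚ
  ρ y b = ∑ 1 n (λ i → R b i *ℚ y i)
  ƛ y a = ∑ 1 n (λ i → L a i *ℚ y i)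

  sumK≡ρ-ƛ : ∀ y {a b} → a < b → sumK y (inK 𝒜 a b) ≡ ρ y b -ℚ ƛ y a
  sumK≡ρ-ƛ y {a} {b} a<b = trans (∑-cong 1 n λ i _ _ → trans (cong (_*ℚ y i) (ind-inK i a<b)) (lem (R b i) (L a i) (y i)))
    (∑-sub 1 n (λ i → R b i *ℚ y i) (λ i → L a i *ℚ y i))
    where
    lem : ∀ r l y → (r -ℚ l) *ℚ y ≡ r *ℚ y -ℚ l *ℚ y
    lem = solve-∀ ℚ-ring

  sumK-singleton : ∀ (y : ℕ → ℚ) j → 1 ≤ j → j ≤ n → ∑ 1 n (λ i → ind (i ≡ᵇ j) *ℚ y i) ≡ y j
  sumK-singleton y j 1≤j j≤n = trans
    (∑-delta 1 n j _ 1≤j (s≤s j≤n) λ i i≢j → trans (cong (λ b → ind b *ℚ y i) (≢⇒≡ᵇ-false i≢j)) (Q.*-zeroˡ (y i)))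
    (trans (cong (λ b → ind b *ℚ y j) (≡⇒≡ᵇ-true (refl {x = j}))) (Q.*-identityˡ (y j)))

  ρ-ƛ-down : ∀ y j → 1 ≤ j → j ≤ n → up j ≡ false → ρ y j -ℚ ƛ y j ≡ - y j
  ρ-ƛ-down y j 1≤j j≤n e = trans (sym (∑-sub 1 n (λ i → R j i *ℚ y i) (λ i → L j i *ℚ y i)))
    (trans (∑-cong 1 n λ i _ _ → trans (lem (R j i) (L j i) (y i)) (trans (cong (_*ℚ y i) (R-L-down j i e)) (lem₂ (ind (i ≡ᵇ j)) (y i))))
    (trans (∑-* 1 n (- 1ℚ) (λ i → ind (i ≡ᵇ j) *ℚ y i)) (trans (cong (- 1ℚ *ℚ_) (sumK-singleton y j 1≤j j≤n)) (lem₃ (y j)))))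
    where
    lem : ∀ r l y → r *ℚ y -ℚ l *ℚ y ≡ (r -ℚ l) *ℚ y
    lem = solve-∀ ℚ-ring
    lem₂ : ∀ d y → (- d) *ℚ y ≡ (- 1ℚ) *ℚ (d *ℚ y)
    lem₂ = solve-∀ ℚ-ring
    lem₃ : ∀ y → (- 1ℚ) *ℚ y ≡ - y
    lem₃ = solve-∀ ℚ-ring

  ρ-ƛ-up : ∀ y j → 1 ≤ j → j ≤ n → up j ≡ true → ρ y j -ℚ ƛ y j ≡ total y +ℚ y j
  ρ-ƛ-up y j 1≤j j≤n e = trans (sym (∑-sub 1 n (λ i → R j i *ℚ y i) (λ i → L j i *ℚ y i)))
    (trans (∑-cong 1 n λ i _ _ → trans (lem (R j i) (L j i) (y i)) (trans (cong (_*ℚ y i) (R-L-up j i e)) (lem₂ (ind (i ≡ᵇ j)) (y i))))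
    (trans (∑-+ 1 n y (λ i → ind (i ≡ᵇ j) *ℚ y i)) (cong (total y +ℚ_) (sumK-singleton y j 1≤j j≤n))))
    where
    lem : ∀ r l y → r *ℚ y -ℚ l *ℚ y ≡ (r -ℚ l) *ℚ y
    lem = solve-∀ ℚ-ring
    lem₂ : ∀ d y → (1ℚ +ℚ d) *ℚ y ≡ y +ℚ d *ℚ y
    lem₂ = solve-∀ ℚ-ring

  ƛ-0 : ∀ y → ƛ y 0 ≡ 0ℚ
  ƛ-0 y = ∑-zero 1 n λ i 1≤i _ → trans (cong (λ b → ind (dn i ∧ b) *ℚ y i) (>⇒≤ᵇ-false 1≤i))
    (trans (cong (λ b → ind b *ℚ y i) (𝔹.∧-zeroʳ (dn i))) (Q.*-zeroˡ (y i)))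

  -- arc a b is the length of the counterclockwise walk from a to b when a < b.
  r l : ℕ → ℚ
  r b = ι (ps b)
  l a = if up a then ι (ps a) -ℚ ι N else ι (ps a)

  arc : ℕ → ℕ → ℚ
  arc a b = r b -ℚ l a

  l-down : ∀ a → up a ≡ false → l a ≡ ι (ps a)
  l-down a e = cong (λ u → if u then ι (ps a) -ℚ ι N else ι (ps a)) e

  l-up : ∀ a → up a ≡ true → l a ≡ ι (ps a) -ℚ ι N
  l-up a e = cong (λ u → if u then ι (ps a) -ℚ ι N else ι (ps a)) e

  one : ℕ → ℚ
  one _ = 1ℚ

  -- Counts the labels before `b`, label 0 being the extra one. For up `b` the label `b` itself
  -- stands in for `n+1`, which precedes it but is no coordinate.
  ρ-one : ∀ b → 1 ≤ b → b ≤ suc n → 1ℚ +ℚ ρ one b ≡ r b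
  ρ-one (suc b) _ (s≤s b≤n) with bool (up (suc b))
  ... | inj₂ e = trans (cong (1ℚ +ℚ_) (trans (∑-cong 1 n λ i _ _ → trans (Q.*-identityʳ (R (suc b) i)) (R-suc i)) (∑-prefix dn n b b≤n)))
    (trans (sym (ι-suc (downs b))) (cong ι (trans (sym (downs-suc b e)) (sym (ps-down (suc b) e)))))
    where
    R-suc : ∀ i → R (suc b) i ≡ ind (dn i ∧ (i ≤ᵇ b))
    R-suc zero    rewrite e = refl
    R-suc (suc i) rewrite e = refl
  ... | inj₁ e = trans (cong (1ℚ +ℚ_) (trans (∑-cong 1 n λ i _ _ → trans (Q.*-identityʳ (R (suc b) i)) (R-up i))
      (trans (∑-+ 1 n _ _) (cong₂ _+ℚ_ (sym (ι-countIn dn 1 n)) (∑-suffix up n b b≤n)))))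
    (trans (cong (1ℚ +ℚ_) (sym (ι-+ (downs n) (ups (suc b))))) (trans (sym (ι-suc _)) (cong ι (sym (ps-up (suc b) e)))))
    where
    R-up : ∀ i → R (suc b) i ≡ ind (dn i) +ℚ ind (up i ∧ (suc b ≤ᵇ i))
    R-up i rewrite e = refl

  -- For up `a` the sum is minus the number of up labels not exceeding `a`. These fill the positions
  -- from that of `a` to the last one, hence the shift by `N`.
  ƛ-one : ∀ a → a ≤ n → ƛ one a ≡ l a
  ƛ-one a a≤n with bool (up a)
  ... | inj₂ e = trans (∑-cong 1 n λ i _ _ → trans (Q.*-identityʳ (L a i)) (L-down i))
    (trans (∑-prefix dn n a a≤n) (trans (cong ι (sym (ps-down a e))) (sym (l-down a e))))
    where
    L-down : ∀ i → L a i ≡ ind (dn i ∧ (i ≤ᵇ a))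
    L-down i rewrite e = refl
  ... | inj₁ e = trans (∑-cong 1 n λ i _ _ → trans (cong (_*ℚ 1ℚ) (L-up i)) (lem (ind (up i ∧ (i ≤ᵇ a)))))
    (trans (∑-* 1 n (- 1ℚ) _) (trans (cong (- 1ℚ *ℚ_) (∑-prefix up n a a≤n))
    -- The 2 completes both terms: `ps a` is `2 + downs n + ups (suc a)` and `N` is
    -- `2 + ups 1 + downs n`.
    (trans (lem₂ (ι (ups 1)) (ι (downs n)) (ι (countIn up 1 a)) (ι (ups (suc a))) split) (trans
      (cong₂ (λ p q → p -ℚ (2ℚ +ℚ q)) ps≡ (trans (sym (ι-+ (ups 1) (downs n))) (cong ι ups+downs)))
      (trans (cong (ι (ps a) -ℚ_) 2+n≡N) (sym (l-up a e)))))))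
    where
    L-up : ∀ i → L a i ≡ - ind (up i ∧ (i ≤ᵇ a))
    L-up i rewrite e = refl
    lem : ∀ x → (- x) *ℚ 1ℚ ≡ (- 1ℚ) *ℚ x
    lem = solve-∀ ℚ-ring
    split : ι (ups 1) ≡ ι (countIn up 1 a) +ℚ ι (ups (suc a))
    split = trans (cong ι (countIn-∸ up (s≤s z≤n) (s≤s a≤n))) (ι-+ (countIn up 1 a) (ups (suc a)))
    lem₂ : ∀ u d c s → u ≡ c +ℚ s → (- 1ℚ) *ℚ c ≡ (2ℚ +ℚ (d +ℚ s)) -ℚ (2ℚ +ℚ (u +ℚ d))
    lem₂ u d c s refl = lem₃ d c s
      where
      lem₃ : ∀ d c s → (- 1ℚ) *ℚ c ≡ (2ℚ +ℚ (d +ℚ s)) -ℚ (2ℚ +ℚ ((c +ℚ s) +ℚ d))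
      lem₃ = solve-∀ ℚ-ring
    2+n≡N : 2ℚ +ℚ ι n ≡ ι N
    2+n≡N = trans (Q.+-assoc 1ℚ 1ℚ (ι n)) (trans (cong (1ℚ +ℚ_) (sym (ι-suc n))) (sym (ι-suc (suc n))))
    lem₄ : ∀ d s → 2ℚ +ℚ (d +ℚ s) ≡ (1ℚ +ℚ d) +ℚ (1ℚ +ℚ s)
    lem₄ = solve-∀ ℚ-ring
    ps≡ : 2ℚ +ℚ (ι (downs n) +ℚ ι (ups (suc a))) ≡ ι (ps a)
    ps≡ = trans (lem₄ (ι (downs n)) (ι (ups (suc a)))) (trans (cong₂ _+ℚ_ (sym (ι-suc (downs n))) (sym (ι-suc (ups (suc a)))))
      (trans (sym (ι-+ (suc (downs n)) (suc (ups (suc a))))) (cong ι (sym (trans (ps-up a e) (cong (suc (downs n) +_) (ups-up a e)))))))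

  card≡arc : ∀ {a b} → a < b → b ≤ suc n → ι (countIn (inK 𝒜 a b) 1 n) ≡ arc a b -ℚ 1ℚ
  card≡arc {a} {suc b} (s≤s a≤b) (s≤s b≤n) = trans (ι-countIn (inK 𝒜 a (suc b)) 1 n)
    (trans (∑-cong 1 n λ i _ _ → sym (Q.*-identityʳ (ind (inK 𝒜 a (suc b) i))))
    (trans (sumK≡ρ-ƛ one (s≤s a≤b))
    (trans (lem (ρ one (suc b)) (ƛ one a)) (cong₂ (λ p q → (p -ℚ q) -ℚ 1ℚ) (ρ-one (suc b) (s≤s z≤n) (s≤s b≤n)) (ƛ-one a (≤-trans a≤b b≤n))))))
    where
    lem : ∀ p q → p -ℚ q ≡ ((1ℚ +ℚ p) -ℚ q) -ℚ 1ℚ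
    lem = solve-∀ ℚ-ring

  -- Doubled slacks and the exchange identity.

  abstract
    -- Twice the slack of the inequality of {a,b}, a < b.
    δ : (ℕ → ℚ) → ℕ → ℕ → ℚ
    δ y a b = 2ℚ *ℚ (ρ y b -ℚ ƛ y a) -ℚ (arc a b -ℚ 1ℚ) *ℚ arc a b

    δ≡ : ∀ y a b → δ y a b ≡ 2ℚ *ℚ (ρ y b -ℚ ƛ y a) -ℚ (arc a b -ℚ 1ℚ) *ℚ arc a b
    δ≡ y a b = refl

  -- The only part of `δ y a b` that mixes its two ends is `2 * r b * l a`; all else cancels in the
  -- alternating sum.
  ptolemy : ∀ y w x z v → δ y w z +ℚ δ y x v ≡ (δ y w v +ℚ δ y x z) +ℚ 2ℚ *ℚ ((r v -ℚ r z) *ℚ (l x -ℚ l w))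
  ptolemy y w x z v = trans (cong₂ _+ℚ_ (δ≡ y w z) (δ≡ y x v)) (trans
    (lem (ρ y v) (ρ y z) (ƛ y w) (ƛ y x) (r v) (r z) (l w) (l x))
    (cong₂ (λ s t → (s +ℚ t) +ℚ 2ℚ *ℚ ((r v -ℚ r z) *ℚ (l x -ℚ l w))) (sym (δ≡ y w v)) (sym (δ≡ y x z))))
    where
    lem : ∀ ρv ρz λw λx rv rz lw lx →
      (2ℚ *ℚ (ρz -ℚ λw) -ℚ ((rz -ℚ lw) -ℚ 1ℚ) *ℚ (rz -ℚ lw)) +ℚ (2ℚ *ℚ (ρv -ℚ λx) -ℚ ((rv -ℚ lx) -ℚ 1ℚ) *ℚ (rv -ℚ lx)) ≡
      ((2ℚ *ℚ (ρv -ℚ λw) -ℚ ((rv -ℚ lw) -ℚ 1ℚ) *ℚ (rv -ℚ lw)) +ℚ (2ℚ *ℚ (ρz -ℚ λx) -ℚ ((rz -ℚ lx) -ℚ 1ℚ) *ℚ (rz -ℚ lx)))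
        +ℚ 2ℚ *ℚ ((rv -ℚ rz) *ℚ (lx -ℚ lw))
    lem = solve-∀ ℚ-ring

  r-down : ∀ {z v} → z < v → up z ≡ false → r z <ℚ r v
  r-down z<v e = ι-mono-< (below z<v e)

  r-up : ∀ {z v} → z < v → v ≤ suc n → up z ≡ true → r v <ℚ r z
  r-up z<v v≤ e = ι-mono-< (above z<v v≤ e)

  ps-N<0 : ∀ a → a ≤ suc n → ι (ps a) -ℚ ι N <ℚ 0ℚ
  ps-N<0 a a≤ = <-diff-neg (ι-mono-< (s≤s (ps≤ a≤)))

  l-up<0 : ∀ a → a ≤ suc n → up a ≡ true → l a <ℚ 0ℚ
  l-up<0 a a≤ e = subst (_<ℚ 0ℚ) (sym (l-up a e)) (ps-N<0 a a≤)

  l-<-down : ∀ {w x} → w < x → x ≤ suc n → up x ≡ false → l w <ℚ l x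
  l-<-down {w} {x} w<x x≤ e with bool (up w)
  ... | inj₂ f = subst₂ _<ℚ_ (sym (l-down w f)) (sym (l-down x e)) (ι-mono-< (below w<x f))
  ... | inj₁ f = Q.<-≤-trans (l-up<0 w (<≤⇒≤ w<x x≤) f) (subst (0ℚ ≤ℚ_) (sym (l-down x e)) (0≤ι (ps x)))

  l-<-up : ∀ {w x} → w < x → x ≤ suc n → up x ≡ true → l x <ℚ l w
  l-<-up {w} {x} w<x x≤ e with bool (up w)
  ... | inj₂ f = Q.<-≤-trans (l-up<0 x x≤ e) (subst (0ℚ ≤ℚ_) (sym (l-down w f)) (0≤ι (ps w)))
  ... | inj₁ f = subst₂ _<ℚ_ (sym (l-up x e)) (sym (l-up w f)) (Q.+-monoˡ-< (- ι N) (ι-mono-< (above w<x x≤ f)))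

  abstract
    -- Chords found through positions come with their labels in either order, while `δ` represents a
    -- slack only with the smaller label first.
    δˢ : (ℕ → ℚ) → ℕ → ℕ → ℚ
    δˢ y a b = if a <ᵇ b then δ y a b else δ y b a

    δˢ-< : ∀ y {a b} → a < b → δˢ y a b ≡ δ y a b
    δˢ-< y {a} {b} a<b = cong (λ c → if c then δ y a b else δ y b a) (<⇒<ᵇ-true a<b)

    δˢ-> : ∀ y {a b} → b < a → δˢ y a b ≡ δ y b a
    δˢ-> y {a} {b} b<a = cong (λ c → if c then δ y a b else δ y b a) (≥⇒<ᵇ-false (<⇒≤ b<a))

  δˢ-sym : ∀ y a b → δˢ y a b ≡ δˢ y b a
  δˢ-sym y a b with <-cmp a b
  ... | tri< a<b _ _  = trans (δˢ-< y a<b) (sym (δˢ-> y a<b))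
  ... | tri≈ _ refl _ = refl
  ... | tri> _ _ b<a  = trans (δˢ-> y b<a) (sym (δˢ-< y b<a))

  -- Which pair of opposite sides occurs depends on the four labels.
  Ptolemy : ℕ → ℕ → ℕ → ℕ → Set
  Ptolemy A B C D = Σ ℚ λ c → 0ℚ <ℚ c ×
    ((∀ y → δˢ y A C +ℚ δˢ y B D ≡ (δˢ y A B +ℚ δˢ y C D) +ℚ c) ⊎
     (∀ y → δˢ y A C +ℚ δˢ y B D ≡ (δˢ y B C +ℚ δˢ y D A) +ℚ c))

  -- For middle labels of equal type the two factors in `ptolemy` have the same sign, and `w`-`z`,
  -- `x`-`v` is the crossing pair. For different types the signs are opposite and the crossing pair
  -- is on the other side of the identity, so the constant changes sign and is positive again.
  quad⇒ptolemy : ∀ {A B C D} → Quad A B C D → Ptolemy A B C D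
  quad⇒ptolemy (flip₁ {A} {B} {C} {D} q) with quad⇒ptolemy q
  ... | c , 0<c , inj₁ h = c , 0<c , inj₂ λ y → trans (cong (_+ℚ δˢ y B D) (δˢ-sym y C A)) (trans (h y)
          (cong₂ (λ s t → (s +ℚ t) +ℚ c) (δˢ-sym y A B) (δˢ-sym y C D)))
  ... | c , 0<c , inj₂ h = c , 0<c , inj₁ λ y → trans (cong (_+ℚ δˢ y B D) (δˢ-sym y C A)) (trans (h y)
          (cong₂ (λ s t → (s +ℚ t) +ℚ c) (δˢ-sym y B C) (δˢ-sym y D A)))
  quad⇒ptolemy (flip₂ {A} {B} {C} {D} q) with quad⇒ptolemy q
  ... | c , 0<c , inj₁ h = c , 0<c , inj₂ λ y → trans (cong (δˢ y A C +ℚ_) (δˢ-sym y D B)) (trans (h y)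
          (cong (_+ℚ c) (trans (Q.+-comm (δˢ y A B) (δˢ y C D)) (cong₂ _+ℚ_ (δˢ-sym y C D) (δˢ-sym y A B)))))
  ... | c , 0<c , inj₂ h = c , 0<c , inj₁ λ y → trans (cong (δˢ y A C +ℚ_) (δˢ-sym y D B)) (trans (h y)
          (cong (_+ℚ c) (trans (Q.+-comm (δˢ y B C) (δˢ y D A)) (cong₂ _+ℚ_ (δˢ-sym y D A) (δˢ-sym y B C)))))
  quad⇒ptolemy (swap {A} {B} {C} {D} q) with quad⇒ptolemy q
  ... | c , 0<c , inj₁ h = c , 0<c , inj₁ λ y → trans (Q.+-comm (δˢ y B D) (δˢ y A C)) (trans (h y)
          (cong₂ (λ s t → (s +ℚ t) +ℚ c) (δˢ-sym y A B) (δˢ-sym y C D)))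
  ... | c , 0<c , inj₂ h = c , 0<c , inj₂ λ y → trans (Q.+-comm (δˢ y B D) (δˢ y A C)) (trans (h y)
          (cong (_+ℚ c) (trans (Q.+-comm (δˢ y B C) (δˢ y D A)) (cong₂ _+ℚ_ (δˢ-sym y D A) (δˢ-sym y B C)))))
  quad⇒ptolemy (alt {w} {x} {z} {v} w<x x<z z<v v≤ e) =
    c , 0<* 0<2ℚ 0<c′ , inj₂ λ y → begin
      δˢ y w z +ℚ δˢ y x v         ≡⟨ cong₂ _+ℚ_ (δˢ-< y (<-trans w<x x<z)) (δˢ-< y (<-trans x<z z<v)) ⟩
      δ y w z +ℚ δ y x v           ≡⟨ ptolemy y w x z v ⟩
      (δ y w v +ℚ δ y x z) +ℚ c    ≡⟨ cong (_+ℚ c) (Q.+-comm (δ y w v) (δ y x z)) ⟩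
      (δ y x z +ℚ δ y w v) +ℚ c    ≡⟨ cong₂ (λ s t → (s +ℚ t) +ℚ c) (δˢ-< y x<z) (δˢ-> y (<-trans w<x (<-trans x<z z<v))) ⟨
      (δˢ y x z +ℚ δˢ y v w) +ℚ c  ∎
    where
    open ≡-Reasoning
    c : ℚ
    c = 2ℚ *ℚ ((r v -ℚ r z) *ℚ (l x -ℚ l w))
    x≤ : x ≤ suc n
    x≤ = <≤⇒≤ (<-trans x<z z<v) v≤
    0<c′ : 0ℚ <ℚ (r v -ℚ r z) *ℚ (l x -ℚ l w)
    0<c′ with bool (up x)
    ... | inj₂ f = 0<* (0<-diff (r-down z<v (trans (sym e) f))) (0<-diff (l-<-down w<x x≤ f))
    ... | inj₁ f = 0<-*-neg (<-diff-neg (r-up z<v v≤ (trans (sym e) f))) (<-diff-neg (l-<-up w<x x≤ f))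
  quad⇒ptolemy (nest {w} {x} {z} {v} w<x x<z z<v v≤ e) =
    c , 0<* 0<2ℚ 0<c′ , inj₂ λ y → begin
      δˢ y w v +ℚ δˢ y x z         ≡⟨ cong₂ _+ℚ_ (δˢ-< y (<-trans w<x (<-trans x<z z<v))) (δˢ-< y x<z) ⟩
      δ y w v +ℚ δ y x z           ≡⟨ lem (δ y w v +ℚ δ y x z) (r v -ℚ r z) (l w) (l x) ⟩
      ((δ y w v +ℚ δ y x z) +ℚ 2ℚ *ℚ ((r v -ℚ r z) *ℚ (l x -ℚ l w))) +ℚ c ≡⟨ cong (_+ℚ c) (ptolemy y w x z v) ⟨
      (δ y w z +ℚ δ y x v) +ℚ c    ≡⟨ cong (_+ℚ c) (Q.+-comm (δ y w z) (δ y x v)) ⟩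
      (δ y x v +ℚ δ y w z) +ℚ c    ≡⟨ cong₂ (λ s t → (s +ℚ t) +ℚ c) (δˢ-< y (<-trans x<z z<v)) (δˢ-> y (<-trans w<x x<z)) ⟨
      (δˢ y x v +ℚ δˢ y z w) +ℚ c  ∎
    where
    open ≡-Reasoning
    c : ℚ
    c = 2ℚ *ℚ ((r v -ℚ r z) *ℚ (l w -ℚ l x))
    lem : ∀ s t p q → s ≡ (s +ℚ 2ℚ *ℚ (t *ℚ (q -ℚ p))) +ℚ 2ℚ *ℚ (t *ℚ (p -ℚ q))
    lem = solve-∀ ℚ-ring
    x≤ : x ≤ suc n
    x≤ = <≤⇒≤ (<-trans x<z z<v) v≤
    0<c′ : 0ℚ <ℚ (r v -ℚ r z) *ℚ (l w -ℚ l x)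
    0<c′ with bool (up x) | bool (up z)
    ... | inj₂ f | inj₂ g = ⊥-elim (e (trans f (sym g)))
    ... | inj₁ f | inj₁ g = ⊥-elim (e (trans f (sym g)))
    ... | inj₂ f | inj₁ g = 0<-*-neg (<-diff-neg (r-up z<v v≤ g)) (<-diff-neg (l-<-down w<x x≤ f))
    ... | inj₁ f | inj₂ g = 0<* (0<-diff (r-down z<v g)) (0<-diff (l-<-up w<x x≤ f))

  -- Triangle identities.

  defect : (ℕ → ℚ) → ℚ
  defect y = 2ℚ *ℚ total y -ℚ ι n *ℚ (1ℚ +ℚ ι n)

  ι-N : ι N ≡ 2ℚ +ℚ ι n
  ι-N = trans (ι-suc (suc n)) (trans (cong (1ℚ +ℚ_) (ι-suc n)) (sym (Q.+-assoc 1ℚ 1ℚ (ι n))))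

  -- The coordinate x_j prescribed by a triangle a < j < b: μ_j(a) and μ_j(b) are the
  -- two arcs if j is down, and their complements to N if j is up.
  middleCoord : ℕ → ℕ → ℕ → ℚ
  middleCoord a j b = if up j then (1ℚ +ℚ ι n) -ℚ (ι N -ℚ arc a j) *ℚ (ι N -ℚ arc j b) else arc a j *ℚ arc j b

  middleCoord-down : ∀ a j b → up j ≡ false → middleCoord a j b ≡ arc a j *ℚ arc j b
  middleCoord-down a j b e rewrite e = refl

  middleCoord-up : ∀ a j b → up j ≡ true → middleCoord a j b ≡ (1ℚ +ℚ ι n) -ℚ (ι N -ℚ arc a j) *ℚ (ι N -ℚ arc j b)
  middleCoord-up a j b e rewrite e = refl

  module _ (y : ℕ → ℚ) {a j b : ℕ} (a<j : a < j) (j<b : j < b) (b≤ : b ≤ suc n) where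

    private
      1≤j : 1 ≤ j
      1≤j = ≤-<-trans z≤n a<j
      j≤n : j ≤ n
      j≤n = ≤-pred (<-≤-trans j<b b≤)

    -- Since `l j` is `r j`, the arcs s and t of the two parts add up to that of `a`-`b`. The
    -- quadratic terms differ by `2 * s * t`, and gluing loses `2 * y j`; the prescribed coordinate
    -- balances the two.
    triangle-down : up j ≡ false → y j ≡ middleCoord a j b → δ y a b ≡ δ y a j +ℚ δ y j b
    triangle-down e h = trans (δ≡ y a b) (trans (lem (ρ y b) (ƛ y a) (r b) (l a) (r j) (ρ y j)) (sym (cong₂ _+ℚ_ (δ≡ y a j)
        (trans (δ≡ y j b) (trans (cong (λ t → 2ℚ *ℚ (ρ y b -ℚ ƛ y j) -ℚ (r b -ℚ t -ℚ 1ℚ) *ℚ (r b -ℚ t)) l≡r)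
               (cong (λ t → 2ℚ *ℚ (ρ y b -ℚ t) -ℚ (r b -ℚ r j -ℚ 1ℚ) *ℚ (r b -ℚ r j)) ƛ≡))))))
      where
      l≡r : l j ≡ r j
      l≡r = l-down j e
      ƛ≡ : ƛ y j ≡ ρ y j +ℚ (r j -ℚ l a) *ℚ (r b -ℚ r j)
      ƛ≡ = trans (lem₁ (ƛ y j) (ρ y j)) (trans (cong (λ t → ρ y j -ℚ t) (ρ-ƛ-down y j 1≤j j≤n e))
        (trans (lem₂ (ρ y j) (y j)) (cong (ρ y j +ℚ_) (trans h (trans (middleCoord-down a j b e) (cong (λ t → (r j -ℚ l a) *ℚ (r b -ℚ t)) l≡r))))))
        where
        lem₁ : ∀ x z → x ≡ z -ℚ (z -ℚ x)
        lem₁ = solve-∀ ℚ-ring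
        lem₂ : ∀ x z → x -ℚ (- z) ≡ x +ℚ z
        lem₂ = solve-∀ ℚ-ring
      lem : ∀ ρb λa rb la rj ρj → 2ℚ *ℚ (ρb -ℚ λa) -ℚ (rb -ℚ la -ℚ 1ℚ) *ℚ (rb -ℚ la) ≡
        (2ℚ *ℚ (ρj -ℚ λa) -ℚ (rj -ℚ la -ℚ 1ℚ) *ℚ (rj -ℚ la)) +ℚ
        (2ℚ *ℚ (ρb -ℚ (ρj +ℚ (rj -ℚ la) *ℚ (rb -ℚ rj))) -ℚ (rb -ℚ rj -ℚ 1ℚ) *ℚ (rb -ℚ rj))
      lem = solve-∀ ℚ-ring

    -- Now the two arcs s and t add up to that of `a`-`b` plus N. In terms of the complements N - s
    -- and N - t the quadratic terms differ by `N * (N - 1) - 2 * (N - s) * (N - t)`. The constant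
    -- `N * (N - 1)` is shared between `n + 1`, doubled, and `defect`.
    triangle-up : up j ≡ true → y j ≡ middleCoord a j b → δ y a b +ℚ defect y ≡ δ y a j +ℚ δ y j b
    triangle-up e h = trans (cong (_+ℚ defect y) (δ≡ y a b)) (trans (lem (ρ y b) (ƛ y a) (r b) (l a) (r j) (ρ y j) (total y) (ι n)) (sym (cong₂ _+ℚ_ (δ≡ y a j)
        (trans (δ≡ y j b) (trans (cong (λ t → 2ℚ *ℚ (ρ y b -ℚ ƛ y j) -ℚ (r b -ℚ t -ℚ 1ℚ) *ℚ (r b -ℚ t)) l≡)
               (cong (λ t → 2ℚ *ℚ (ρ y b -ℚ t) -ℚ (r b -ℚ (r j -ℚ (2ℚ +ℚ ι n)) -ℚ 1ℚ) *ℚ (r b -ℚ (r j -ℚ (2ℚ +ℚ ι n)))) ƛ≡))))))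
      where
      l≡ : l j ≡ r j -ℚ (2ℚ +ℚ ι n)
      l≡ = trans (l-up j e) (cong (r j -ℚ_) ι-N)
      ƛ≡ : ƛ y j ≡ ρ y j -ℚ (total y +ℚ ((1ℚ +ℚ ι n) -ℚ ((2ℚ +ℚ ι n) -ℚ (r j -ℚ l a)) *ℚ ((2ℚ +ℚ ι n) -ℚ (r b -ℚ (r j -ℚ (2ℚ +ℚ ι n))))))
      ƛ≡ = trans (lem₁ (ƛ y j) (ρ y j)) (cong (λ t → ρ y j -ℚ t) (trans (ρ-ƛ-up y j 1≤j j≤n e)
        (cong (total y +ℚ_) (trans h (trans (middleCoord-up a j b e)
          (cong₂ (λ s t → (1ℚ +ℚ ι n) -ℚ (s -ℚ (r j -ℚ l a)) *ℚ (s -ℚ (r b -ℚ t))) ι-N l≡))))))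
        where
        lem₁ : ∀ x z → x ≡ z -ℚ (z -ℚ x)
        lem₁ = solve-∀ ℚ-ring
      lem : ∀ ρb λa rb la rj ρj t m → (2ℚ *ℚ (ρb -ℚ λa) -ℚ (rb -ℚ la -ℚ 1ℚ) *ℚ (rb -ℚ la)) +ℚ (2ℚ *ℚ t -ℚ m *ℚ (1ℚ +ℚ m)) ≡
        (2ℚ *ℚ (ρj -ℚ λa) -ℚ (rj -ℚ la -ℚ 1ℚ) *ℚ (rj -ℚ la)) +ℚ
        (2ℚ *ℚ (ρb -ℚ (ρj -ℚ (t +ℚ ((1ℚ +ℚ m) -ℚ ((2ℚ +ℚ m) -ℚ (rj -ℚ la)) *ℚ ((2ℚ +ℚ m) -ℚ (rb -ℚ (rj -ℚ (2ℚ +ℚ m)))))))) -ℚ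
          (rb -ℚ (rj -ℚ (2ℚ +ℚ m)) -ℚ 1ℚ) *ℚ (rb -ℚ (rj -ℚ (2ℚ +ℚ m))))
      lem = solve-∀ ℚ-ring

  0≤ind : ∀ b → 0ℚ ≤ℚ ind b
  0≤ind true  = Q.nonNegative⁻¹ 1ℚ
  0≤ind false = Q.≤-refl

  δ≡sumK : ∀ y {a b} → a < b → δ y a b ≡ 2ℚ *ℚ sumK y (inK 𝒜 a b) -ℚ (arc a b -ℚ 1ℚ) *ℚ arc a b
  δ≡sumK y {a} {b} a<b = trans (δ≡ y a b) (cong (λ s → 2ℚ *ℚ s -ℚ (arc a b -ℚ 1ℚ) *ℚ arc a b) (sym (sumK≡ρ-ƛ y a<b)))

  -- K has `arc - 1` elements, so it is empty; emptiness is extracted from a vanishing sum of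
  -- indicators.
  δ-lower : ∀ y {a b} → a < b → b ≤ suc n → arc a b ≡ 1ℚ → δ y a b ≡ 0ℚ
  δ-lower y {a} {b} a<b b≤ e = trans (δ≡sumK y a<b) (cong₂ (λ s t → 2ℚ *ℚ s -ℚ (t -ℚ 1ℚ) *ℚ t)
    (∑-zero 1 n λ i 1≤i i≤n → trans (cong (_*ℚ y i) (∑≡0⇒≡0 1 n (λ i → 0≤ind (inK 𝒜 a b i)) empty i 1≤i i≤n)) (Q.*-zeroˡ (y i))) e)
    where
    empty : ∑ 1 n (λ i → ind (inK 𝒜 a b i)) ≡ 0ℚ
    empty = trans (sym (ι-countIn (inK 𝒜 a b) 1 n)) (trans (card≡arc a<b b≤) (cong (_-ℚ 1ℚ) e))

  -- Here K has all n elements, so the slack sees only the total. Sides of the polygon thus give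
  -- degenerate inequalities of two kinds, with empty or with full K.
  δ-upper : ∀ y {a b} → a < b → b ≤ suc n → arc a b ≡ 1ℚ +ℚ ι n → δ y a b ≡ defect y
  δ-upper y {a} {b} a<b b≤ e = trans (δ≡sumK y a<b) (trans (cong₂ (λ s t → 2ℚ *ℚ s -ℚ (t -ℚ 1ℚ) *ℚ t)
    (∑-cong 1 n λ i 1≤i i≤n → trans (cong (_*ℚ y i) (sym (diff≡0 {1ℚ} {ind (inK 𝒜 a b i)} (∑≡0⇒≡0 1 n (λ i → 0≤1-ind (inK 𝒜 a b i)) full i 1≤i i≤n)))) (Q.*-identityˡ (y i))) e)
    (lem (total y) (ι n)))
    where
    0≤1-ind : ∀ b → 0ℚ ≤ℚ 1ℚ -ℚ ind b
    0≤1-ind true  = Q.≤-refl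
    0≤1-ind false = Q.nonNegative⁻¹ 1ℚ
    lem : ∀ t m → 2ℚ *ℚ t -ℚ ((1ℚ +ℚ m) -ℚ 1ℚ) *ℚ (1ℚ +ℚ m) ≡ 2ℚ *ℚ t -ℚ m *ℚ (1ℚ +ℚ m)
    lem = solve-∀ ℚ-ring
    lem₂ : ∀ m → m -ℚ ((1ℚ +ℚ m) -ℚ 1ℚ) ≡ 0ℚ
    lem₂ = solve-∀ ℚ-ring
    full : ∑ 1 n (λ i → 1ℚ -ℚ ind (inK 𝒜 a b i)) ≡ 0ℚ
    full = trans (∑-sub 1 n (λ _ → 1ℚ) (λ i → ind (inK 𝒜 a b i))) (trans (cong₂ _-ℚ_ (∑-one 1 n)
      (trans (sym (ι-countIn (inK 𝒜 a b) 1 n)) (trans (card≡arc a<b b≤) (cong (_-ℚ 1ℚ) e)))) (lem₂ (ι n)))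

  -- Translating sets of diagonals between labels and positions.

  top : ℕ
  top = suc n

  -- Matches a chord given by labels with its sorted positions without fixing which of the labels
  -- comes first.
  data Ends (p q a b : ℕ) : Set where
    fwd : ps a ≡ p → ps b ≡ q → Ends p q a b
    bwd : ps b ≡ p → ps a ≡ q → Ends p q a b

  Ends-sym : ∀ {p q a b} → Ends p q a b → Ends p q b a
  Ends-sym (fwd e f) = bwd e f
  Ends-sym (bwd e f) = fwd e f

  Ends-lab : ∀ {p q} → p ≤ top → q ≤ top → Ends p q (lab p) (lab q)
  Ends-lab p≤ q≤ = fwd (ps-lab p≤) (ps-lab q≤)

  sortEnds : ∀ {a b} → a ≤ top → b ≤ top → a ≢ b → ∃ λ p → ∃ λ q → Ends p q a b × p < q × q ≤ top
  sortEnds {a} {b} a≤ b≤ a≢b with <-cmp (ps a) (ps b)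
  ... | tri< p _ _ = ps a , ps b , fwd refl refl , p , ps≤ b≤
  ... | tri≈ _ e _ = ⊥-elim (a≢b (ps-injective a b a≤ b≤ e))
  ... | tri> _ _ p = ps b , ps a , bwd refl refl , p , ps≤ a≤

  span : ∀ {A B C D p q r s} → Interleaved A B C D → Ends p q A C → p < q → Ends r s B D → r < s →
         (p < r × r < q × q < s) ⊎ (r < p × p < s × s < q)
  span (flip₁ i) e p<q f r<s = span i (Ends-sym e) p<q f r<s
  span (flip₂ i) e p<q f r<s = span i e p<q (Ends-sym f) r<s
  span (swap i)  e p<q f r<s with span i f r<s e p<q
  ... | inj₁ x = inj₂ x
  ... | inj₂ x = inj₁ x
  span (asc _ AB BC CD _ _ _) (fwd refl refl) p<q (fwd refl refl) r<s = inj₁ (AB , BC , CD)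
  span (asc _ AB BC CD _ _ _) (bwd refl refl) p<q _               r<s = ⊥-elim (<-asym p<q (<-trans AB BC))
  span (asc _ AB BC CD _ _ _) _               p<q (bwd refl refl) r<s = ⊥-elim (<-asym r<s (<-trans BC CD))

  interleaved-lab : ∀ {p q r s} → p < r → r < q → q < s → s ≤ top → Interleaved (lab p) (lab r) (lab q) (lab s)
  interleaved-lab p<r r<q q<s s≤ = asc (lab≤ s≤) (ps-mono p≤ r≤ p<r) (ps-mono r≤ q≤ r<q) (ps-mono q≤ s≤ q<s) (lab≤ p≤) (lab≤ r≤) (lab≤ q≤)
    where
    ps-mono : ∀ {p q} → p ≤ top → q ≤ top → p < q → ps (lab p) < ps (lab q)
    ps-mono p≤ q≤ = subst₂ _<_ (sym (ps-lab p≤)) (sym (ps-lab q≤))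
    q≤ = <≤⇒≤ q<s s≤
    r≤ = <≤⇒≤ r<q q≤
    p≤ = <≤⇒≤ p<r r≤

  Adjacent : ℕ → ℕ → Set
  Adjacent p q = q ≡ suc p ⊎ (p ≡ 0 × q ≡ top)

  adjacent⇒Adjacent : ∀ {a b p q} → adjacent 𝒜 a b ≡ true → Ends p q a b → p < q → Adjacent p q
  adjacent⇒Adjacent {a} {b} h e p<q with ∨-true {suc (ps a) ≡ᵇ ps b} h
  adjacent⇒Adjacent h (fwd refl refl) p<q | inj₁ f = inj₁ (sym (≡ᵇ-true⇒≡ f))
  adjacent⇒Adjacent h (bwd refl refl) p<q | inj₁ f = ⊥-elim (<⇒≱ p<q (≤-trans (n≤1+n _) (≤-reflexive (≡ᵇ-true⇒≡ f))))
  adjacent⇒Adjacent {a} {b} h e p<q | inj₂ h′ with ∨-true {suc (ps b) ≡ᵇ ps a} h′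
  adjacent⇒Adjacent h (bwd refl refl) p<q | inj₂ h′ | inj₁ f = inj₁ (sym (≡ᵇ-true⇒≡ f))
  adjacent⇒Adjacent h (fwd refl refl) p<q | inj₂ h′ | inj₁ f = ⊥-elim (<⇒≱ p<q (≤-trans (n≤1+n _) (≤-reflexive (≡ᵇ-true⇒≡ f))))
  adjacent⇒Adjacent {a} {b} h e p<q | inj₂ h′ | inj₂ h″ with ∨-true {(ps a ≡ᵇ 0) ∧ (ps b ≡ᵇ suc n)} h″
  adjacent⇒Adjacent {a} {b} h (fwd refl refl) p<q | inj₂ h′ | inj₂ h″ | inj₁ f with ∧-true {ps a ≡ᵇ 0} f
  ... | f₁ , f₂ = inj₂ (≡ᵇ-true⇒≡ f₁ , ≡ᵇ-true⇒≡ f₂)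
  adjacent⇒Adjacent {a} {b} h (bwd refl refl) p<q | inj₂ h′ | inj₂ h″ | inj₁ f with ∧-true {ps a ≡ᵇ 0} f
  ... | f₁ , f₂ = ⊥-elim (<⇒≱ p<q (≤-trans (≤-reflexive (≡ᵇ-true⇒≡ f₁)) z≤n))
  adjacent⇒Adjacent {a} {b} h (bwd refl refl) p<q | inj₂ h′ | inj₂ h″ | inj₂ f with ∧-true {ps b ≡ᵇ 0} f
  ... | f₁ , f₂ = inj₂ (≡ᵇ-true⇒≡ f₁ , ≡ᵇ-true⇒≡ f₂)
  adjacent⇒Adjacent {a} {b} h (fwd refl refl) p<q | inj₂ h′ | inj₂ h″ | inj₂ f with ∧-true {ps b ≡ᵇ 0} f
  ... | f₁ , f₂ = ⊥-elim (<⇒≱ p<q (≤-trans (≤-reflexive (≡ᵇ-true⇒≡ f₁)) z≤n))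

  Adjacent⇒adjacent : ∀ {a b p q} → Adjacent p q → Ends p q a b → adjacent 𝒜 a b ≡ true
  Adjacent⇒adjacent {a} {b} (inj₁ h) (fwd refl refl) = ∨-trueˡ _ (≡⇒≡ᵇ-true (sym h))
  Adjacent⇒adjacent {a} {b} (inj₁ h) (bwd refl refl) = ∨-trueʳ (suc (ps a) ≡ᵇ ps b) (∨-trueˡ _ (≡⇒≡ᵇ-true (sym h)))
  Adjacent⇒adjacent {a} {b} (inj₂ (h , h′)) (fwd refl refl) = ∨-trueʳ (suc (ps a) ≡ᵇ ps b) (∨-trueʳ (suc (ps b) ≡ᵇ ps a)
    (∨-trueˡ _ (cong₂ _∧_ (≡⇒≡ᵇ-true h) (≡⇒≡ᵇ-true h′))))
  Adjacent⇒adjacent {a} {b} (inj₂ (h , h′)) (bwd refl refl) = ∨-trueʳ (suc (ps a) ≡ᵇ ps b) (∨-trueʳ (suc (ps b) ≡ᵇ ps a)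
    (∨-trueʳ ((ps a ≡ᵇ 0) ∧ (ps b ≡ᵇ suc n)) (cong₂ _∧_ (≡⇒≡ᵇ-true h) (≡⇒≡ᵇ-true h′))))

  Addable : DiagSet → ℕ → ℕ → Set
  Addable S a b = IsDiagonal 𝒜 a b × (∀ c d → S c d ≡ true → crosses 𝒜 a b c d ≡ false)

  IsMaximal : DiagSet → Set
  IsMaximal S = ∀ a b → Addable S a b → S a b ≡ true

  module Geometry (S : DiagSet) (nc : IsNonCrossing 𝒜 S) where

    diagonal : ∀ {a b} → S a b ≡ true → IsDiagonal 𝒜 a b
    diagonal = proj₁ nc _ _

    Sˢ : ℕ → ℕ → Set
    Sˢ a b = S a b ≡ true ⊎ S b a ≡ true

    Sˢ-sym : ∀ {a b} → Sˢ a b → Sˢ b a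
    Sˢ-sym (inj₁ x) = inj₂ x
    Sˢ-sym (inj₂ x) = inj₁ x

    Sˢ-noncrossing : ∀ {a b c d} → Sˢ a b → Sˢ c d → crosses 𝒜 a b c d ≡ false
    Sˢ-noncrossing {a} {b} {c} {d} (inj₁ x) (inj₁ y) = proj₂ nc a b c d x y
    Sˢ-noncrossing {a} {b} {c} {d} (inj₂ x) (inj₁ y) = trans (crosses-flip₁ a b c d) (proj₂ nc b a c d x y)
    Sˢ-noncrossing {a} {b} {c} {d} (inj₁ x) (inj₂ y) = trans (crosses-flip₂ a b c d) (proj₂ nc a b d c x y)
    Sˢ-noncrossing {a} {b} {c} {d} (inj₂ x) (inj₂ y) = trans (crosses-flip₁ a b c d) (trans (crosses-flip₂ b a c d) (proj₂ nc b a d c x y))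

    C : ℕ → ℕ → Set
    C p q = p < q × q ≤ top × Sˢ (lab p) (lab q)

    C? : ∀ p q → Dec (C p q)
    C? p q = (suc p ≤? q) ×-dec ((q ≤? top) ×-dec ((S (lab p) (lab q) 𝔹.≟ true) ⊎-dec (S (lab q) (lab p) 𝔹.≟ true)))

    C-noncrossing : ∀ p q r s → C p q → C r s → p < r → r < q → q < s → ⊥
    C-noncrossing p q r s (_ , _ , x) (_ , s≤ , y) p<r r<q q<s =
      true≢false (interleaved⇒crosses (interleaved-lab p<r r<q q<s s≤)) (Sˢ-noncrossing x y)

    open Chords top C C? (λ _ _ c → proj₁ (proj₂ c)) C-noncrossing public

    Ends-C : ∀ {a b p q} → a ≤ top → b ≤ top → Ends p q a b → p < q → Sˢ a b → C p q
    Ends-C a≤ b≤ (fwd refl refl) p<q x = p<q , ps≤ b≤ , subst₂ Sˢ (sym (lab-ps a≤)) (sym (lab-ps b≤)) x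
    Ends-C a≤ b≤ (bwd refl refl) p<q x = p<q , ps≤ a≤ , subst₂ Sˢ (sym (lab-ps b≤)) (sym (lab-ps a≤)) (Sˢ-sym x)

    C-Ends : ∀ {a b p q} → a ≤ top → b ≤ top → Ends p q a b → C p q → Sˢ a b
    C-Ends a≤ b≤ (fwd refl refl) (_ , _ , x) = subst₂ Sˢ (lab-ps a≤) (lab-ps b≤) x
    C-Ends a≤ b≤ (bwd refl refl) (_ , _ , x) = Sˢ-sym (subst₂ Sˢ (lab-ps b≤) (lab-ps a≤) x)

    Sˢ-< : ∀ {a b} → a < b → Sˢ a b → S a b ≡ true
    Sˢ-< a<b (inj₁ x) = x
    Sˢ-< a<b (inj₂ x) = ⊥-elim (<-asym a<b (proj₁ (diagonal x)))

    ≤top : ∀ {a b} → S a b ≡ true → a ≤ top × b ≤ top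
    ≤top x with diagonal x
    ... | a<b , b≤ , _ = <≤⇒≤ a<b b≤ , b≤

    S⇒C : ∀ {a b} → S a b ≡ true → ∃ λ p → ∃ λ q → Ends p q a b × C p q
    S⇒C x with ≤top x
    ... | a≤ , b≤ with sortEnds a≤ b≤ (<⇒≢ (proj₁ (diagonal x)))
    ...   | p , q , e , p<q , _ = p , q , e , Ends-C a≤ b≤ e p<q (inj₁ x)

    C-nonadjacent : ∀ {p q} → C p q → ¬ Adjacent p q
    C-nonadjacent (p<q , q≤ , x) adj with Ends-lab (<≤⇒≤ p<q q≤) q≤
    C-nonadjacent (p<q , q≤ , inj₁ x) adj | e = true≢false (Adjacent⇒adjacent adj e) (proj₂ (proj₂ (diagonal x)))
    C-nonadjacent (p<q , q≤ , inj₂ x) adj | e = true≢false (Adjacent⇒adjacent adj (Ends-sym e)) (proj₂ (proj₂ (diagonal x)))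

    compatible⇒noncrossing : ∀ {a b p q} → a ≤ top → b ≤ top → Ends p q a b → p < q → Compatible p q →
                             ∀ c d → S c d ≡ true → crosses 𝒜 a b c d ≡ false
    compatible⇒noncrossing {a} {b} a≤ b≤ e p<q (d₁ , d₂) c d x = ≡false λ cr → contra cr (≤top x) (S⇒C x)
      where
      contra : crosses 𝒜 a b c d ≡ true → c ≤ top × d ≤ top → (∃ λ r → ∃ λ s → Ends r s c d × C r s) → ⊥
      contra cr (c≤ , d≤) (r , s , f , cc@(r<s , _)) with span (crosses⇒interleaved a≤ b≤ c≤ d≤ cr) e p<q f r<s
      ... | inj₁ (p<r , r<q , q<s) = d₂ r s cc p<r r<q q<s
      ... | inj₂ (r<p , p<s , s<q) = d₁ r s cc r<p p<s s<q

    noncrossing⇒compatible : ∀ {p q} → p < q → q ≤ top →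
                             (∀ c d → S c d ≡ true → crosses 𝒜 (lab p) (lab q) c d ≡ false) → Compatible p q
    noncrossing⇒compatible {p} {q} p<q q≤ h =
      (λ r s c r<p p<s s<q → contra (interleaved⇒crosses (swap (interleaved-lab r<p p<s s<q q≤))) (proj₂ (proj₂ c))) ,
      (λ r s c p<r r<q q<s → contra (interleaved⇒crosses (interleaved-lab p<r r<q q<s (proj₁ (proj₂ c)))) (proj₂ (proj₂ c)))
      where
      contra : ∀ {c d} → crosses 𝒜 (lab p) (lab q) c d ≡ true → Sˢ c d → ⊥
      contra cr (inj₁ x) = true≢false cr (h _ _ x)
      contra {c} {d} cr (inj₂ x) = true≢false (trans (crosses-flip₂ (lab p) (lab q) d c) cr) (h _ _ x)

    addable : ∀ {p q} → p < q → q ≤ top → ¬ Adjacent p q → Compatible p q →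
              ∃ λ a → ∃ λ b → Ends p q a b × a ≤ top × Addable S a b
    addable {p} {q} p<q q≤ ¬adj comp with <-cmp (lab p) (lab q)
    ... | tri≈ _ e _ = ⊥-elim (<⇒≢ p<q (trans (sym (ps-lab (<≤⇒≤ p<q q≤))) (trans (cong ps e) (ps-lab q≤))))
    ... | tri< lt _ _ = lab p , lab q , e , lab≤ p≤ , (lt , lab≤ q≤ , ≡false λ a → ¬adj (adjacent⇒Adjacent a e p<q)) ,
                        compatible⇒noncrossing (lab≤ p≤) (lab≤ q≤) e p<q comp
      where
      p≤ = <≤⇒≤ p<q q≤
      e = Ends-lab p≤ q≤
    ... | tri> _ _ gt = lab q , lab p , e , lab≤ q≤ , (gt , lab≤ p≤ , ≡false λ a → ¬adj (adjacent⇒Adjacent a e p<q)) ,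
                        compatible⇒noncrossing (lab≤ q≤) (lab≤ p≤) e p<q comp
      where
      p≤ = <≤⇒≤ p<q q≤
      e = Ends-sym (Ends-lab p≤ q≤)

    maximal⇒C : IsMaximal S → ∀ p q → suc p < q → q ≤ top → ¬ (p ≡ 0 × q ≡ top) → Compatible p q → C p q
    maximal⇒C mx p q 1+p<q q≤ ¬root comp with addable (<⇒≤ 1+p<q) q≤ [ (λ { refl → <-irrefl refl 1+p<q }) , ¬root ]′ comp
    ... | a , b , e , a≤ , ad@((_ , b≤ , _) , _) = Ends-C a≤ b≤ e (<⇒≤ 1+p<q) (inj₁ (mx a b ad))

    EL : ℕ → ℕ → Set
    EL a b = ∃ λ p → ∃ λ q → Ends p q a b × p < q × q ≤ top × E p q

    EL-sym : ∀ {a b} → EL a b → EL b a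
    EL-sym (p , q , e , h) = p , q , Ends-sym e , h

    EL-noncrossing : ∀ {a b c d} → Interleaved a b c d → EL a c → EL b d → ⊥
    EL-noncrossing i (p , q , e , p<q , _ , h) (r , s , f , r<s , _ , k) with span i e p<q f r<s
    ... | inj₁ (p<r , r<q , q<s) = E-noncrossing h k p<r r<q q<s
    ... | inj₂ (r<p , p<s , s<q) = E-noncrossing k h r<p p<s s<q

    edgeT⇒EL : ∀ {a b} → a < b → b ≤ top → edgeT 𝒜 S a b ≡ true → EL a b
    edgeT⇒EL {a} {b} a<b b≤ h with sortEnds (<≤⇒≤ a<b b≤) b≤ (<⇒≢ a<b) | ∨-true {adjacent 𝒜 a b} h
    ... | p , q , e , p<q , q≤ | inj₂ x = p , q , e , p<q , q≤ , inj₂ (inj₁ (Ends-C (<≤⇒≤ a<b b≤) b≤ e p<q (inj₁ x)))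
    ... | p , q , e , p<q , q≤ | inj₁ x with adjacent⇒Adjacent x e p<q
    ...   | inj₁ f = p , q , e , p<q , q≤ , inj₁ f
    ...   | inj₂ f = p , q , e , p<q , q≤ , inj₂ (inj₂ f)

    EL⇒edgeT : ∀ {a b} → a < b → b ≤ top → EL a b → edgeT 𝒜 S a b ≡ true
    EL⇒edgeT a<b b≤ (p , q , e , p<q , q≤ , inj₁ f) = ∨-trueˡ _ (Adjacent⇒adjacent (inj₁ f) e)
    EL⇒edgeT a<b b≤ (p , q , e , p<q , q≤ , inj₂ (inj₂ f)) = ∨-trueˡ _ (Adjacent⇒adjacent (inj₂ f) e)
    EL⇒edgeT {a} {b} a<b b≤ (p , q , e , p<q , q≤ , inj₂ (inj₁ c)) =
      ∨-trueʳ (adjacent 𝒜 a b) (Sˢ-< a<b (C-Ends (<≤⇒≤ a<b b≤) b≤ e c))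

  -- Completing non-crossing sets.

  -- The quantifier over all pairs becomes a finite search because members of `S` are diagonals,
  -- with labels at most `top`.
  addable? : ∀ S → IsNonCrossing 𝒜 S → ∀ a b → Dec (Addable S a b)
  addable? S nc a b with ((suc a ≤? b) ×-dec ((b ≤? suc n) ×-dec (adjacent 𝒜 a b 𝔹.≟ false))) ×-dec
    All.all? (λ c → All.all? (λ d → (S c d 𝔹.≟ true) →-dec (crosses 𝒜 a b c d 𝔹.≟ false)) (upTo N)) (upTo N)
  ... | yes (dg , h) = yes (dg , λ c d x → All.lookup (All.lookup h (Memₚ.∈-upTo⁺ (s≤s (proj₁ (Geometry.≤top S nc x))))) (Memₚ.∈-upTo⁺ (s≤s (proj₂ (Geometry.≤top S nc x)))) x)
  ... | no ¬h = no λ { (dg , h) → ¬h (dg , All.tabulate λ {c} _ → All.tabulate λ {d} _ → h c d) }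

  insert : DiagSet → ℕ → ℕ → DiagSet
  insert S a b c d = S c d ∨ ((c ≡ᵇ a) ∧ (d ≡ᵇ b))

  crosses-self : ∀ a b → crosses 𝒜 a b a b ≡ false
  crosses-self a b rewrite ≥⇒<ᵇ-false (≤-refl {min′ (ps a) (ps b)}) = refl

  insert-true : ∀ S a b c d → insert S a b c d ≡ true → S c d ≡ true ⊎ (c ≡ a × d ≡ b)
  insert-true S a b c d h with ∨-true {S c d} h
  ... | inj₁ x = inj₁ x
  ... | inj₂ x with ∧-true {c ≡ᵇ a} x
  ...   | y , z = inj₂ (≡ᵇ-true⇒≡ y , ≡ᵇ-true⇒≡ z)

  insert-self : ∀ S a b → insert S a b a b ≡ true
  insert-self S a b = ∨-trueʳ (S a b) (cong₂ _∧_ (≡⇒≡ᵇ-true (refl {x = a})) (≡⇒≡ᵇ-true (refl {x = b})))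

  insert-noncrossing : ∀ S a b → IsNonCrossing 𝒜 S → Addable S a b → IsNonCrossing 𝒜 (insert S a b)
  insert-noncrossing S a b (dg , nc) (dab , nab) = dg′ , nc′
    where
    dg′ : ∀ c d → insert S a b c d ≡ true → IsDiagonal 𝒜 c d
    dg′ c d h with insert-true S a b c d h
    ... | inj₁ x = dg c d x
    ... | inj₂ (refl , refl) = dab
    nc′ : ∀ c d e f → insert S a b c d ≡ true → insert S a b e f ≡ true → crosses 𝒜 c d e f ≡ false
    nc′ c d e f h k with insert-true S a b c d h | insert-true S a b e f k
    ... | inj₁ x | inj₁ y = nc c d e f x y
    ... | inj₂ (refl , refl) | inj₁ y = nab e f y
    ... | inj₁ x | inj₂ (refl , refl) = trans (crosses-swap c d a b) (nab c d x)
    ... | inj₂ (refl , refl) | inj₂ (refl , refl) = crosses-self a b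

  Completion : List (ℕ × ℕ) → DiagSet → Set
  Completion ls S = Σ (NCSet 𝒜) λ R → (S ⊆D proj₁ R) × (∀ {a b} → (a , b) Mem.∈ ls → Addable (proj₁ R) a b → proj₁ R a b ≡ true)

  -- Greedy insertion. One pass is enough: a pair that cannot be added now cannot be added to any
  -- larger set.
  completeAlong : ∀ ls (S : NCSet 𝒜) → Completion ls (proj₁ S)
  completeAlong [] S = S , (λ _ _ x → x) , λ ()
  completeAlong ((a , b) ∷ ls) (S , nc) with addable? S nc a b
  ... | yes ad with completeAlong ls (insert S a b , insert-noncrossing S a b nc ad)
  ...   | R , sub , mx = R , (λ c d x → sub c d (∨-trueˡ _ x)) ,
          λ { (here refl) _ → sub a b (insert-self S a b) ; (there m) → mx m }
  completeAlong ((a , b) ∷ ls) (S , nc) | no ¬ad with completeAlong ls (S , nc)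
  ...   | R , sub , mx = R , sub , λ { (here refl) (dg , h) → ⊥-elim (¬ad (dg , λ c d x → h c d (sub c d x))) ; (there m) → mx m }

  complete : ∀ (S : NCSet 𝒜) → Σ (NCSet 𝒜) λ R → (proj₁ S ⊆D proj₁ R) × IsMaximal (proj₁ R)
  complete S with completeAlong (cartesianProduct (upTo N) (upTo N)) S
  ... | R , sub , mx = R , sub , λ { a b ad@((a<b , b≤ , _) , _) →
    mx (Memₚ.∈-cartesianProduct⁺ (Memₚ.∈-upTo⁺ (s≤s (<≤⇒≤ a<b b≤))) (Memₚ.∈-upTo⁺ (s≤s b≤))) ad }

  -- Counting: maximal non-crossing sets are the triangulations.

  ∑∑ : (ℕ → ℕ → ℚ) → ℚ
  ∑∑ f = ∑ 0 N (λ a → ∑ 0 N (f a))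

  ∑∑-cong : ∀ {f g} → (∀ a b → a ≤ top → b ≤ top → f a b ≡ g a b) → ∑∑ f ≡ ∑∑ g
  ∑∑-cong h = ∑-cong 0 N λ { a _ (s≤s a≤) → ∑-cong 0 N λ { b _ (s≤s b≤) → h a b a≤ b≤ } }

  ∑∑-+ : ∀ f g → ∑∑ (λ a b → f a b +ℚ g a b) ≡ ∑∑ f +ℚ ∑∑ g
  ∑∑-+ f g = trans (∑-cong 0 N λ a _ _ → ∑-+ 0 N (f a) (g a)) (∑-+ 0 N (λ a → ∑ 0 N (f a)) (λ a → ∑ 0 N (g a)))

  ι-card : ∀ S → ι (card n S) ≡ ∑∑ (λ a b → ind (S a b))
  ι-card S = trans (ι-sumℕ (λ a → countIn (S a) 0 N) (λ i → i) 0 N (λ _ → refl)) (∑-cong 0 N λ a _ _ → ι-countIn (S a) 0 N)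

  module Counting (S : DiagSet) (nc : IsNonCrossing 𝒜 S) where

    open Geometry S nc

    lo hi : ℕ → ℕ → ℕ
    lo a b = min′ (ps a) (ps b)
    hi a b = max′ (ps a) (ps b)

    Ends-lohi : ∀ {a b p q} → Ends p q a b → p < q → lo a b ≡ p × hi a b ≡ q
    Ends-lohi (fwd refl refl) p<q = min′-≤ (<⇒≤ p<q) , max′-≤ (<⇒≤ p<q)
    Ends-lohi {a} {b} (bwd refl refl) p<q =
      trans (min′-comm (ps a) (ps b)) (min′-≤ (<⇒≤ p<q)) , trans (max′-comm (ps a) (ps b)) (max′-≤ (<⇒≤ p<q))

    lohi-Ends : ∀ {a b} → S a b ≡ true → Ends (lo a b) (hi a b) a b × C (lo a b) (hi a b)
    lohi-Ends {a} {b} x with S⇒C x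
    ... | p , q , e , c with Ends-lohi e (proj₁ c)
    ...   | e₁ , e₂ = subst₂ (λ p q → Ends p q a b × C p q) (sym e₁) (sym e₂) (e , c)

    Ends-unique : ∀ {p q a b c d} → Ends p q a b → Ends p q c d → S a b ≡ true → S c d ≡ true → c ≡ a × d ≡ b
    Ends-unique {p} {q} {a} {b} {c} {d} e f x y = go e f (≤top x) (≤top y)
      where
      go : Ends p q a b → Ends p q c d → a ≤ top × b ≤ top → c ≤ top × d ≤ top → c ≡ a × d ≡ b
      go (fwd e₁ e₂) (fwd f₁ f₂) (a≤ , b≤) (c≤ , d≤) = ps-injective c a c≤ a≤ (trans f₁ (sym e₁)) , ps-injective d b d≤ b≤ (trans f₂ (sym e₂))
      go (bwd e₁ e₂) (bwd f₁ f₂) (a≤ , b≤) (c≤ , d≤) = ps-injective c a c≤ a≤ (trans f₂ (sym e₂)) , ps-injective d b d≤ b≤ (trans f₁ (sym e₁))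
      go (fwd e₁ e₂) (bwd f₁ f₂) (a≤ , b≤) (c≤ , d≤) = ⊥-elim (<-asym (proj₁ (diagonal x))
        (subst₂ _<_ (ps-injective c b c≤ b≤ (trans f₂ (sym e₂))) (ps-injective d a d≤ a≤ (trans f₁ (sym e₁))) (proj₁ (diagonal y))))
      go (bwd e₁ e₂) (fwd f₁ f₂) (a≤ , b≤) (c≤ , d≤) = ⊥-elim (<-asym (proj₁ (diagonal x))
        (subst₂ _<_ (ps-injective c b c≤ b≤ (trans f₁ (sym e₁))) (ps-injective d a d≤ a≤ (trans f₂ (sym e₂))) (proj₁ (diagonal y))))

    within exactly : ℕ → ℕ → ℕ → ℕ → Bool
    within p q r s = (p ≤ᵇ r) ∧ (s ≤ᵇ q)
    exactly p q r s = (r ≡ᵇ p) ∧ (s ≡ᵇ q)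

    inside at : ℕ → ℕ → ℚ
    inside p q = ∑∑ (λ a b → ind (within p q (lo a b) (hi a b) ∧ S a b))
    at p q = ∑∑ (λ a b → ind (exactly p q (lo a b) (hi a b) ∧ S a b))

    -- A chord inside `p`-`q` that straddles `m` crosses a side of the triangle, unless it is
    -- `p`-`q` itself.
    within-split : ∀ {p m q r s} → p < m → m < q → E p m → E m q → r < s → C r s →
      ind (within p q r s) ≡ (ind (within p m r s) +ℚ ind (within m q r s)) +ℚ ind (exactly p q r s)
    within-split {p} {m} {q} {r} {s} p<m m<q epm emq r<s c with ≤-<-connex s m | ≤-<-connex m r
    ... | inj₁ s≤m | _ rewrite ≤⇒≤ᵇ-true s≤m | ≤⇒≤ᵇ-true (≤-trans s≤m (<⇒≤ m<q)) | >⇒≤ᵇ-false (<-≤-trans r<s s≤m)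
          | ≢⇒≡ᵇ-false (λ (e : s ≡ q) → <⇒≱ m<q (subst (_≤ m) e s≤m)) | 𝔹.∧-zeroʳ (r ≡ᵇ p) =
            sym (trans (Q.+-identityʳ _) (Q.+-identityʳ _))
    ... | inj₂ m<s | inj₁ m≤r rewrite >⇒≤ᵇ-false m<s | ≤⇒≤ᵇ-true m≤r | ≤⇒≤ᵇ-true (≤-trans (<⇒≤ p<m) m≤r)
          | ≢⇒≡ᵇ-false (λ (e : r ≡ p) → <⇒≱ p<m (subst (m ≤_) e m≤r)) =
            sym (trans (Q.+-identityʳ _) (Q.+-identityˡ _))
    ... | inj₂ m<s | inj₂ r<m rewrite >⇒≤ᵇ-false m<s | >⇒≤ᵇ-false r<m | 𝔹.∧-zeroʳ (p ≤ᵇ r) with <-cmp r p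
    ...   | tri< r<p r≢p _ rewrite >⇒≤ᵇ-false r<p | ≢⇒≡ᵇ-false r≢p = refl
    ...   | tri> _ _ p<r = ⊥-elim (E-noncrossing epm (inj₂ (inj₁ c)) p<r r<m m<s)
    ...   | tri≈ _ refl _ with <-cmp s q
    ...     | tri< s<q _ _ = ⊥-elim (E-noncrossing (inj₂ (inj₁ c)) emq p<m m<s s<q)
    ...     | tri≈ _ refl _ rewrite ≤⇒≤ᵇ-true (≤-refl {r}) | ≤⇒≤ᵇ-true (≤-refl {s}) | ≡⇒≡ᵇ-true (refl {x = r}) | ≡⇒≡ᵇ-true (refl {x = s}) = refl
    ...     | tri> _ s≢q q<s rewrite ≤⇒≤ᵇ-true (≤-refl {r}) | >⇒≤ᵇ-false q<s | ≡⇒≡ᵇ-true (refl {x = r}) | ≢⇒≡ᵇ-false s≢q = refl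

    inside-split : ∀ {p m q} → p < m → m < q → E p m → E m q → inside p q ≡ (inside p m +ℚ inside m q) +ℚ at p q
    inside-split {p} {m} {q} p<m m<q epm emq = trans (∑∑-cong pointwise)
      (trans (∑∑-+ (λ a b → w p m a b +ℚ w m q a b) x) (cong (_+ℚ at p q) (∑∑-+ (w p m) (w m q))))
      where
      w : ℕ → ℕ → ℕ → ℕ → ℚ
      w p q a b = ind (within p q (lo a b) (hi a b) ∧ S a b)
      x : ℕ → ℕ → ℚ
      x a b = ind (exactly p q (lo a b) (hi a b) ∧ S a b)
      pointwise : ∀ a b → a ≤ top → b ≤ top → w p q a b ≡ (w p m a b +ℚ w m q a b) +ℚ x a b
      pointwise a b _ _ with bool (S a b)
      ... | inj₂ f rewrite f | 𝔹.∧-zeroʳ (within p q (lo a b) (hi a b)) | 𝔹.∧-zeroʳ (within p m (lo a b) (hi a b))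
            | 𝔹.∧-zeroʳ (within m q (lo a b) (hi a b)) | 𝔹.∧-zeroʳ (exactly p q (lo a b) (hi a b)) = refl
      ... | inj₁ f with lohi-Ends f
      ...   | _ , c rewrite f | 𝔹.∧-identityʳ (within p q (lo a b) (hi a b)) | 𝔹.∧-identityʳ (within p m (lo a b) (hi a b))
            | 𝔹.∧-identityʳ (within m q (lo a b) (hi a b)) | 𝔹.∧-identityʳ (exactly p q (lo a b) (hi a b)) =
              within-split p<m m<q epm emq (proj₁ c) c

    at-true : ∀ {p q a b} → exactly p q (lo a b) (hi a b) ∧ S a b ≡ true → Ends p q a b × C p q × S a b ≡ true
    at-true {p} {q} {a} {b} h with ∧-true {exactly p q (lo a b) (hi a b)} h
    ... | f , x with ∧-true {lo a b ≡ᵇ p} f | lohi-Ends x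
    ...   | f₁ , f₂ | e , c with ≡ᵇ-true⇒≡ {lo a b} f₁ | ≡ᵇ-true⇒≡ {hi a b} f₂
    ...     | e₁ | e₂ = subst₂ (λ p q → Ends p q a b × C p q × S a b ≡ true) e₁ e₂ (e , c , x)

    at-C : ∀ {p q} → C p q → at p q ≡ 1ℚ
    at-C {p} {q} c@(p<q , q≤ , x) = go x
      where
      p≤ : p ≤ top
      p≤ = <≤⇒≤ p<q q≤
      single : ∀ {a b} → Ends p q a b → S a b ≡ true → at p q ≡ 1ℚ
      single {a} {b} e x = trans (∑-delta 0 N a _ z≤n (s≤s (proj₁ (≤top x)))
          λ a′ a′≢a → ∑-zero 0 N λ b′ _ _ → off a′ b′ λ h → a′≢a (proj₁ h))
        (trans (∑-delta 0 N b _ z≤n (s≤s (proj₂ (≤top x))) λ b′ b′≢b → off a b′ λ h → b′≢b (proj₂ h))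
          (cong ind on))
        where
        off : ∀ a′ b′ → ¬ (a′ ≡ a × b′ ≡ b) → ind (exactly p q (lo a′ b′) (hi a′ b′) ∧ S a′ b′) ≡ 0ℚ
        off a′ b′ ¬h = cong ind (≡false {exactly p q (lo a′ b′) (hi a′ b′) ∧ S a′ b′} λ t → contra (at-true t))
          where
          contra : Ends p q a′ b′ × C p q × S a′ b′ ≡ true → ⊥
          contra (e′ , _ , x′) = ¬h (Ends-unique e e′ x x′)
        on : exactly p q (lo a b) (hi a b) ∧ S a b ≡ true
        on with Ends-lohi e p<q
        ... | e₁ , e₂ rewrite e₁ | e₂ | ≡⇒≡ᵇ-true (refl {x = p}) | ≡⇒≡ᵇ-true (refl {x = q}) = x
      go : Sˢ (lab p) (lab q) → at p q ≡ 1ℚ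
      go (inj₁ x) = single (Ends-lab p≤ q≤) x
      go (inj₂ x) = single (Ends-sym (Ends-lab p≤ q≤)) x

    at-¬C : ∀ {p q} → ¬ C p q → at p q ≡ 0ℚ
    at-¬C {p} {q} ¬c = ∑-zero 0 N λ a _ _ → ∑-zero 0 N λ b _ _ →
      cong ind (≡false {exactly p q (lo a b) (hi a b) ∧ S a b} λ t → ¬c (proj₁ (proj₂ (at-true t))))

    inside-boundary : ∀ p → inside p (suc p) ≡ 0ℚ
    inside-boundary p = ∑-zero 0 N λ a _ _ → ∑-zero 0 N λ b _ _ →
      cong ind (≡false {within p (suc p) (lo a b) (hi a b) ∧ S a b} λ t → contra t)
      where
      contra : ∀ {a b} → within p (suc p) (lo a b) (hi a b) ∧ S a b ≡ true → ⊥
      contra {a} {b} t with ∧-true {within p (suc p) (lo a b) (hi a b)} t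
      ... | f , x with ∧-true {p ≤ᵇ lo a b} f | lohi-Ends x
      ...   | f₁ , f₂ | _ , c = C-nonadjacent c (inj₁ (≤-antisym
        (≤-trans (≤ᵇ-true⇒≤ {hi a b} f₂) (s≤s (≤ᵇ-true⇒≤ {p} f₁))) (proj₁ c)))

    inside-all : inside 0 top ≡ ι (card n S)
    inside-all = trans (∑∑-cong pointwise) (sym (ι-card S))
      where
      pointwise : ∀ a b → a ≤ top → b ≤ top → ind (within 0 top (lo a b) (hi a b) ∧ S a b) ≡ ind (S a b)
      pointwise a b a≤ b≤ = cong (λ w → ind (w ∧ S a b)) (≤⇒≤ᵇ-true (hi≤ (ps≤ a≤) (ps≤ b≤)))
        where
        hi≤ : ∀ {p q} → p ≤ top → q ≤ top → max′ p q ≤ top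
        hi≤ {p} {q} p≤ q≤ with p ≤ᵇ q
        ... | true  = q≤
        ... | false = p≤

    -- Counting triangle by triangle, a non-root edge `p`-`q` has `q - p - 1` diagonals inside,
    -- itself included when it is one. The root is split separately because it has interior
    -- positions but is a side: its two parts hold `m - 1` and `n - m` diagonals.
    maximal⇒card : IsMaximal S → card n S ≡ n ∸ 1
    maximal⇒card mx with apex (inj₂ (inj₂ (refl , refl))) (s≤s 1≤n) ≤-refl
      where open Maximal (s≤s z≤n) (maximal⇒C mx)
    ... | m , 0<m , m<top , e₁ , e₂ = ι-injective (trans (sym inside-all) (trans (inside-split 0<m m<top e₁ e₂)
      (trans (cong₂ _+ℚ_ (cong₂ _+ℚ_
          (count e₁ 0<m (<⇒≤ m<top) (λ { (_ , refl) → <-irrefl refl m<top }))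
          (count e₂ m<top ≤-refl (λ { (refl , _) → <-irrefl refl 0<m })))
          (at-¬C (λ c → C-nonadjacent c (inj₂ (refl , refl)))))
        (trans (cong₂ (λ z t → ((ι m -ℚ z -ℚ 1ℚ) +ℚ (t -ℚ ι m -ℚ 1ℚ)) +ℚ 0ℚ) ι-0 (ι-suc n))
          (trans (lem (ι m) (ι n)) (sym (trans (ι-∸ 1≤n) (cong (ι n -ℚ_) ι-1))))))))
      where
      open Maximal (s≤s z≤n) (maximal⇒C mx)
      lem : ∀ m n → ((m -ℚ 0ℚ -ℚ 1ℚ) +ℚ ((1ℚ +ℚ n) -ℚ m -ℚ 1ℚ)) +ℚ 0ℚ ≡ n -ℚ 1ℚ
      lem = solve-∀ ℚ-ring
      count : ∀ {p q} → E p q → p < q → q ≤ top → ¬ (p ≡ 0 × q ≡ top) → inside p q ≡ ι q -ℚ ι p -ℚ 1ℚ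
      count = edge-induction (λ p q → ¬ (p ≡ 0 × q ≡ top) → inside p q ≡ ι q -ℚ ι p -ℚ 1ℚ)
        (λ p _ _ → trans (inside-boundary p) (trans (lem₀ (ι p)) (cong (λ t → t -ℚ ι p -ℚ 1ℚ) (sym (ι-suc p)))))
        (λ p m q p<m m<q q≤ epm emq epq ih₁ ih₂ ¬root → trans (inside-split p<m m<q epm emq)
          (trans (cong₂ _+ℚ_ (cong₂ _+ℚ_ (ih₁ λ { (_ , refl) → <-irrefl refl (<-≤-trans m<q q≤) }) (ih₂ λ { (refl , _) → <⇒≱ p<m z≤n }))
            (at-C (chord p<m m<q epq ¬root))) (lem₁ (ι p) (ι m) (ι q))))
        where
        lem₀ : ∀ p → 0ℚ ≡ (1ℚ +ℚ p) -ℚ p -ℚ 1ℚ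
        lem₀ = solve-∀ ℚ-ring
        lem₁ : ∀ p m q → ((m -ℚ p -ℚ 1ℚ) +ℚ (q -ℚ m -ℚ 1ℚ)) +ℚ 1ℚ ≡ q -ℚ p -ℚ 1ℚ
        lem₁ = solve-∀ ℚ-ring
        chord : ∀ {p m q} → p < m → m < q → E p q → ¬ (p ≡ 0 × q ≡ top) → C p q
        chord p<m m<q (inj₁ refl)        ¬root = ⊥-elim (<⇒≱ p<m (≤-pred m<q))
        chord p<m m<q (inj₂ (inj₁ c))    ¬root = c
        chord p<m m<q (inj₂ (inj₂ root)) ¬root = ⊥-elim (¬root root)

  -- The differences of the indicators are nonnegative and sum to zero, so each vanishes.
  ⊆-card-≡ : ∀ (S R : NCSet 𝒜) → proj₁ S ⊆D proj₁ R → card n (proj₁ S) ≡ card n (proj₁ R) → proj₁ R ⊆D proj₁ S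
  ⊆-card-≡ (S , ncS) (R , ncR) sub e a b x = back (bool (S a b))
    where
    ≤ab : a ≤ top × b ≤ top
    ≤ab = Geometry.≤top R ncR x
    d : ℕ → ℕ → ℚ
    d a b = ind (R a b) -ℚ ind (S a b)
    0≤d : ∀ a b → 0ℚ ≤ℚ d a b
    0≤d a b with bool (S a b) | bool (R a b)
    ... | inj₂ f | _      = subst (0ℚ ≤ℚ_) (sym (trans (cong (λ s → ind (R a b) -ℚ ind s) f) (Q.+-identityʳ (ind (R a b))))) (0≤ind (R a b))
    ... | inj₁ f | inj₁ g = Q.≤-reflexive (sym (cong₂ (λ r s → ind r -ℚ ind s) g f))
    ... | inj₁ f | inj₂ g = ⊥-elim (true≢false (sub a b f) g)
    ∑d≡0 : ∑∑ d ≡ 0ℚ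
    ∑d≡0 = trans (∑-cong 0 N λ a _ _ → ∑-sub 0 N (λ b → ind (R a b)) (λ b → ind (S a b)))
      (trans (∑-sub 0 N (λ a → ∑ 0 N (λ b → ind (R a b))) (λ a → ∑ 0 N (λ b → ind (S a b))))
      (trans (cong₂ _-ℚ_ (trans (sym (ι-card R)) (cong ι (sym e))) (sym (ι-card S))) (Q.+-inverseʳ (ι (card n S)))))
    d≡0 : d a b ≡ 0ℚ
    d≡0 = ∑≡0⇒≡0 0 N (0≤d a) (∑≡0⇒≡0 0 N (λ a → ∑-0≤ 0 N (0≤d a)) ∑d≡0 a z≤n (s≤s (proj₁ ≤ab))) b z≤n (s≤s (proj₂ ≤ab))
    back : S a b ≡ true ⊎ S a b ≡ false → S a b ≡ true
    back (inj₁ f) = f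
    back (inj₂ f) = ⊥-elim (Q.1≢0 (trans (sym (cong₂ (λ r s → ind r -ℚ ind s) x f)) d≡0))

  -- A maximal completion has `n ∸ 1` diagonals as well, so it has added nothing.
  triangulation-maximal : (T : Triangulation 𝒜) → IsMaximal (proj₁ T)
  triangulation-maximal (T , nc , |T|) a b (dg , h) with complete (T , nc)
  ... | (R , ncR) , sub , mx = back a b (mx a b (dg , λ c d x → h c d (back c d x)))
    where
    back : R ⊆D T
    back = ⊆-card-≡ (T , nc) (R , ncR) sub (trans |T| (sym (Counting.maximal⇒card R ncR mx)))

  triangulate : (S : NCSet 𝒜) → Σ (Triangulation 𝒜) λ T → proj₁ S ⊆D proj₁ T
  triangulate S with complete S
  ... | (R , ncR) , sub , mx = (R , ncR , Counting.maximal⇒card R ncR mx) , sub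

  -- The lengths `μ` as arcs or complementary arcs.

  module Walk (i j : ℕ) where

    allowed : ℕ → Bool
    allowed ℓ = if j <ᵇ i then ℓ ≤ᵇ i else i ≤ᵇ ℓ

    dccw dcw : ℕ
    dccw = (ps j + N ∸ ps i) % N
    dcw = (ps i + N ∸ ps j) % N

    at : ℕ → ℕ
    at k = labelAt 𝒜 ((ps i + k) % N)

    μ-ccw : (∀ k → k ≤ dccw → allowed (at k) ≡ true) → μ 𝒜 i j ≡ dccw
    μ-ccw h = cong (λ b → if b then dccw else dcw) (allB-true (λ k → allowed (at k)) (λ k → k) (suc dccw) λ { k (s≤s k≤) → h k k≤ })

    μ-cw : ∀ k → k ≤ dccw → allowed (at k) ≡ false → μ 𝒜 i j ≡ dcw
    μ-cw k k≤ h = cong (λ b → if b then dccw else dcw) (allB-false (λ k → allowed (at k)) (λ k → k) (suc dccw) k (s≤s k≤) h)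

    allowed-< : ∀ ℓ → j < i → allowed ℓ ≡ (ℓ ≤ᵇ i)
    allowed-< ℓ j<i = cong (λ b → if b then ℓ ≤ᵇ i else i ≤ᵇ ℓ) (<⇒<ᵇ-true j<i)

    allowed-> : ∀ ℓ → i < j → allowed ℓ ≡ (i ≤ᵇ ℓ)
    allowed-> ℓ i<j = cong (λ b → if b then ℓ ≤ᵇ i else i ≤ᵇ ℓ) (≥⇒<ᵇ-false (<⇒≤ i<j))

    1≤dccw : i ≤ top → j ≤ top → i ≢ j → 1 ≤ dccw
    1≤dccw i≤ j≤ i≢j with <-cmp (ps i) (ps j)
    ... | tri< p _ _ = subst (1 ≤_) (sym (sub-mod (suc n) (<⇒≤ p) (s≤s (ps≤ j≤)))) (m<n⇒0<n∸m p)
    ... | tri≈ _ e _ = ⊥-elim (i≢j (ps-injective i j i≤ j≤ e))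
    ... | tri> _ _ p = subst (1 ≤_) (sym (sub-mod-wrap (suc n) p (s≤s (ps≤ i≤))))
                         (m<n⇒0<n∸m (<-≤-trans (s≤s (ps≤ i≤)) (m≤n+m N (ps j))))

    at-small : ∀ k → ps i + k ≤ top → ps (at k) ≡ ps i + k × at k ≤ top
    at-small k h = subst (λ p → ps (labelAt 𝒜 p) ≡ ps i + k × labelAt 𝒜 p ≤ top) (sym (DivMod.m<n⇒m%n≡m (s≤s h))) (labelAt-spec h)

  open Walk

  dccw-≤ : ∀ i j → ps i ≤ ps j → j ≤ top → dccw i j ≡ ps j ∸ ps i
  dccw-≤ i j p j≤ = sub-mod (suc n) p (s≤s (ps≤ j≤))

  ι-dccw-≤ : ∀ i j → ps i ≤ ps j → j ≤ top → ι (dccw i j) ≡ r j -ℚ r i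
  ι-dccw-≤ i j p j≤ = trans (cong ι (dccw-≤ i j p j≤)) (ι-∸ p)

  dccw-> : ∀ i j → ps j < ps i → i ≤ top → dccw i j ≡ ps j + N ∸ ps i
  dccw-> i j p i≤ = sub-mod-wrap (suc n) p (s≤s (ps≤ i≤))

  ι-dccw-> : ∀ i j → ps j < ps i → i ≤ top → ι (dccw i j) ≡ (r j +ℚ ι N) -ℚ r i
  ι-dccw-> i j p i≤ = trans (cong ι (dccw-> i j p i≤)) (trans (ι-∸ (≤-trans (ps≤ i≤) (≤-trans (n≤1+n top) (m≤n+m N (ps j)))))
    (cong (_-ℚ r i) (ι-+ (ps j) N)))

  -- The counterclockwise neighbour of a down `i` is a larger label, so that walk is blocked at once
  -- and the clockwise one is taken.
  μ-down-< : ∀ {i j} → j < i → i ≤ n → up i ≡ false → ι (μ 𝒜 i j) ≡ arc j i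
  μ-down-< {i} {j} j<i i≤n e = trans (cong ι (μ-cw i j 1 (1≤dccw i j i≤ j≤ (λ { refl → <-irrefl refl j<i })) blocked)) value
    where
    i≤ : i ≤ top
    i≤ = m≤n⇒m≤1+n i≤n
    j≤ : j ≤ top
    j≤ = <≤⇒≤ j<i i≤
    i<top : ps i < ps top
    i<top = below (s≤s i≤n) e
    blocked : allowed i j (at i j 1) ≡ false
    blocked with at-small i j 1 (subst (_≤ top) (sym (+-comm (ps i) 1)) (≤-trans i<top (ps≤ ≤-refl)))
    ... | p , L≤ with posOrder i≤ L≤ (subst (ps i <_) (trans (sym (+-comm (ps i) 1)) (sym p)) ≤-refl)
    ...   | rising i<L _ = trans (allowed-< i j (at i j 1) j<i) (>⇒≤ᵇ-false i<L)
    ...   | falling L<i u = ⊥-elim (<⇒≱ (above (<-≤-trans L<i i≤) ≤-refl u)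
            (subst (_≤ ps top) (trans (sym (+-comm (ps i) 1)) (sym p)) i<top))
    value : ι (dcw i j) ≡ arc j i
    value with bool (up j)
    ... | inj₂ f = trans (ι-dccw-≤ j i (<⇒≤ (below j<i f)) i≤) (cong (r i -ℚ_) (sym (l-down j f)))
    ... | inj₁ f = trans (ι-dccw-> j i (above j<i i≤ f) j≤) (trans (lem (r i) (ι N) (r j)) (cong (r i -ℚ_) (sym (l-up j f))))
      where
      lem : ∀ a b c → (a +ℚ b) -ℚ c ≡ a -ℚ (c -ℚ b)
      lem = solve-∀ ℚ-ring

  -- Counterclockwise after an up `i` comes a smaller up label or, past the last position, label 0;
  -- either blocks the walk.
  μ-up-> : ∀ {i j} → i < j → j ≤ top → up i ≡ true → ι (μ 𝒜 i j) ≡ ι N -ℚ arc i j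
  μ-up-> {i} {j} i<j j≤ e = trans (cong ι (μ-cw i j 1 (1≤dccw i j i≤ j≤ (λ { refl → <-irrefl refl i<j })) blocked))
      (trans (ι-dccw-≤ j i (<⇒≤ (above i<j j≤ e)) i≤) (trans (lem (ι N) (r i) (r j)) (cong (λ t → ι N -ℚ (r j -ℚ t)) (sym (l-up i e)))))
    where
    lem : ∀ N i j → i -ℚ j ≡ N -ℚ (j -ℚ (i -ℚ N))
    lem = solve-∀ ℚ-ring
    i≤ : i ≤ top
    i≤ = <≤⇒≤ i<j j≤
    blocked : allowed i j (at i j 1) ≡ false
    blocked with m≤n⇒m<n∨m≡n (ps≤ i≤)
    ... | inj₂ q = trans (allowed-> i j (at i j 1) i<j) (>⇒≤ᵇ-false (subst (_< i) (sym at0) (1≤up i e)))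
      where
      at0 : at i j 1 ≡ 0
      at0 = cong (labelAt 𝒜) (trans (cong (λ p → (p + 1) % N) q) (trans (cong (_% N) (+-comm top 1)) (DivMod.n%n≡0 N)))
    ... | inj₁ q with at-small i j 1 (subst (_≤ top) (sym (+-comm (ps i) 1)) q)
    ...   | p , L≤ with posOrder i≤ L≤ (subst (ps i <_) (trans (sym (+-comm (ps i) 1)) (sym p)) ≤-refl)
    ...     | rising _ d = ⊥-elim (true≢false e d)
    ...     | falling L<i _ = trans (allowed-> i j (at i j 1) i<j) (>⇒≤ᵇ-false L<i)

  -- No smaller label is met: the down ones lie before `i`, the up ones beyond `j`.
  μ-down-> : ∀ {i j} → i < j → j ≤ top → up i ≡ false → ι (μ 𝒜 i j) ≡ arc i j
  μ-down-> {i} {j} i<j j≤ e = trans (cong ι (μ-ccw i j free)) (trans (ι-dccw-≤ i j (<⇒≤ pi<pj) j≤) (cong (r j -ℚ_) (sym (l-down i e))))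
    where
    i≤ : i ≤ top
    i≤ = <≤⇒≤ i<j j≤
    pi<pj : ps i < ps j
    pi<pj = below i<j e
    free : ∀ k → k ≤ dccw i j → allowed i j (at i j k) ≡ true
    free k k≤ = trans (allowed-> i j (at i j k) i<j) (≤⇒≤ᵇ-true (≮⇒≥ λ L<i → contra L<i (at-small i j k (≤-trans pi+k≤pj (ps≤ j≤)))))
      where
      pi+k≤pj : ps i + k ≤ ps j
      pi+k≤pj = subst (ps i + k ≤_) (m+[n∸m]≡n (<⇒≤ pi<pj)) (+-monoʳ-≤ (ps i) (subst (k ≤_) (dccw-≤ i j (<⇒≤ pi<pj) j≤) k≤))
      contra : at i j k < i → ps (at i j k) ≡ ps i + k × at i j k ≤ top → ⊥
      contra L<i (p , L≤) with bool (up (at i j k))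
      ... | inj₂ d = <⇒≱ (below L<i d) (subst (ps i ≤_) (sym p) (m≤m+n _ _))
      ... | inj₁ u = <⇒≱ (above (<-trans L<i i<j) j≤ u) (subst (_≤ ps j) (sym p) pi+k≤pj)

  -- Labels larger than `i` precede it, so only a walk that wraps past the last position could meet
  -- one. Such a walk ends at a down `j`, and the larger labels come after `j`.
  μ-up-< : ∀ {i j} → j < i → i ≤ n → up i ≡ true → ι (μ 𝒜 i j) ≡ ι N -ℚ arc j i
  μ-up-< {i} {j} j<i i≤n e = trans (cong ι (μ-ccw i j free)) value
    where
    i≤ : i ≤ top
    i≤ = m≤n⇒m≤1+n i≤n
    j≤ : j ≤ top
    j≤ = <≤⇒≤ j<i i≤
    free : ∀ k → k ≤ dccw i j → allowed i j (at i j k) ≡ true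
    free k k≤ = trans (allowed-< i j (at i j k) j<i) (≤⇒≤ᵇ-true (≮⇒≥ contra))
      where
      contra : i < at i j k → ⊥
      contra i<L with ≤-<-connex (ps i + k) top
      ... | inj₁ h with at-small i j k h
      ...   | p , L≤ = <⇒≱ (above i<L L≤ e) (subst (ps i ≤_) (sym p) (m≤m+n _ _))
      contra i<L | inj₂ h with bool (up j)
      ...   | inj₁ u = <⇒≱ h (≤-trans (subst (ps i + k ≤_) (m+[n∸m]≡n pi≤pj)
                (+-monoʳ-≤ (ps i) (subst (k ≤_) (dccw-≤ i j pi≤pj j≤) k≤))) (ps≤ j≤))
        where
        pi≤pj : ps i ≤ ps j
        pi≤pj = <⇒≤ (above j<i i≤ u)
      ...   | inj₂ d = <⇒≱ (below (<-trans j<i i<L) d) (subst (_≤ ps j) (sym psL) w≤pj)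
        where
        pj<pi : ps j < ps i
        pj<pi = below j<i d
        w : ℕ
        w = ps i + k ∸ N
        w+N : w + N ≡ ps i + k
        w+N = m∸n+n≡m h
        w≤pj : w ≤ ps j
        w≤pj = +-cancelʳ-≤ N w (ps j) (subst₂ _≤_ (sym w+N) (m+[n∸m]≡n (≤-trans (ps≤ i≤) (≤-trans (n≤1+n top) (m≤n+m N (ps j)))))
                 (+-monoʳ-≤ (ps i) (subst (k ≤_) (dccw-> i j pj<pi i≤) k≤)))
        w≤top : w ≤ top
        w≤top = ≤-trans w≤pj (ps≤ j≤)
        psL : ps (at i j k) ≡ w
        psL = trans (cong (λ p → ps (labelAt 𝒜 p)) (trans (cong (_% N) (sym w+N)) (trans (DivMod.[m+n]%n≡m%n w N) (DivMod.m<n⇒m%n≡m (s≤s w≤top))))) (proj₁ (labelAt-spec w≤top))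
    value : ι (dccw i j) ≡ ι N -ℚ arc j i
    value with bool (up j)
    ... | inj₁ f = trans (ι-dccw-≤ i j (<⇒≤ (above j<i i≤ f)) j≤) (trans (lem (ι N) (r i) (r j)) (cong (λ t → ι N -ℚ (r i -ℚ t)) (sym (l-up j f))))
      where
      lem : ∀ N i j → j -ℚ i ≡ N -ℚ (i -ℚ (j -ℚ N))
      lem = solve-∀ ℚ-ring
    ... | inj₂ f = trans (ι-dccw-> i j (below j<i f) i≤) (trans (lem (ι N) (r i) (r j)) (cong (λ t → ι N -ℚ (r i -ℚ t)) (sym (l-down j f))))
      where
      lem : ∀ N i j → (j +ℚ N) -ℚ i ≡ N -ℚ (i -ℚ j)
      lem = solve-∀ ℚ-ring

  -- Coordinates of M(T) read off from triangles.

  xℚ : DiagSet → ℕ → ℚ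
  xℚ T i = fromℤ (xcoord 𝒜 T i)

  module _ (T : DiagSet) (nc : IsNonCrossing 𝒜 T) where

    open Geometry T nc

    module _ {a j b : ℕ} (a<j : a < j) (j<b : j < b) (b≤ : b ≤ top) (eaj : EL a j) (ejb : EL j b) (eab : EL a b) where

      private
        j≤ : j ≤ top
        j≤ = <≤⇒≤ j<b b≤
        j≤n : j ≤ n
        j≤n = ≤-pred (<-≤-trans j<b b≤)
        arc-< : ∀ x y → r j -ℚ l y <ℚ r j -ℚ l x → l x <ℚ l y
        arc-< x y h = diff-0< (subst (0ℚ <ℚ_) (lem (r j) (l x) (l y)) (0<-diff h))
          where
          lem : ∀ r x y → (r -ℚ x) -ℚ (r -ℚ y) ≡ y -ℚ x
          lem = solve-∀ ℚ-ring
        N-arc-< : ∀ x y → ι N -ℚ (r j -ℚ l y) <ℚ ι N -ℚ (r j -ℚ l x) → l y <ℚ l x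
        N-arc-< x y h = diff-0< (subst (0ℚ <ℚ_) (lem (ι N) (r j) (l x) (l y)) (0<-diff h))
          where
          lem : ∀ N r x y → (N -ℚ (r -ℚ x)) -ℚ (N -ℚ (r -ℚ y)) ≡ x -ℚ y
          lem = solve-∀ ℚ-ring
        arc-<ʳ : ∀ x y → r y -ℚ l j <ℚ r x -ℚ l j → r y <ℚ r x
        arc-<ʳ x y h = diff-0< (subst (0ℚ <ℚ_) (lem (l j) (r x) (r y)) (0<-diff h))
          where
          lem : ∀ l x y → (x -ℚ l) -ℚ (y -ℚ l) ≡ x -ℚ y
          lem = solve-∀ ℚ-ring
        N-arc-<ʳ : ∀ x y → ι N -ℚ (r y -ℚ l j) <ℚ ι N -ℚ (r x -ℚ l j) → r x <ℚ r y
        N-arc-<ʳ x y h = diff-0< (subst (0ℚ <ℚ_) (lem (ι N) (l j) (r x) (r y)) (0<-diff h))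
          where
          lem : ∀ N l x y → (N -ℚ (x -ℚ l)) -ℚ (N -ℚ (y -ℚ l)) ≡ y -ℚ x
          lem = solve-∀ ℚ-ring

      -- The maximum in `pℓ` is attained at the triangle whose middle label is `j`. Depending on
      -- types, an edge from `j` to another smaller label `y` either crosses `a`-`b`, or the
      -- monotonicity of `l` contradicts a larger `μ`. The right side is the mirror image, with `r`.
      left-bound : ∀ y → y < j → EL y j → μ 𝒜 j y ≤ μ 𝒜 j a
      left-bound y y<j eyj = ≮⇒≥ λ lt → further (ι-mono-< lt)
        where
        a≤ : a ≤ top
        a≤ = <≤⇒≤ a<j j≤
        y≤ : y ≤ top
        y≤ = <≤⇒≤ y<j j≤
        further : ι (μ 𝒜 j a) <ℚ ι (μ 𝒜 j y) → ⊥
        further lt with bool (up j) | <-cmp y a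
        ... | _ | tri≈ _ refl _ = Q.<-irrefl refl lt
        ... | inj₂ f | tri< y<a _ _ with bool (up a)
        ...   | inj₂ g = EL-noncrossing (quad⇒interleaved (alt y<a a<j j<b b≤ (trans g (sym f)))) eyj eab
        ...   | inj₁ g = Q.<-asym (arc-< y a (subst₂ _<ℚ_ (μ-down-< a<j j≤n f) (μ-down-< y<j j≤n f) lt)) (l-<-up y<a a≤ g)
        further lt | inj₂ f | tri> _ _ a<y with bool (up y)
        ...   | inj₁ g = EL-noncrossing (quad⇒interleaved (nest a<y y<j j<b b≤ (λ e → true≢false g (trans e f)))) eab eyj
        ...   | inj₂ g = Q.<-asym (arc-< y a (subst₂ _<ℚ_ (μ-down-< a<j j≤n f) (μ-down-< y<j j≤n f) lt)) (l-<-down a<y y≤ g)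
        further lt | inj₁ f | tri< y<a _ _ with bool (up a)
        ...   | inj₁ g = EL-noncrossing (quad⇒interleaved (alt y<a a<j j<b b≤ (trans g (sym f)))) eyj eab
        ...   | inj₂ g = Q.<-asym (N-arc-< y a (subst₂ _<ℚ_ (μ-up-< a<j j≤n f) (μ-up-< y<j j≤n f) lt)) (l-<-down y<a a≤ g)
        further lt | inj₁ f | tri> _ _ a<y with bool (up y)
        ...   | inj₂ g = EL-noncrossing (quad⇒interleaved (nest a<y y<j j<b b≤ (λ e → true≢false f (trans (sym e) g)))) eab eyj
        ...   | inj₁ g = Q.<-asym (N-arc-< y a (subst₂ _<ℚ_ (μ-up-< a<j j≤n f) (μ-up-< y<j j≤n f) lt)) (l-<-up a<y y≤ g)

      right-bound : ∀ y → j < y → y ≤ top → EL j y → μ 𝒜 j y ≤ μ 𝒜 j b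
      right-bound y j<y y≤ ejy = ≮⇒≥ λ lt → further (ι-mono-< lt)
        where
        further : ι (μ 𝒜 j b) <ℚ ι (μ 𝒜 j y) → ⊥
        further lt with bool (up j) | <-cmp b y
        ... | _ | tri≈ _ refl _ = Q.<-irrefl refl lt
        ... | inj₂ f | tri< b<y _ _ with bool (up b)
        ...   | inj₂ g = EL-noncrossing (quad⇒interleaved (alt a<j j<b b<y y≤ (trans f (sym g)))) eab ejy
        ...   | inj₁ g = Q.<-asym (arc-<ʳ y b (subst₂ _<ℚ_ (μ-down-> j<b b≤ f) (μ-down-> j<y y≤ f) lt)) (r-up b<y y≤ g)
        further lt | inj₂ f | tri> _ _ y<b with bool (up y)
        ...   | inj₁ g = EL-noncrossing (quad⇒interleaved (nest a<j j<y y<b b≤ (λ e → true≢false g (trans (sym e) f)))) eab ejy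
        ...   | inj₂ g = Q.<-asym (arc-<ʳ y b (subst₂ _<ℚ_ (μ-down-> j<b b≤ f) (μ-down-> j<y y≤ f) lt)) (r-down y<b g)
        further lt | inj₁ f | tri< b<y _ _ with bool (up b)
        ...   | inj₁ g = EL-noncrossing (quad⇒interleaved (alt a<j j<b b<y y≤ (trans f (sym g)))) eab ejy
        ...   | inj₂ g = Q.<-asym (N-arc-<ʳ y b (subst₂ _<ℚ_ (μ-up-> j<b b≤ f) (μ-up-> j<y y≤ f) lt)) (r-down b<y g)
        further lt | inj₁ f | tri> _ _ y<b with bool (up y)
        ...   | inj₂ g = EL-noncrossing (quad⇒interleaved (nest a<j j<y y<b b≤ (λ e → true≢false f (trans e g)))) eab ejy
        ...   | inj₁ g = Q.<-asym (N-arc-<ʳ y b (subst₂ _<ℚ_ (μ-up-> j<b b≤ f) (μ-up-> j<y y≤ f) lt)) (r-up y<b b≤ g)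

      pℓ≡μ : pℓ 𝒜 T j ≡ μ 𝒜 j a
      pℓ≡μ = maxList-map (μ 𝒜 j) _ (filterB-∈⁺ _ (upTo j) (Memₚ.∈-upTo⁺ a<j) (EL⇒edgeT a<j j≤ eaj)) bound
        where
        bound : ∀ {y} → y Mem.∈ filterB (λ a → edgeT 𝒜 T a j) (upTo j) → μ 𝒜 j y ≤ μ 𝒜 j a
        bound {y} m with filterB-∈⁻ (λ a → edgeT 𝒜 T a j) (upTo j) m
        ... | m′ , h = left-bound y (Memₚ.∈-upTo⁻ m′) (edgeT⇒EL (Memₚ.∈-upTo⁻ m′) j≤ h)

      pr≡μ : pr 𝒜 T j ≡ μ 𝒜 j b
      pr≡μ = maxList-map (μ 𝒜 j) _ (filterB-∈⁺ _ right b∈ (EL⇒edgeT j<b b≤ ejb)) bound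
        where
        right : List ℕ
        right = applyUpTo (λ k → suc j + k) (suc n ∸ j)
        b∈ : b Mem.∈ right
        b∈ = subst (Mem._∈ right) (m+[n∸m]≡n j<b) (Memₚ.∈-applyUpTo⁺ (λ k → suc j + k)
          (+-cancelˡ-< j _ _ (subst₂ _<_ refl (sym (m+[n∸m]≡n j≤)) (subst (_≤ top) (sym (trans (sym (+-suc j _)) (trans (+-suc j _) (m+[n∸m]≡n j<b)))) b≤))))
        bound : ∀ {y} → y Mem.∈ filterB (λ b → edgeT 𝒜 T j b) right → μ 𝒜 j y ≤ μ 𝒜 j b
        bound {y} m with filterB-∈⁻ (λ b → edgeT 𝒜 T j b) right m
        ... | m′ , h with Memₚ.∈-applyUpTo⁻ (λ k → suc j + k) m′
        ...   | k , k< , refl = right-bound (suc j + k) (s≤s (m≤m+n j k)) y≤ (edgeT⇒EL (s≤s (m≤m+n j k)) y≤ h)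
          where
          y≤ : suc j + k ≤ top
          y≤ = subst (suc j + k ≤_) (m+[n∸m]≡n j≤) (subst (_≤ j + (top ∸ j)) (+-suc j k) (+-monoʳ-≤ j k<))

      ι-ω : ∀ {s t} → ι (μ 𝒜 j a) ≡ s → ι (μ 𝒜 j b) ≡ t → ι (ω 𝒜 T j) ≡ s *ℚ t
      ι-ω e f = trans (ι-* (pℓ 𝒜 T j) (pr 𝒜 T j)) (cong₂ _*ℚ_ (trans (cong ι pℓ≡μ) e) (trans (cong ι pr≡μ) f))

      xℚ≡middleCoord : xℚ T j ≡ middleCoord a j b
      xℚ≡middleCoord with bool (up j)
      ... | inj₂ f = trans (cong (λ u → fromℤ (if u then +ℤ (suc n) -ℤ +ℤ ω 𝒜 T j else +ℤ ω 𝒜 T j)) f)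
        (trans (sym (ι≡ℕtoℚ (ω 𝒜 T j))) (trans (ι-ω (μ-down-< a<j j≤n f) (μ-down-> j<b b≤ f)) (sym (middleCoord-down a j b f))))
      ... | inj₁ f = trans (cong (λ u → fromℤ (if u then +ℤ (suc n) -ℤ +ℤ ω 𝒜 T j else +ℤ ω 𝒜 T j)) f)
        (trans (fromℤ-homo-sub (+ℤ (suc n)) (+ℤ ω 𝒜 T j)) (trans (cong₂ _-ℚ_ (trans (sym (ι≡ℕtoℚ (suc n))) (ι-suc n)) (sym (ι≡ℕtoℚ (ω 𝒜 T j))))
        (trans (cong (λ t → (1ℚ +ℚ ι n) -ℚ t) (ι-ω (μ-up-< a<j j≤n f) (μ-up-> j<b b≤ f))) (sym (middleCoord-up a j b f)))))

  -- An excess additive along triangles.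

  arc-succ : ∀ {a b} → a < b → b ≤ top → ps b ≡ suc (ps a) → arc a b ≡ 1ℚ
  arc-succ {a} {b} a<b b≤ e with bool (up a)
  ... | inj₁ f = ⊥-elim (<-asym (above a<b b≤ f) (subst (ps a <_) (sym e) ≤-refl))
  ... | inj₂ f = trans (cong₂ _-ℚ_ (trans (cong ι e) (ι-suc (ps a))) (l-down a f)) (lem (ι (ps a)))
    where
    lem : ∀ p → (1ℚ +ℚ p) -ℚ p ≡ 1ℚ
    lem = solve-∀ ℚ-ring

  -- When the larger label comes first, `a` is up, and the shift by `N` turns the side into the
  -- complementary arc.
  arc-pred : ∀ {a b} → a < b → ps a ≡ suc (ps b) → arc a b ≡ 1ℚ +ℚ ι n
  arc-pred {a} {b} a<b e with bool (up a)
  ... | inj₂ f = ⊥-elim (<-asym (below a<b f) (subst (ps b <_) (sym e) ≤-refl))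
  ... | inj₁ f = trans (cong (r b -ℚ_) (trans (l-up a f) (cong₂ _-ℚ_ (trans (cong ι e) (ι-suc (ps b))) ι-N))) (lem (ι (ps b)) (ι n))
    where
    lem : ∀ p n → p -ℚ ((1ℚ +ℚ p) -ℚ (2ℚ +ℚ n)) ≡ 1ℚ +ℚ n
    lem = solve-∀ ℚ-ring

  arc-root : ∀ {a b} → ps a ≡ 0 → up a ≡ false → ps b ≡ top → arc a b ≡ 1ℚ +ℚ ι n
  arc-root {a} {b} e f g = trans (cong₂ _-ℚ_ (trans (cong ι g) (ι-suc n)) (trans (l-down a f) (trans (cong ι e) ι-0))) (Q.+-identityʳ _)

  lab-order : ∀ {p q} → p < q → q ≤ top → PosOrder (lab p) (lab q)
  lab-order p<q q≤ = posOrder (lab≤ p≤) (lab≤ q≤) (subst₂ _<_ (sym (ps-lab p≤)) (sym (ps-lab q≤)) p<q)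
    where p≤ = <≤⇒≤ p<q q≤

  -- The excess of the region cut off by p–q on the side not containing the
  -- boundary edge {0, top}; unlike δ it is additive along triangles.
  Ψ : (ℕ → ℚ) → ℕ → ℕ → ℚ
  Ψ y p q = if lab p <ᵇ lab q then δ y (lab p) (lab q) else defect y -ℚ δ y (lab q) (lab p)

  Ψ-rising : ∀ y p q → lab p < lab q → Ψ y p q ≡ δ y (lab p) (lab q)
  Ψ-rising y p q h = cong (λ b → if b then δ y (lab p) (lab q) else defect y -ℚ δ y (lab q) (lab p)) (<⇒<ᵇ-true h)

  Ψ-falling : ∀ y p q → lab q < lab p → Ψ y p q ≡ defect y -ℚ δ y (lab q) (lab p)
  Ψ-falling y p q h = cong (λ b → if b then δ y (lab p) (lab q) else defect y -ℚ δ y (lab q) (lab p)) (≥⇒<ᵇ-false (<⇒≤ h))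

  ps-lab-suc : ∀ p → suc p ≤ top → ps (lab (suc p)) ≡ suc (ps (lab p))
  ps-lab-suc p 1+p≤ = trans (ps-lab 1+p≤) (cong suc (sym (ps-lab (<⇒≤ 1+p≤))))

  Ψ-boundary : ∀ y p → suc p ≤ top → Ψ y p (suc p) ≡ 0ℚ
  Ψ-boundary y p 1+p≤ with lab-order ≤-refl 1+p≤
  ... | rising lt _ = trans (Ψ-rising y p (suc p) lt) (δ-lower y lt (lab≤ 1+p≤) (arc-succ lt (lab≤ 1+p≤) (ps-lab-suc p 1+p≤)))
  ... | falling gt _ = trans (Ψ-falling y p (suc p) gt) (trans (cong (defect y -ℚ_) (δ-upper y gt (lab≤ (<⇒≤ 1+p≤)) (arc-pred gt (ps-lab-suc p 1+p≤))))
      (Q.+-inverseʳ (defect y)))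

  0<lab-top : 0 < lab top
  0<lab-top = ≤∧≢⇒< z≤n λ e → 0≢1+n (trans (cong ps e) (ps-lab ≤-refl))

  Ψ-root : ∀ y → Ψ y 0 top ≡ defect y
  Ψ-root y = trans (Ψ-rising y 0 top (subst (_< lab top) (sym lab-0) 0<lab-top))
    (trans (cong (λ a → δ y a (lab top)) lab-0) (δ-upper y 0<lab-top (lab≤ ≤-refl) (arc-root {0} {lab top} refl refl (ps-lab ≤-refl))))

  module _ (y : ℕ → ℚ) (EL′ : ℕ → ℕ → Set) (EL′-sym : ∀ {a b} → EL′ a b → EL′ b a)
    (tri : ∀ {a j b} → a < j → j < b → b ≤ top → EL′ a j → EL′ j b → EL′ a b → y j ≡ middleCoord a j b) where

    -- Three labels in order of position rise, fall, or rise and then fall. The shape tells which of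
    -- them is the middle one by size and forces its type: down at the start of a rise, up at the
    -- end of a fall. This selects the triangle identity; the `defect` in `Ψ` absorbs the one in
    -- `triangle-up`.
    Ψ-additive : ∀ p m q → p < m → m < q → q ≤ top → EL′ (lab p) (lab m) → EL′ (lab m) (lab q) → EL′ (lab p) (lab q) →
                 Ψ y p q ≡ Ψ y p m +ℚ Ψ y m q
    Ψ-additive p m q p<m m<q q≤ epm emq epq with lab-order p<m (<≤⇒≤ m<q q≤) | lab-order m<q q≤
    ... | falling _ u | rising _ d = ⊥-elim (true≢false u d)
    ... | rising P<M _ | rising M<Q d = trans (Ψ-rising y p q (<-trans P<M M<Q))
          (trans (triangle-down y P<M M<Q (lab≤ q≤) d (tri P<M M<Q (lab≤ q≤) epm emq epq))
          (sym (cong₂ _+ℚ_ (Ψ-rising y p m P<M) (Ψ-rising y m q M<Q))))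
    ... | falling M<P u | falling Q<M _ = trans (Ψ-falling y p q (<-trans Q<M M<P)) (trans
          (lem (δ y (lab q) (lab p)) (defect y) (δ y (lab q) (lab m)) (δ y (lab m) (lab p))
            (triangle-up y Q<M M<P P≤ u (tri Q<M M<P P≤ (EL′-sym emq) (EL′-sym epm) (EL′-sym epq))))
          (sym (cong₂ _+ℚ_ (Ψ-falling y p m M<P) (Ψ-falling y m q Q<M))))
      where
      P≤ : lab p ≤ top
      P≤ = lab≤ (<≤⇒≤ (<-trans p<m m<q) q≤)
      lem′ : ∀ t d s u → (d -ℚ t) ≡ ((d -ℚ u) +ℚ (d -ℚ s)) -ℚ ((t +ℚ d) -ℚ (s +ℚ u))
      lem′ = solve-∀ ℚ-ring
      lem : ∀ t d s u → t +ℚ d ≡ s +ℚ u → d -ℚ t ≡ (d -ℚ u) +ℚ (d -ℚ s)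
      lem t d s u e = trans (lem′ t d s u) (trans (cong (λ z → ((d -ℚ u) +ℚ (d -ℚ s)) -ℚ (z -ℚ (s +ℚ u))) e)
        (trans (cong (λ z → ((d -ℚ u) +ℚ (d -ℚ s)) -ℚ z) (Q.+-inverseʳ (s +ℚ u))) (Q.+-identityʳ _)))
    ... | rising P<M dp | falling Q<M uq with lab-order (<-trans p<m m<q) q≤
    ...   | rising P<Q _ = trans (Ψ-rising y p q P<Q) (trans
            (lem (δ y (lab p) (lab q)) (defect y) (δ y (lab q) (lab m)) (δ y (lab p) (lab m))
              (triangle-up y P<Q Q<M M≤ uq (tri P<Q Q<M M≤ epq (EL′-sym emq) epm)))
            (sym (cong₂ _+ℚ_ (Ψ-rising y p m P<M) (Ψ-falling y m q Q<M))))
      where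
      M≤ : lab m ≤ top
      M≤ = lab≤ (<≤⇒≤ m<q q≤)
      lem′ : ∀ t d s u → t ≡ (u +ℚ (d -ℚ s)) -ℚ ((u +ℚ d) -ℚ (t +ℚ s))
      lem′ = solve-∀ ℚ-ring
      lem : ∀ t d s u → u +ℚ d ≡ t +ℚ s → t ≡ u +ℚ (d -ℚ s)
      lem t d s u e = trans (lem′ t d s u) (trans (cong (λ z → (u +ℚ (d -ℚ s)) -ℚ (z -ℚ (t +ℚ s))) e)
        (trans (cong (λ z → (u +ℚ (d -ℚ s)) -ℚ z) (Q.+-inverseʳ (t +ℚ s))) (Q.+-identityʳ _)))
    ...   | falling Q<P _ = trans (Ψ-falling y p q Q<P) (trans
            (cong (λ t → t) (lem (δ y (lab q) (lab p)) (defect y) (δ y (lab p) (lab m)) (δ y (lab q) (lab m))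
              (triangle-down y Q<P P<M M≤ dp (tri Q<P P<M M≤ (EL′-sym epq) epm (EL′-sym emq)))))
            (sym (cong₂ _+ℚ_ (Ψ-rising y p m P<M) (Ψ-falling y m q Q<M))))
      where
      M≤ : lab m ≤ top
      M≤ = lab≤ (<≤⇒≤ m<q q≤)
      lem′ : ∀ t d s → d -ℚ t ≡ s +ℚ (d -ℚ (t +ℚ s))
      lem′ = solve-∀ ℚ-ring
      lem : ∀ t d s u → u ≡ t +ℚ s → d -ℚ t ≡ s +ℚ (d -ℚ u)
      lem t d s u e = trans (lem′ t d s) (cong (λ z → s +ℚ (d -ℚ z)) (sym e))

  δ-determines-ρ-ƛ : ∀ y y′ a b → δ y a b ≡ δ y′ a b → ρ y b -ℚ ƛ y a ≡ ρ y′ b -ℚ ƛ y′ a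
  δ-determines-ρ-ƛ y y′ a b e = diff≡0 (*≡0⁻ 0<2ℚ (trans (lem (ρ y b -ℚ ƛ y a) (ρ y′ b -ℚ ƛ y′ a) ((arc a b -ℚ 1ℚ) *ℚ arc a b))
    (trans (cong₂ _-ℚ_ (trans (sym (δ≡ y a b)) e) (sym (δ≡ y′ a b))) (Q.+-inverseʳ (δ y′ a b)))))
    where
    lem : ∀ s t k → 2ℚ *ℚ (s -ℚ t) ≡ (2ℚ *ℚ s -ℚ k) -ℚ (2ℚ *ℚ t -ℚ k)
    lem = solve-∀ ℚ-ring

  -- The chords `0`-`j` and `j`-`top` minus `0`-`top` isolate the gluing correction `ρ y j - ƛ y j`,
  -- from which the coordinate is read off.
  δ-determines : ∀ y y′ → total y ≡ total y′ → (∀ a b → a < b → b ≤ top → δ y a b ≡ δ y′ a b) →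
                 ∀ j → 1 ≤ j → j ≤ n → y j ≡ y′ j
  δ-determines y y′ tot h j 1≤j j≤n = byType (bool (up j))
    where
    lem : ∀ rj lj r₀ l₀ → rj -ℚ lj ≡ ((rj -ℚ l₀) +ℚ (r₀ -ℚ lj)) -ℚ (r₀ -ℚ l₀)
    lem = solve-∀ ℚ-ring
    lem-down : ∀ x → x ≡ - (- x)
    lem-down = solve-∀ ℚ-ring
    lem-up : ∀ t x → x ≡ (t +ℚ x) -ℚ t
    lem-up = solve-∀ ℚ-ring
    chord : ∀ a b → a < b → b ≤ top → ρ y b -ℚ ƛ y a ≡ ρ y′ b -ℚ ƛ y′ a
    chord a b a<b b≤ = δ-determines-ρ-ƛ y y′ a b (h a b a<b b≤)
    same : ρ y j -ℚ ƛ y j ≡ ρ y′ j -ℚ ƛ y′ j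
    same = trans (lem (ρ y j) (ƛ y j) (ρ y top) (ƛ y 0)) (trans
      (cong₂ _-ℚ_ (cong₂ _+ℚ_ (chord 0 j 1≤j (m≤n⇒m≤1+n j≤n)) (chord j top (s≤s j≤n) ≤-refl)) (chord 0 top (s≤s z≤n) ≤-refl))
      (sym (lem (ρ y′ j) (ƛ y′ j) (ρ y′ top) (ƛ y′ 0))))
    byType : up j ≡ true ⊎ up j ≡ false → y j ≡ y′ j
    byType (inj₂ f) = trans (lem-down (y j)) (trans (cong -_ (trans (sym (ρ-ƛ-down y j 1≤j j≤n f)) (trans same (ρ-ƛ-down y′ j 1≤j j≤n f))))
      (sym (lem-down (y′ j))))
    byType (inj₁ f) = trans (lem-up (total y) (y j)) (trans (cong₂ _-ℚ_ (trans (sym (ρ-ƛ-up y j 1≤j j≤n f)) (trans same (ρ-ƛ-up y′ j 1≤j j≤n f))) tot)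
      (sym (lem-up (total y′) (y′ j))))

  Ψ≡0⇒δˢ≡0 : ∀ y {p q} → defect y ≡ 0ℚ → p < q → q ≤ top → Ψ y p q ≡ 0ℚ → δˢ y (lab p) (lab q) ≡ 0ℚ
  Ψ≡0⇒δˢ≡0 y {p} {q} e p<q q≤ h with lab-order p<q q≤
  ... | rising lt _  = trans (δˢ-< y lt) (trans (sym (Ψ-rising y p q lt)) h)
  ... | falling gt _ = trans (δˢ-> y gt) (sym (diff≡0 {0ℚ} {δ y (lab q) (lab p)}
    (trans (cong (_-ℚ δ y (lab q) (lab p)) (sym e)) (trans (sym (Ψ-falling y p q gt)) h))))

  Adjacent⇒δˢ≡0 : ∀ y {p q} → defect y ≡ 0ℚ → p < q → q ≤ top → Adjacent p q → δˢ y (lab p) (lab q) ≡ 0ℚ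
  Adjacent⇒δˢ≡0 y e p<q q≤ (inj₁ refl)          = Ψ≡0⇒δˢ≡0 y e p<q q≤ (Ψ-boundary y _ q≤)
  Adjacent⇒δˢ≡0 y e p<q q≤ (inj₂ (refl , refl)) = Ψ≡0⇒δˢ≡0 y e p<q q≤ (trans (Ψ-root y) e)

  Ends-δˢ : ∀ y {a b p q} → a < b → b ≤ top → Ends p q a b → δˢ y (lab p) (lab q) ≡ δ y a b
  Ends-δˢ y {a} {b} a<b b≤ (fwd refl refl) = trans (cong₂ (δˢ y) (lab-ps (<≤⇒≤ a<b b≤)) (lab-ps b≤)) (δˢ-< y a<b)
  Ends-δˢ y {a} {b} a<b b≤ (bwd refl refl) = trans (cong₂ (δˢ y) (lab-ps b≤) (lab-ps (<≤⇒≤ a<b b≤))) (δˢ-> y a<b)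

  δ-adjacent : ∀ y {a b} → defect y ≡ 0ℚ → a < b → b ≤ top → adjacent 𝒜 a b ≡ true → δ y a b ≡ 0ℚ
  δ-adjacent y {a} {b} e a<b b≤ h with sortEnds (<≤⇒≤ a<b b≤) b≤ (<⇒≢ a<b)
  ... | p , q , f , p<q , q≤ = trans (sym (Ends-δˢ y a<b b≤ f)) (Adjacent⇒δˢ≡0 y e p<q q≤ (adjacent⇒Adjacent h f p<q))

  ptolemyAt : ∀ {p q r s} → p < q → q < r → r < s → s ≤ top → Ptolemy (lab p) (lab q) (lab r) (lab s)
  ptolemyAt p<q q<r r<s s≤ = quad⇒ptolemy (interleaved⇒quad (interleaved-lab p<q q<r r<s s≤))

  -- Slacks at M(T).

  module _ (T : DiagSet) (nc : IsNonCrossing 𝒜 T) (mx : IsMaximal T) where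

    open Geometry T nc
    open Maximal (s≤s z≤n) (maximal⇒C mx)

    private
      x : ℕ → ℚ
      x = xℚ T
      EL-lab : ∀ {p q} → E p q → p < q → q ≤ top → EL (lab p) (lab q)
      EL-lab {p} {q} e p<q q≤ = p , q , Ends-lab (<≤⇒≤ p<q q≤) q≤ , p<q , q≤ , e

    Ψ-edge : ∀ {p q} → E p q → p < q → q ≤ top → Ψ x p q ≡ 0ℚ
    Ψ-edge = edge-induction (λ p q → Ψ x p q ≡ 0ℚ) (Ψ-boundary x) λ p m q p<m m<q q≤ epm emq epq h₁ h₂ →
      trans (Ψ-additive x EL EL-sym (λ a<j j<b b≤ → xℚ≡middleCoord T nc a<j j<b b≤) p m q p<m m<q q≤
              (EL-lab epm p<m (<≤⇒≤ m<q q≤)) (EL-lab emq m<q q≤) (EL-lab epq (<-trans p<m m<q) q≤))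
        (cong₂ _+ℚ_ h₁ h₂)

    -- The excess is zero on sides between consecutive positions, hence by additivity on the root
    -- edge, where it equals `defect`. This puts M(T) on H.
    xℚ-defect : defect x ≡ 0ℚ
    xℚ-defect = trans (sym (Ψ-root x)) (Ψ-edge (inj₂ (inj₂ (refl , refl))) (s≤s z≤n) ≤-refl)

    xℚ-edge : ∀ {p q} → E p q → p < q → q ≤ top → δˢ x (lab p) (lab q) ≡ 0ℚ
    xℚ-edge e p<q q≤ = Ψ≡0⇒δˢ≡0 x xℚ-defect p<q q≤ (Ψ-edge e p<q q≤)

    Slack : ℕ → ℕ → Set
    Slack p q = 0ℚ ≤ℚ δˢ x (lab p) (lab q) × (¬ E p q → 0ℚ <ℚ δˢ x (lab p) (lab q))

    ptolemy-positive : ∀ {A B C D} → Ptolemy A B C D → 0ℚ ≤ℚ δˢ x A B → 0ℚ ≤ℚ δˢ x B C → 0ℚ ≤ℚ δˢ x C D → 0ℚ ≤ℚ δˢ x D A →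
                       0ℚ <ℚ δˢ x A C +ℚ δˢ x B D
    ptolemy-positive (c , 0<c , inj₁ h) ab bc cd da = subst (0ℚ <ℚ_) (sym (h x)) (0<+ʳ (0≤+ ab cd) 0<c)
    ptolemy-positive (c , 0<c , inj₂ h) ab bc cd da = subst (0ℚ <ℚ_) (sym (h x)) (0<+ʳ (0≤+ bc da) 0<c)

    -- In each exchange one of the two crossing chords is an edge of T, with slack zero, so the
    -- positive sum belongs to the other one.
    slack : ∀ {p q} → p < q → q ≤ top → Slack p q
    slack = chord-induction Slack
      (λ e p<q q≤ → Q.≤-reflexive (sym (xℚ-edge e p<q q≤)) , λ ¬e → ⊥-elim (¬e e))
      (λ p q r s p<q q<r r<s s≤ pq qr rs ps e → strict (subst (0ℚ <ℚ_)
        (trans (cong (_+ℚ δˢ x (lab q) (lab s)) (xℚ-edge e (<-trans p<q q<r) (<≤⇒≤ r<s s≤))) (Q.+-identityˡ _))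
        (positive p<q q<r r<s s≤ pq qr rs ps)))
      (λ p q r s p<q q<r r<s s≤ pq qr rs ps e → strict (subst (0ℚ <ℚ_)
        (trans (cong (δˢ x (lab p) (lab r) +ℚ_) (xℚ-edge e (<-trans q<r r<s) s≤)) (Q.+-identityʳ _))
        (positive p<q q<r r<s s≤ pq qr rs ps)))
      where
      strict : ∀ {p q} → 0ℚ <ℚ δˢ x (lab p) (lab q) → Slack p q
      strict h = Q.<⇒≤ h , λ _ → h
      positive : ∀ {p q r s} → p < q → q < r → r < s → s ≤ top → Slack p q → Slack q r → Slack r s → Slack p s →
                 0ℚ <ℚ δˢ x (lab p) (lab r) +ℚ δˢ x (lab q) (lab s)
      positive {p} {q} {r} {s} p<q q<r r<s s≤ pq qr rs ps = ptolemy-positive {lab p} {lab q} {lab r} {lab s} (ptolemyAt p<q q<r r<s s≤) (proj₁ pq) (proj₁ qr) (proj₁ rs)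
        (subst (0ℚ ≤ℚ_) (δˢ-sym x (lab p) (lab s)) (proj₁ ps))

    xℚ-tight : ∀ {a b} → T a b ≡ true → δ x a b ≡ 0ℚ
    xℚ-tight t with S⇒C t | diagonal t
    ... | p , q , e , c@(p<q , q≤ , _) | a<b , b≤ , _ = trans (sym (Ends-δˢ x a<b b≤ e)) (xℚ-edge (inj₂ (inj₁ c)) p<q q≤)

    xℚ-0≤ : ∀ {a b} → a < b → b ≤ top → 0ℚ ≤ℚ δ x a b
    xℚ-0≤ a<b b≤ with sortEnds (<≤⇒≤ a<b b≤) b≤ (<⇒≢ a<b)
    ... | p , q , e , p<q , q≤ = subst (0ℚ ≤ℚ_) (Ends-δˢ x a<b b≤ e) (proj₁ (slack p<q q≤))

    xℚ-strict : ∀ {a b} → IsDiagonal 𝒜 a b → T a b ≡ false → 0ℚ <ℚ δ x a b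
    xℚ-strict {a} {b} (a<b , b≤ , nadj) t with sortEnds (<≤⇒≤ a<b b≤) b≤ (<⇒≢ a<b)
    ... | p , q , e , p<q , q≤ = subst (0ℚ <ℚ_) (Ends-δˢ x a<b b≤ e) (proj₂ (slack p<q q≤) ¬edge)
      where
      ¬edge : ¬ E p q
      ¬edge (inj₁ f)        = true≢false (Adjacent⇒adjacent (inj₁ f) e) nadj
      ¬edge (inj₂ (inj₂ f)) = true≢false (Adjacent⇒adjacent (inj₂ f) e) nadj
      ¬edge (inj₂ (inj₁ c)) = true≢false (Sˢ-< a<b (C-Ends (<≤⇒≤ a<b b≤) b≤ e c)) t

    -- The exchange constants do not depend on the point, so the slacks of `y` and of M(T) propagate
    -- identically from the edges of T to all chords.
    xℚ-unique : ∀ y → defect y ≡ 0ℚ → (∀ a b → T a b ≡ true → δ y a b ≡ 0ℚ) → ∀ j → 1 ≤ j → j ≤ n → y j ≡ x j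
    xℚ-unique y dy tight = δ-determines y x same-total λ a b a<b b≤ → same-δ a<b b≤
      where
      same-total : total y ≡ total x
      same-total = diff≡0 (*≡0⁻ 0<2ℚ (trans (lem (total y) (total x) (ι n *ℚ (1ℚ +ℚ ι n))) (cong₂ _-ℚ_ dy xℚ-defect)))
        where
        lem : ∀ s t k → 2ℚ *ℚ (s -ℚ t) ≡ (2ℚ *ℚ s -ℚ k) -ℚ (2ℚ *ℚ t -ℚ k)
        lem = solve-∀ ℚ-ring
      y-edge : ∀ {p q} → E p q → p < q → q ≤ top → δˢ y (lab p) (lab q) ≡ 0ℚ
      y-edge (inj₁ f) p<q q≤ = Adjacent⇒δˢ≡0 y dy p<q q≤ (inj₁ f)
      y-edge (inj₂ (inj₂ f)) p<q q≤ = Adjacent⇒δˢ≡0 y dy p<q q≤ (inj₂ f)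
      y-edge (inj₂ (inj₁ (_ , _ , inj₁ t))) p<q q≤ = trans (δˢ-< y (proj₁ (diagonal t))) (tight _ _ t)
      y-edge (inj₂ (inj₁ (_ , _ , inj₂ t))) p<q q≤ = trans (δˢ-> y (proj₁ (diagonal t))) (tight _ _ t)
      Same : ℕ → ℕ → Set
      Same p q = δˢ y (lab p) (lab q) ≡ δˢ x (lab p) (lab q)
      edges-same : ∀ {p q} → E p q → p < q → q ≤ top → Same p q
      edges-same e p<q q≤ = trans (y-edge e p<q q≤) (sym (xℚ-edge e p<q q≤))
      diagonals-same : ∀ {A B C D} → Ptolemy A B C D → δˢ y A B ≡ δˢ x A B → δˢ y B C ≡ δˢ x B C → δˢ y C D ≡ δˢ x C D → δˢ y D A ≡ δˢ x D A →
                       δˢ y A C +ℚ δˢ y B D ≡ δˢ x A C +ℚ δˢ x B D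
      diagonals-same (c , _ , inj₁ h) ab bc cd da = trans (h y) (trans (cong₂ (λ s t → (s +ℚ t) +ℚ c) ab cd) (sym (h x)))
      diagonals-same (c , _ , inj₂ h) ab bc cd da = trans (h y) (trans (cong₂ (λ s t → (s +ℚ t) +ℚ c) bc da) (sym (h x)))
      quadSame : ∀ {p q r s} → p < q → q < r → r < s → s ≤ top → Same p q → Same q r → Same r s → Same p s →
                 δˢ y (lab p) (lab r) +ℚ δˢ y (lab q) (lab s) ≡ δˢ x (lab p) (lab r) +ℚ δˢ x (lab q) (lab s)
      quadSame {p} {q} {r} {s} p<q q<r r<s s≤ pq qr rs ps = diagonals-same {lab p} {lab q} {lab r} {lab s} (ptolemyAt p<q q<r r<s s≤) pq qr rs
        (trans (δˢ-sym y (lab s) (lab p)) (trans ps (δˢ-sym x (lab p) (lab s))))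
      cancelˡ : ∀ {s t u v} → s ≡ u → s +ℚ t ≡ u +ℚ v → t ≡ v
      cancelˡ {s} {t} {u} {v} refl e = trans (lem s t) (trans (cong (_-ℚ s) e) (sym (lem s v)))
        where
        lem : ∀ s t → t ≡ (s +ℚ t) -ℚ s
        lem = solve-∀ ℚ-ring
      same : ∀ {p q} → p < q → q ≤ top → Same p q
      same = chord-induction Same edges-same
        (λ p q r s p<q q<r r<s s≤ pq qr rs ps e →
          cancelˡ (edges-same e (<-trans p<q q<r) (<≤⇒≤ r<s s≤)) (quadSame p<q q<r r<s s≤ pq qr rs ps))
        (λ p q r s p<q q<r r<s s≤ pq qr rs ps e →
          cancelˡ (edges-same e (<-trans q<r r<s) s≤) (trans (Q.+-comm _ (δˢ y (lab p) (lab r)))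
            (trans (quadSame p<q q<r r<s s≤ pq qr rs ps) (Q.+-comm (δˢ x (lab p) (lab r)) _))))
      same-δ : ∀ {a b} → a < b → b ≤ top → δ y a b ≡ δ x a b
      same-δ a<b b≤ with sortEnds (<≤⇒≤ a<b b≤) b≤ (<⇒≢ a<b)
      ... | p , q , e , p<q , q≤ = trans (sym (Ends-δˢ y a<b b≤ e)) (trans (same p<q q≤) (Ends-δˢ x a<b b≤ e))

  -- Triangulations that avoid a given diagonal.

  Ends-interleaved : ∀ {p q u v a b c d} → a ≤ top → b ≤ top → c ≤ top → d ≤ top → Ends p q a b → Ends u v c d →
                     p < u → u < q → q < v → Interleaved a c b d
  Ends-interleaved a≤ b≤ c≤ d≤ (fwd refl refl) (fwd refl refl) x y z = asc d≤ x y z a≤ c≤ b≤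
  Ends-interleaved a≤ b≤ c≤ d≤ (fwd refl refl) (bwd refl refl) x y z = flip₂ (asc c≤ x y z a≤ d≤ b≤)
  Ends-interleaved a≤ b≤ c≤ d≤ (bwd refl refl) (fwd refl refl) x y z = flip₁ (asc d≤ x y z b≤ c≤ a≤)
  Ends-interleaved a≤ b≤ c≤ d≤ (bwd refl refl) (bwd refl refl) x y z = flip₁ (flip₂ (asc c≤ x y z b≤ d≤ a≤))

  -- If `a`-`b` crosses a member of `S`, every completion avoids it. Otherwise `flip` supplies a
  -- chord that crosses `a`-`b` and is compatible with `S`; inserting it first keeps `a`-`b` out.
  avoiding : ∀ (S : NCSet 𝒜) {a b} → IsDiagonal 𝒜 a b → proj₁ S a b ≡ false →
             Σ (NCSet 𝒜) λ R → (proj₁ S ⊆D proj₁ R) × IsMaximal (proj₁ R) × proj₁ R a b ≡ false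
  avoiding (S , nc) {a} {b} dg@(a<b , b≤ , nadj) s with addable? S nc a b
  ... | no ¬ad with complete (S , nc)
  ...   | (R , ncR) , sub , mx = (R , ncR) , sub , mx , ≡false λ t → ¬ad (dg , λ c d x → proj₂ ncR a b c d t (sub c d x))
  avoiding (S , nc) {a} {b} dg@(a<b , b≤ , nadj) s | yes (_ , h) with sortEnds (<≤⇒≤ a<b b≤) b≤ (<⇒≢ a<b)
  ... | p , q , e , p<q , q≤ = conclude (flip p q p<q q≤ ¬edge (noncrossing⇒compatible p<q q≤ (uncrossed e)))
    where
    open Geometry S nc
    a≤ : a ≤ top
    a≤ = <≤⇒≤ a<b b≤
    ¬edge : ¬ E p q
    ¬edge (inj₁ f)        = true≢false (Adjacent⇒adjacent (inj₁ f) e) nadj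
    ¬edge (inj₂ (inj₂ f)) = true≢false (Adjacent⇒adjacent (inj₂ f) e) nadj
    ¬edge (inj₂ (inj₁ c)) = true≢false (Sˢ-< a<b (C-Ends a≤ b≤ e c)) s
    uncrossed : ∀ {p q} → Ends p q a b → ∀ c d → S c d ≡ true → crosses 𝒜 (lab p) (lab q) c d ≡ false
    uncrossed (fwd refl refl) c d x = trans (cong₂ (λ u v → crosses 𝒜 u v c d) (lab-ps a≤) (lab-ps b≤)) (h c d x)
    uncrossed (bwd refl refl) c d x = trans (cong₂ (λ u v → crosses 𝒜 u v c d) (lab-ps b≤) (lab-ps a≤)) (trans (crosses-flip₁ b a c d) (h c d x))
    Result : Set
    Result = Σ (NCSet 𝒜) λ R → (S ⊆D proj₁ R) × IsMaximal (proj₁ R) × proj₁ R a b ≡ false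
    withChord : ∀ {c d} → Addable S c d → crosses 𝒜 a b c d ≡ true → Result
    withChord {c} {d} ad cr with complete (insert S c d , insert-noncrossing S c d nc ad)
    ... | (R , ncR) , sub , mx = (R , ncR) , (λ u v x → sub u v (∨-trueˡ _ x)) , mx ,
          ≡false λ t → true≢false cr (proj₂ ncR a b c d t (sub c d (insert-self S c d)))
    conclude : (∃ λ u → ∃ λ v → u < v × v ≤ top × ((u < p × p < v × v < q) ⊎ (p < u × u < q × q < v)) × Compatible u v) → Result
    conclude (u , v , u<v , v≤ , inj₁ (u<p , p<v , v<q) , comp) with addable u<v v≤
      [ (λ { refl → <⇒≱ u<p (≤-pred p<v) }) , (λ { (_ , refl) → <⇒≱ v<q q≤ }) ]′ comp
    ... | c , d , f , c≤ , ad@((_ , d≤ , _) , _) = withChord ad (interleaved⇒crosses (swap (Ends-interleaved c≤ d≤ a≤ b≤ f e u<p p<v v<q)))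
    conclude (u , v , u<v , v≤ , inj₂ (p<u , u<q , q<v) , comp) with addable u<v v≤
      [ (λ { refl → <⇒≱ u<q (≤-pred q<v) }) , (λ { (refl , _) → <⇒≱ p<u z≤n }) ]′ comp
    ... | c , d , f , c≤ , ad@((_ , d≤ , _) , _) = withChord ad (interleaved⇒crosses (Ends-interleaved a≤ b≤ c≤ d≤ e f p<u u<q q<v))

  -- Paths of sets of labels.

  -- The path of a set A runs from 0 to top through the down labels outside A
  -- and the up labels in A, in increasing order; A lies below it.
  on : (ℕ → Bool) → ℕ → Bool
  on A w = if up w then A w else not (A w)

  onPath : (ℕ → Bool) → ℕ → Bool
  onPath A w = (w ≡ᵇ 0) ∨ (w ≡ᵇ top) ∨ on A w

  onPath-inner : ∀ A w → 1 ≤ w → w ≤ n → onPath A w ≡ on A w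
  onPath-inner A w 1≤w w≤n = trans (cong (_∨ ((w ≡ᵇ top) ∨ on A w)) (≢⇒≡ᵇ-false {w} {0} λ { refl → <-irrefl refl 1≤w }))
    (cong (_∨ on A w) (≢⇒≡ᵇ-false {w} {top} λ { refl → 1+n≰n w≤n }))

  onPath-top : ∀ A → onPath A top ≡ true
  onPath-top A = ∨-trueʳ (top ≡ᵇ 0) (∨-trueˡ (on A top) (≡⇒≡ᵇ-true (refl {x = top})))

  PathEdge : (ℕ → Bool) → ℕ → ℕ → Set
  PathEdge A a b = a < b × b ≤ top × onPath A a ≡ true × onPath A b ≡ true × (∀ w → w < b → a < w → onPath A w ≡ false)

  pathEdge? : ∀ A a b → Dec (PathEdge A a b)
  pathEdge? A a b with (suc a ≤? b) ×-dec ((b ≤? top) ×-dec ((onPath A a 𝔹.≟ true) ×-dec ((onPath A b 𝔹.≟ true) ×-dec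
    All.all? (λ w → (suc a ≤? w) →-dec (onPath A w 𝔹.≟ false)) (upTo b))))
  ... | yes (p , q , s , t , h) = yes (p , q , s , t , λ w w<b → All.lookup h (Memₚ.∈-upTo⁺ w<b))
  ... | no ¬h = no λ { (p , q , s , t , h) → ¬h (p , q , s , t , All.tabulate λ {w} m → h w (Memₚ.∈-upTo⁻ m)) }

  -- A scan over the labels: `a` is the last path vertex met and `b` the next candidate. In use,
  -- `b + k` stays equal to `top`.
  walkSum : (ℕ → ℕ → ℚ) → (ℕ → Bool) → ℕ → ℕ → ℕ → ℚ
  walkSum f A a b zero    = f a b
  walkSum f A a b (suc k) = if on A b then f a b +ℚ walkSum f A b (suc b) k else walkSum f A a (suc b) k

  walkSum-telescope : ∀ (ρ′ ƛ′ : ℕ → ℚ) A a b k → walkSum (λ a b → ρ′ b -ℚ ƛ′ a) A a b k ≡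
                      (ρ′ (b + k) -ℚ ƛ′ a) +ℚ ∑ b k (λ w → ind (on A w) *ℚ (ρ′ w -ℚ ƛ′ w))
  walkSum-telescope ρ′ ƛ′ A a b zero = trans (cong (λ c → ρ′ c -ℚ ƛ′ a) (sym (+-identityʳ b))) (sym (Q.+-identityʳ _))
  walkSum-telescope ρ′ ƛ′ A a b (suc k) with on A b
  ... | true = trans (cong ((ρ′ b -ℚ ƛ′ a) +ℚ_) (walkSum-telescope ρ′ ƛ′ A b (suc b) k))
    (trans (lem (ρ′ b) (ƛ′ a) (ρ′ (suc b + k)) (ƛ′ b) (∑ (suc b) k (λ w → ind (on A w) *ℚ (ρ′ w -ℚ ƛ′ w))))
      (cong (λ c → (ρ′ c -ℚ ƛ′ a) +ℚ (1ℚ *ℚ (ρ′ b -ℚ ƛ′ b) +ℚ ∑ (suc b) k (λ w → ind (on A w) *ℚ (ρ′ w -ℚ ƛ′ w)))) (sym (+-suc b k))))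
    where
    lem : ∀ rb la rc lb s → (rb -ℚ la) +ℚ ((rc -ℚ lb) +ℚ s) ≡ (rc -ℚ la) +ℚ (1ℚ *ℚ (rb -ℚ lb) +ℚ s)
    lem = solve-∀ ℚ-ring
  ... | false = trans (walkSum-telescope ρ′ ƛ′ A a (suc b) k)
    (cong₂ (λ c s → (ρ′ c -ℚ ƛ′ a) +ℚ s) (sym (+-suc b k))
      (sym (trans (cong (_+ℚ ∑ (suc b) k (λ w → ind (on A w) *ℚ (ρ′ w -ℚ ƛ′ w))) (Q.*-zeroˡ (ρ′ b -ℚ ƛ′ b))) (Q.+-identityˡ _))))

  -- After telescoping, `R top` contributes all down labels, and each inner vertex of the path its
  -- gluing correction: a down label outside `A` is removed, an up label in `A` is added. What
  -- remains is `A`, up to all-one vectors, on which `z` vanishes.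
  path-sum : ∀ z A → total z ≡ 0ℚ → walkSum (λ a b → ρ z b -ℚ ƛ z a) A 0 1 n ≡ sumK z A
  path-sum z A tz = trans (walkSum-telescope (ρ z) (ƛ z) A 0 1 n)
    (trans (cong₂ _+ℚ_ (trans (cong (ρ z top -ℚ_) (ƛ-0 z)) (trans (Q.+-identityʳ (ρ z top)) (∑-cong 1 n λ { i _ (s≤s i≤n) → cong (_*ℚ z i) (R-top i (s≤s i≤n)) })))
        (∑-cong 1 n λ { i 1≤i (s≤s i≤n) → term i 1≤i i≤n }))
      (trans (sym (∑-+ 1 n (λ i → ind (dn i) *ℚ z i) (λ i → (ind (A i) -ℚ ind (dn i)) *ℚ z i)))
        (∑-cong 1 n λ i _ _ → lem (ind (dn i)) (ind (A i)) (z i))))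
    where
    lem : ∀ d a z → d *ℚ z +ℚ (a -ℚ d) *ℚ z ≡ a *ℚ z
    lem = solve-∀ ℚ-ring
    R-top : ∀ i → i < top → R top i ≡ ind (dn i)
    R-top i i<top = trans (cong (λ u → if u then ind (dn i) +ℚ ind (up i ∧ (top ≤ᵇ i)) else ind (dn i ∧ (i <ᵇ top))) up-top)
      (cong ind (trans (cong (dn i ∧_) (<⇒<ᵇ-true i<top)) (𝔹.∧-identityʳ (dn i))))
    ind-not : ∀ a → ind (not a) ≡ 1ℚ -ℚ ind a
    ind-not true  = refl
    ind-not false = refl
    term-down : ∀ a z → (1ℚ -ℚ a) *ℚ (- z) ≡ (a -ℚ 1ℚ) *ℚ z
    term-down = solve-∀ ℚ-ring
    term-up : ∀ a z → a *ℚ (0ℚ +ℚ z) ≡ (a -ℚ 0ℚ) *ℚ z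
    term-up = solve-∀ ℚ-ring
    on≡ : ∀ i {u} → up i ≡ u → on A i ≡ (if u then A i else not (A i))
    on≡ i e = cong (λ u → if u then A i else not (A i)) e
    term : ∀ i → 1 ≤ i → i ≤ n → ind (on A i) *ℚ (ρ z i -ℚ ƛ z i) ≡ (ind (A i) -ℚ ind (dn i)) *ℚ z i
    term i 1≤i i≤n with bool (up i)
    ... | inj₂ f = trans (cong₂ _*ℚ_ (trans (cong ind (on≡ i f)) (ind-not (A i))) (ρ-ƛ-down z i 1≤i i≤n f))
      (trans (term-down (ind (A i)) (z i)) (cong (λ u → (ind (A i) -ℚ ind (not u)) *ℚ z i) (sym f)))
    ... | inj₁ f = trans (cong₂ _*ℚ_ (cong ind (on≡ i f)) (trans (ρ-ƛ-up z i 1≤i i≤n f) (cong (_+ℚ z i) tz)))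
      (trans (term-up (ind (A i)) (z i)) (cong (λ u → (ind (A i) -ℚ ind (not u)) *ℚ z i) (sym f)))

  module _ (f : ℕ → ℕ → ℚ) (A : ℕ → Bool) where

    private
      Reached : ℕ → ℕ → Set
      Reached a b = a < b × onPath A a ≡ true × (∀ w → w < b → a < w → onPath A w ≡ false)

      edge : ∀ {a b} → Reached a b → b ≤ top → onPath A b ≡ true → PathEdge A a b
      edge (a<b , va , h) b≤ vb = a<b , b≤ , va , vb , h

      last-edge : ∀ {a b} → Reached a b → b + 0 ≡ top → PathEdge A a b
      last-edge {a} {b} rc e with trans (sym (+-identityʳ b)) e
      ... | refl = edge rc ≤-refl (onPath-top A)

      b≤n : ∀ b k → b + suc k ≡ top → b ≤ n
      b≤n b k e = subst (b ≤_) (suc-injective (trans (sym (+-suc b k)) e)) (m≤m+n b k)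

      advance : ∀ {a b k} → Reached a b → b + suc k ≡ top → on A b ≡ true → PathEdge A a b × Reached b (suc b)
      advance {a} {b} {k} rc@(a<b , _) e o = edge rc (m≤n⇒m≤1+n (b≤n b k e)) vb , (≤-refl , vb , λ w w≤b b<w → ⊥-elim (<⇒≱ b<w (≤-pred w≤b)))
        where
        vb : onPath A b ≡ true
        vb = trans (onPath-inner A b (≤-<-trans z≤n a<b) (b≤n b k e)) o

      skip : ∀ {a b k} → Reached a b → b + suc k ≡ top → on A b ≡ false → onPath A b ≡ false × Reached a (suc b)
      skip {a} {b} {k} (a<b , va , h) e o = vb , (m≤n⇒m≤1+n a<b , va , h′)
        where
        vb : onPath A b ≡ false
        vb = trans (onPath-inner A b (≤-<-trans z≤n a<b) (b≤n b k e)) o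
        h′ : ∀ w → w < suc b → a < w → onPath A w ≡ false
        h′ w (s≤s w≤b) a<w with m≤n⇒m<n∨m≡n w≤b
        ... | inj₁ w<b  = h w w<b a<w
        ... | inj₂ refl = vb

      start : Reached 0 1
      start = s≤s z≤n , refl , λ w w<1 0<w → ⊥-elim (<⇒≱ 0<w (≤-pred w<1))

      go-0≤ : (∀ a b → PathEdge A a b → 0ℚ ≤ℚ f a b) → ∀ a b k → Reached a b → b + k ≡ top → 0ℚ ≤ℚ walkSum f A a b k
      go-0≤ h a b zero    rc e = h a b (last-edge rc e)
      go-0≤ h a b (suc k) rc e with on A b in o
      ... | true  = 0≤+ (h a b (proj₁ (advance rc e o))) (go-0≤ h b (suc b) k (proj₂ (advance rc e o)) (trans (sym (+-suc b k)) e))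
      ... | false = go-0≤ h a (suc b) k (proj₂ (skip rc e o)) (trans (sym (+-suc b k)) e)

      go-≡0 : (∀ a b → PathEdge A a b → f a b ≡ 0ℚ) → ∀ a b k → Reached a b → b + k ≡ top → walkSum f A a b k ≡ 0ℚ
      go-≡0 h a b zero    rc e = h a b (last-edge rc e)
      go-≡0 h a b (suc k) rc e with on A b in o
      ... | true  = cong₂ _+ℚ_ (h a b (proj₁ (advance rc e o))) (go-≡0 h b (suc b) k (proj₂ (advance rc e o)) (trans (sym (+-suc b k)) e))
      ... | false = go-≡0 h a (suc b) k (proj₂ (skip rc e o)) (trans (sym (+-suc b k)) e)

      next : ∀ {a b c d} → Reached a b → onPath A b ≡ true → PathEdge A c d → a ≤ c → (c ≡ a × d ≡ b) ⊎ b ≤ c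
      next {a} {b} {c} {d} (a<b , va , h) vb (c<d , d≤ , vc , vd , g) a≤c with m≤n⇒m<n∨m≡n a≤c
      ... | inj₁ a<c = inj₂ (≮⇒≥ λ c<b → true≢false vc (h c c<b a<c))
      ... | inj₂ refl with <-cmp d b
      ...   | tri< d<b _ _ = ⊥-elim (true≢false vd (h d d<b c<d))
      ...   | tri≈ _ refl _ = inj₁ (refl , refl)
      ...   | tri> _ _ b<d = ⊥-elim (true≢false vb (g b b<d a<b))

      go-all≡0 : (∀ a b → PathEdge A a b → 0ℚ ≤ℚ f a b) → ∀ a b k → Reached a b → b + k ≡ top → walkSum f A a b k ≡ 0ℚ →
                 ∀ c d → PathEdge A c d → a ≤ c → f c d ≡ 0ℚ
      go-all≡0 h a b zero rc e s c d pe a≤c with trans (sym (+-identityʳ b)) e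
      ... | refl with next rc (onPath-top A) pe a≤c
      ...   | inj₁ (refl , refl) = s
      ...   | inj₂ b≤c = ⊥-elim (<⇒≱ (<-≤-trans (proj₁ pe) (proj₁ (proj₂ pe))) b≤c)
      go-all≡0 h a b (suc k) rc e s c d pe a≤c with on A b in o
      ... | false = go-all≡0 h a (suc b) k (proj₂ (skip rc e o)) (trans (sym (+-suc b k)) e) s c d pe a≤c
      ... | true with advance rc e o
      ...   | pe₁ , rc′ with 0≤+≡0 (h a b pe₁) (go-0≤ h b (suc b) k rc′ (trans (sym (+-suc b k)) e)) s
      ...     | s₁ , s₂ with next rc (proj₁ (proj₂ rc′)) pe a≤c
      ...       | inj₁ (refl , refl) = s₁
      ...       | inj₂ b≤c = go-all≡0 h b (suc b) k rc′ (trans (sym (+-suc b k)) e) s₂ c d pe b≤c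

    walkSum-0≤ : (∀ a b → PathEdge A a b → 0ℚ ≤ℚ f a b) → 0ℚ ≤ℚ walkSum f A 0 1 n
    walkSum-0≤ h = go-0≤ h 0 1 n start refl

    walkSum-≡0 : (∀ a b → PathEdge A a b → f a b ≡ 0ℚ) → walkSum f A 0 1 n ≡ 0ℚ
    walkSum-≡0 h = go-≡0 h 0 1 n start refl

    walkSum≡0⇒≡0 : (∀ a b → PathEdge A a b → 0ℚ ≤ℚ f a b) → walkSum f A 0 1 n ≡ 0ℚ → ∀ a b → PathEdge A a b → f a b ≡ 0ℚ
    walkSum≡0⇒≡0 h s a b pe = go-all≡0 h 0 1 n start refl s a b pe z≤n

  _⊆ᵇ_ : (ℕ → Bool) → (ℕ → Bool) → Set
  P ⊆ᵇ P′ = ∀ w → P w ≡ true → P′ w ≡ true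

  -- For equal types, changing from off to on at `x` and from on to off at `z` means that membership
  -- changes in opposite directions, which nested sets do not allow.
  nested-moves : ∀ {P P′ x z} → P ⊆ᵇ P′ ⊎ P′ ⊆ᵇ P → on P x ≡ false → on P′ x ≡ true → on P z ≡ true → on P′ z ≡ false → up x ≡ up z → ⊥
  nested-moves {P} {P′} {x} {z} inc px p′x pz p′z e with up x | up z
  nested-moves (inj₁ inc) px p′x pz p′z refl | true | true = true≢false (inc _ pz) p′z
  nested-moves (inj₂ inc) px p′x pz p′z refl | true | true = true≢false (inc _ p′x) px
  nested-moves {P} {P′} {x} {z} inc px p′x pz p′z refl | false | false with P x in a | P′ x in b | P z in c | P′ z in d
  nested-moves {P} {P′} {x} {z} (inj₁ inc) px p′x pz p′z refl | false | false | true | false | false | true = true≢false (inc x a) b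
  nested-moves {P} {P′} {x} {z} (inj₂ inc) px p′x pz p′z refl | false | false | true | false | false | true = true≢false (inc z d) c

  -- Being on the path means membership for up labels and non-membership for down ones, so equal
  -- changes at labels of different type are again opposite changes of membership.
  nested-moves′ : ∀ {P P′ x z} → P ⊆ᵇ P′ ⊎ P′ ⊆ᵇ P → on P x ≡ false → on P′ x ≡ true → on P z ≡ false → on P′ z ≡ true → up x ≢ up z → ⊥
  nested-moves′ {P} {P′} {x} {z} inc px p′x pz p′z e with up x | up z
  ... | true  | true  = e refl
  ... | false | false = e refl
  nested-moves′ {P} {P′} {x} {z} inc px p′x pz p′z e | true | false with P z in c | P′ z in d
  nested-moves′ {P} {P′} {x} {z} (inj₁ inc) px p′x pz p′z e | true | false | true | false = true≢false (inc z c) d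
  nested-moves′ {P} {P′} {x} {z} (inj₂ inc) px p′x pz p′z e | true | false | true | false = true≢false (inc x p′x) px
  nested-moves′ {P} {P′} {x} {z} inc px p′x pz p′z e | false | true with P x in a | P′ x in b
  nested-moves′ {P} {P′} {x} {z} (inj₁ inc) px p′x pz p′z e | false | true | true | false = true≢false (inc x a) b
  nested-moves′ {P} {P′} {x} {z} (inj₂ inc) px p′x pz p′z e | false | true | true | false = true≢false (inc z p′z) pz

  PathEdgeˢ : (ℕ → Bool) → ℕ → ℕ → Set
  PathEdgeˢ A a b = PathEdge A a b ⊎ PathEdge A b a

  PathEdgeˢ-< : ∀ {A a b} → a < b → PathEdgeˢ A a b → PathEdge A a b
  PathEdgeˢ-< a<b (inj₁ pe) = pe
  PathEdgeˢ-< a<b (inj₂ pe) = ⊥-elim (<-asym a<b (proj₁ pe))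

  -- A path edge skips every label between its ends. For crossing edges this prescribes, at both
  -- middle labels, which path passes through; the two shapes of a `Quad` give exactly the two
  -- situations excluded for nested sets.
  paths-noncrossing : ∀ {A B C D P P′} → Quad A B C D → P ⊆ᵇ P′ ⊎ P′ ⊆ᵇ P → PathEdgeˢ P A C → PathEdgeˢ P′ B D → ⊥
  paths-noncrossing (flip₁ q) inc e f = paths-noncrossing q inc (⊎-swap e) f
  paths-noncrossing (flip₂ q) inc e f = paths-noncrossing q inc e (⊎-swap f)
  paths-noncrossing (swap q)  inc e f = paths-noncrossing q (⊎-swap inc) f e
  paths-noncrossing {P = P} {P′} (alt {w} {x} {z} {v} w<x x<z z<v v≤ t) inc e f
    with PathEdgeˢ-< (<-trans w<x x<z) e | PathEdgeˢ-< (<-trans x<z z<v) f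
  ... | _ , _ , _ , pz , hp | _ , _ , p′x , _ , hp′ = nested-moves {P} {P′} {x} {z} inc
    (trans (sym (inner P x 1≤x x≤n)) (hp x x<z w<x)) (trans (sym (inner P′ x 1≤x x≤n)) p′x)
    (trans (sym (inner P z 1≤z z≤n′)) pz) (trans (sym (inner P′ z 1≤z z≤n′)) (hp′ z z<v x<z)) t
    where
    inner = onPath-inner
    1≤x = ≤-<-trans z≤n w<x
    1≤z = ≤-<-trans z≤n x<z
    z≤n′ = ≤-pred (<-≤-trans z<v v≤)
    x≤n = ≤-trans (<⇒≤ x<z) z≤n′
  paths-noncrossing {P = P} {P′} (nest {w} {x} {z} {v} w<x x<z z<v v≤ t) inc e f
    with PathEdgeˢ-< (<-trans w<x (<-trans x<z z<v)) e | PathEdgeˢ-< x<z f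
  ... | _ , _ , _ , _ , hp | _ , _ , p′x , p′z , _ = nested-moves′ {P} {P′} {x} {z} inc
    (trans (sym (inner P x 1≤x x≤n)) (hp x (<-trans x<z z<v) w<x)) (trans (sym (inner P′ x 1≤x x≤n)) p′x)
    (trans (sym (inner P z 1≤z z≤n′)) (hp z z<v (<-trans w<x x<z))) (trans (sym (inner P′ z 1≤z z≤n′)) p′z) t
    where
    inner = onPath-inner
    1≤x = ≤-<-trans z≤n w<x
    1≤z = ≤-<-trans z≤n x<z
    z≤n′ = ≤-pred (<-≤-trans z<v v≤)
    x≤n = ≤-trans (<⇒≤ x<z) z≤n′

  -- Linear functionals through paths of their level sets.

  module Levels (c : ℕ → ℚ) where

    level : ℚ → ℕ → Bool
    level u j = ⌊ c j Q.<? u ⌋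

    level-mono : ∀ {u u′} → u ≤ℚ u′ → level u ⊆ᵇ level u′
    level-mono {u} {u′} u≤u′ j h = true-does (c j Q.<? u′) (Q.<-≤-trans (does-true (c j Q.<? u) h) u≤u′)

    levels-nested : ∀ u u′ → level u ⊆ᵇ level u′ ⊎ level u′ ⊆ᵇ level u
    levels-nested u u′ with Q.≤-total u u′
    ... | inj₁ h = inj₁ (level-mono h)
    ... | inj₂ h = inj₂ (level-mono h)

    -- Only proper gaps `v < u` count: a term with coefficient zero says nothing about the slacks
    -- along its path.
    onLevel : ℚ → List ℚ → ℕ → ℕ → Bool
    onLevel v []       a b = false
    onLevel v (u ∷ us) a b = (⌊ v Q.<? u ⌋ ∧ ⌊ pathEdge? (level u) a b ⌋) ∨ onLevel u us a b

    onLevel-true : ∀ v us a b → onLevel v us a b ≡ true → ∃ λ u → PathEdge (level u) a b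
    onLevel-true v (u ∷ us) a b h with ∨-true {⌊ v Q.<? u ⌋ ∧ ⌊ pathEdge? (level u) a b ⌋} h
    ... | inj₁ x = u , does-true (pathEdge? (level u) a b) (proj₂ (∧-true {⌊ v Q.<? u ⌋} x))
    ... | inj₂ x = onLevel-true u us a b x

    diagonals : ℚ → List ℚ → DiagSet
    diagonals v us a b = not (adjacent 𝒜 a b) ∧ onLevel v us a b

    diagonals-true : ∀ v us a b → diagonals v us a b ≡ true → adjacent 𝒜 a b ≡ false × onLevel v us a b ≡ true
    diagonals-true v us a b h with adjacent 𝒜 a b | h
    ... | false | x = refl , x

    diagonals-noncrossing : ∀ v us → IsNonCrossing 𝒜 (diagonals v us)
    diagonals-noncrossing v us = dg , nc
      where
      dg : ∀ a b → diagonals v us a b ≡ true → IsDiagonal 𝒜 a b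
      dg a b h with diagonals-true v us a b h
      ... | nadj , x with onLevel-true v us a b x
      ...   | u , (a<b , b≤ , _) = a<b , b≤ , nadj
      nc : ∀ a b c d → diagonals v us a b ≡ true → diagonals v us c d ≡ true → crosses 𝒜 a b c d ≡ false
      nc a b c d h k with onLevel-true v us a b (proj₂ (diagonals-true v us a b h)) | onLevel-true v us c d (proj₂ (diagonals-true v us c d k))
      ... | u , pe@(a<b , b≤ , _) | u′ , pe′@(c<d , d≤ , _) = ≡false λ cr → paths-noncrossing
        (interleaved⇒quad (crosses⇒interleaved (<≤⇒≤ a<b b≤) b≤ (<≤⇒≤ c<d d≤) d≤ cr))
        (levels-nested u u′) (inj₁ pe) (inj₁ pe′)

    weighted : (ℕ → ℚ) → ℚ → List ℚ → ℚ
    weighted z v []       = 0ℚ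
    weighted z v (u ∷ us) = (u -ℚ v) *ℚ sumK z (level u) +ℚ weighted z u us

    ∑-drop : ∀ z v us → ∑ 1 n (λ j → drop v us (c j) *ℚ z j) ≡ weighted z v us
    ∑-drop z v []       = ∑-zero 1 n λ j _ _ → Q.*-zeroˡ (z j)
    ∑-drop z v (u ∷ us) = trans (∑-cong 1 n λ j _ _ → lem (u -ℚ v) (ind (level u j)) (drop u us (c j)) (z j))
      (trans (∑-+ 1 n (λ j → (u -ℚ v) *ℚ (ind (level u j) *ℚ z j)) (λ j → drop u us (c j) *ℚ z j))
        (cong₂ _+ℚ_ (∑-* 1 n (u -ℚ v) (λ j → ind (level u j) *ℚ z j)) (∑-drop z u us)))
      where
      lem : ∀ g i d z → (g *ℚ i +ℚ d) *ℚ z ≡ g *ℚ (i *ℚ z) +ℚ d *ℚ z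
      lem = solve-∀ ℚ-ring

  pair : (ℕ → ℚ) → (ℕ → ℚ) → ℚ
  pair c y = ∑ 1 n (λ j → c j *ℚ y j)

  pair-sub : ∀ c y x → pair c (λ j → y j -ℚ x j) ≡ pair c y -ℚ pair c x
  pair-sub c y x = trans (∑-cong 1 n λ j _ _ → lem (c j) (y j) (x j)) (∑-sub 1 n (λ j → c j *ℚ y j) (λ j → c j *ℚ x j))
    where
    lem : ∀ c y x → c *ℚ (y -ℚ x) ≡ c *ℚ y -ℚ c *ℚ x
    lem = solve-∀ ℚ-ring

  chordSum : (ℕ → ℚ) → ℕ → ℕ → ℚ
  chordSum z a b = ρ z b -ℚ ƛ z a

  chordSum-sub : ∀ y x a b → 2ℚ *ℚ chordSum (λ j → y j -ℚ x j) a b ≡ δ y a b -ℚ δ x a b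
  chordSum-sub y x a b = trans (cong₂ (λ s t → 2ℚ *ℚ (s -ℚ t)) (pair-sub (R b) y x) (pair-sub (L a) y x))
    (trans (lem (ρ y b) (ρ x b) (ƛ y a) (ƛ x a) ((arc a b -ℚ 1ℚ) *ℚ arc a b)) (sym (cong₂ _-ℚ_ (δ≡ y a b) (δ≡ x a b))))
    where
    lem : ∀ p q s t k → 2ℚ *ℚ ((p -ℚ q) -ℚ (s -ℚ t)) ≡ (2ℚ *ℚ (p -ℚ s) -ℚ k) -ℚ (2ℚ *ℚ (q -ℚ t) -ℚ k)
    lem = solve-∀ ℚ-ring

  module _ (c : ℕ → ℚ) where

    open Levels c

    values : List ℚ
    values = applyUpTo (λ i → c (suc i)) n

    c∈values : ∀ j → 1 ≤ j → j ≤ n → c j Mem.∈ sort values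
    c∈values (suc i) _ i<n = ∈-resp-↭ (↭-sym (sort-↭ values)) (Memₚ.∈-applyUpTo⁺ (λ i → c (suc i)) i<n)

    Thresholds : Set
    Thresholds = ∃ λ v → ∃ λ us → Linked _≤ℚ_ (v ∷ us) × (∀ j → 1 ≤ j → j ≤ n → c j Mem.∈ (v ∷ us))

    thresholds : Thresholds
    thresholds with sort values | sort-↗ values | c∈values
    ... | []     | _ | m = ⊥-elim (case m 1 ≤-refl 1≤n of λ ())
    ... | v ∷ us | s | m = v , us , s , m

    -- By the layer-cake decomposition `c` is the largest threshold minus weighted level sets, and
    -- the constant drops out because `z` has total zero.
    pair≡-weighted : ∀ z v us → total z ≡ 0ℚ → Linked _≤ℚ_ (v ∷ us) → (∀ j → 1 ≤ j → j ≤ n → c j Mem.∈ (v ∷ us)) →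
                     pair c z ≡ - weighted z v us
    pair≡-weighted z v us tz s m = trans (∑-cong 1 n λ { j 1≤j (s≤s j≤n) → trans (lem (c j) (last v us) (z j))
        (cong (λ d → last v us *ℚ z j -ℚ d *ℚ z j) (sym (drop-∈ s (m j 1≤j j≤n)))) })
      (trans (∑-sub 1 n (λ j → last v us *ℚ z j) (λ j → drop v us (c j) *ℚ z j))
      (trans (cong₂ _-ℚ_ (trans (∑-* 1 n (last v us) z) (trans (cong (last v us *ℚ_) tz) (Q.*-zeroʳ (last v us)))) (∑-drop z v us))
        (Q.+-identityˡ _)))
      where
      lem : ∀ c w z → c *ℚ z ≡ w *ℚ z -ℚ (w -ℚ c) *ℚ z
      lem = solve-∀ ℚ-ring

    module _ (z : ℕ → ℚ) (tz : total z ≡ 0ℚ) where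

      level-sum : ∀ u → sumK z (level u) ≡ walkSum (chordSum z) (level u) 0 1 n
      level-sum u = sym (path-sum z (level u) tz)

      gap≡0 : ∀ {v u} → v ≤ℚ u → ¬ v <ℚ u → u -ℚ v ≡ 0ℚ
      gap≡0 {v} {u} v≤u v≮u = trans (cong (_-ℚ v) (Q.≤-antisym (Q.≮⇒≥ v≮u) v≤u)) (Q.+-inverseʳ v)

      onLevel-head : ∀ {v u us a b} → v <ℚ u → PathEdge (level u) a b → onLevel v (u ∷ us) a b ≡ true
      onLevel-head {v} {u} {us} {a} {b} v<u pe = ∨-trueˡ (onLevel u us a b)
        (cong₂ _∧_ (true-does (v Q.<? u) v<u) (true-does (pathEdge? (level u) a b) pe))

      onLevel-tail : ∀ {v u us a b} → onLevel u us a b ≡ true → onLevel v (u ∷ us) a b ≡ true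
      onLevel-tail {v} {u} {us} {a} {b} h = ∨-trueʳ (⌊ v Q.<? u ⌋ ∧ ⌊ pathEdge? (level u) a b ⌋) h

      term-0≤ : ∀ {v u us} → v ≤ℚ u → (∀ a b → onLevel v (u ∷ us) a b ≡ true → 0ℚ ≤ℚ chordSum z a b) →
                0ℚ ≤ℚ (u -ℚ v) *ℚ sumK z (level u)
      term-0≤ {v} {u} {us} v≤u h with v Q.<? u
      ... | no v≮u  = Q.≤-reflexive (sym (trans (cong (_*ℚ sumK z (level u)) (gap≡0 v≤u v≮u)) (Q.*-zeroˡ (sumK z (level u)))))
      ... | yes v<u = 0≤* (0≤-diff v≤u) (subst (0ℚ ≤ℚ_) (sym (level-sum u))
                        (walkSum-0≤ (chordSum z) (level u) λ a b pe → h a b (cong (_∨ onLevel u us a b) (true-does (pathEdge? (level u) a b) pe))))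

      weighted-0≤ : ∀ v us → Linked _≤ℚ_ (v ∷ us) → (∀ a b → onLevel v us a b ≡ true → 0ℚ ≤ℚ chordSum z a b) → 0ℚ ≤ℚ weighted z v us
      weighted-0≤ v []       s         h = Q.≤-refl
      weighted-0≤ v (u ∷ us) (v≤u ∷ s) h = 0≤+ (term-0≤ {v} {u} {us} v≤u h) (weighted-0≤ u us s λ a b x → h a b (onLevel-tail {v} {u} {us} {a} {b} x))

      weighted-≡0 : ∀ v us → Linked _≤ℚ_ (v ∷ us) → (∀ a b → onLevel v us a b ≡ true → chordSum z a b ≡ 0ℚ) → weighted z v us ≡ 0ℚ
      weighted-≡0 v []       s         h = refl
      weighted-≡0 v (u ∷ us) (v≤u ∷ s) h = cong₂ _+ℚ_ term (weighted-≡0 u us s λ a b x → h a b (onLevel-tail {v} {u} {us} {a} {b} x))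
        where
        term : (u -ℚ v) *ℚ sumK z (level u) ≡ 0ℚ
        term with Q.≤-total u v
        ... | inj₁ u≤v = trans (cong (_*ℚ sumK z (level u)) (gap≡0 v≤u λ v<u → Q.<⇒≢ v<u (Q.≤-antisym v≤u u≤v))) (Q.*-zeroˡ (sumK z (level u)))
        ... | inj₂ _ with v Q.≟ u
        ...   | yes refl = trans (cong (_*ℚ sumK z (level u)) (Q.+-inverseʳ u)) (Q.*-zeroˡ (sumK z (level u)))
        ...   | no v≢u = trans (cong ((u -ℚ v) *ℚ_) (trans (level-sum u) (walkSum-≡0 (chordSum z) (level u) λ a b pe →
                           h a b (onLevel-head {v} {u} {us} {a} {b} (Q.≰⇒> λ u≤v → v≢u (Q.≤-antisym v≤u u≤v)) pe)))) (Q.*-zeroʳ (u -ℚ v))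

      -- Nonnegative terms with sum zero, used twice: across the thresholds and along the path of
      -- each one.
      weighted≡0⇒≡0 : ∀ v us → Linked _≤ℚ_ (v ∷ us) → (∀ a b → onLevel v us a b ≡ true → 0ℚ ≤ℚ chordSum z a b) → weighted z v us ≡ 0ℚ →
                      ∀ a b → onLevel v us a b ≡ true → chordSum z a b ≡ 0ℚ
      weighted≡0⇒≡0 v (u ∷ us) (v≤u ∷ s) h e a b x
        with 0≤+≡0 (term-0≤ {v} {u} {us} v≤u h) (weighted-0≤ u us s λ a b x → h a b (onLevel-tail {v} {u} {us} {a} {b} x)) e
           | ∨-true {⌊ v Q.<? u ⌋ ∧ ⌊ pathEdge? (level u) a b ⌋} x
      ... | _ , e₂ | inj₂ x₂ = weighted≡0⇒≡0 u us s (λ a b x → h a b (onLevel-tail {v} {u} {us} {a} {b} x)) e₂ a b x₂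
      ... | e₁ , _ | inj₁ x₁ with ∧-true {⌊ v Q.<? u ⌋} x₁
      ...   | f , g = walkSum≡0⇒≡0 (chordSum z) (level u) (λ a b pe → h a b (onLevel-head {v} {u} {us} {a} {b} v<u pe))
                        (trans (sym (level-sum u)) (*≡0⁻ (0<-diff v<u) e₁)) a b (does-true (pathEdge? (level u) a b) g)
        where
        v<u : v <ℚ u
        v<u = does-true (v Q.<? u) f

    -- The reference point `x` is any point of H tight on `S`, and `y` satisfies only the
    -- inequalities of `S`; no triangulation is chosen yet. Later `x` becomes M(T) for a T
    -- containing `S`.
    Optimal : NCSet 𝒜 → Set
    Optimal (S , _) = ∀ x y → defect x ≡ 0ℚ → defect y ≡ 0ℚ → (∀ a b → S a b ≡ true → δ x a b ≡ 0ℚ) → (∀ a b → S a b ≡ true → 0ℚ ≤ℚ δ y a b) →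
      pair c y ≤ℚ pair c x × (pair c y ≡ pair c x → ∀ a b → S a b ≡ true → δ y a b ≡ 0ℚ) × ((∀ a b → S a b ≡ true → δ y a b ≡ 0ℚ) → pair c y ≡ pair c x)

    -- With z = y - x, twice `chordSum z` along a path edge is the slack of `y`, because `x` is
    -- tight there; on sides both slacks vanish. So the loss in the functional is a combination of
    -- slacks of `y` with positive weights.
    optimal-set : Σ (NCSet 𝒜) Optimal
    optimal-set with thresholds
    ... | v , us , s , m = (diagonals v us , diagonals-noncrossing v us) , optimal
      where
      optimal : Optimal (diagonals v us , diagonals-noncrossing v us)
      optimal x y dx dy tight 0≤δy = diff-0≤ (subst (0ℚ ≤ℚ_) weighted≡ 0≤weighted) , forward , backward
        where
        z : ℕ → ℚ
        z j = y j -ℚ x j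
        tz : total z ≡ 0ℚ
        tz = trans (∑-sub 1 n y x) (*≡0⁻ 0<2ℚ (trans (lem (total y) (total x) (ι n *ℚ (1ℚ +ℚ ι n))) (cong₂ _-ℚ_ dy dx)))
          where
          lem : ∀ s t k → 2ℚ *ℚ (s -ℚ t) ≡ (2ℚ *ℚ s -ℚ k) -ℚ (2ℚ *ℚ t -ℚ k)
          lem = solve-∀ ℚ-ring
        weighted≡ : weighted z v us ≡ pair c x -ℚ pair c y
        weighted≡ = trans (lem (weighted z v us)) (trans (cong -_ (trans (sym (pair≡-weighted z v us tz s m)) (pair-sub c y x))) (lem₂ (pair c y) (pair c x)))
          where
          lem : ∀ w → w ≡ - (- w)
          lem = solve-∀ ℚ-ring
          lem₂ : ∀ s t → - (s -ℚ t) ≡ t -ℚ s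
          lem₂ = solve-∀ ℚ-ring
        2chordSum : ∀ a b → δ x a b ≡ 0ℚ → 2ℚ *ℚ chordSum z a b ≡ δ y a b
        2chordSum a b e = trans (chordSum-sub y x a b) (trans (cong (λ t → δ y a b -ℚ t) e) (Q.+-identityʳ (δ y a b)))
        onEdge : ∀ {a b} → onLevel v us a b ≡ true → (δ x a b ≡ 0ℚ × δ y a b ≡ 0ℚ) ⊎ diagonals v us a b ≡ true
        onEdge {a} {b} h with bool (adjacent 𝒜 a b)
        ... | inj₂ f = inj₂ (cong₂ (λ s t → not s ∧ t) f h)
        ... | inj₁ f with onLevel-true v us a b h
        ...   | u , (a<b , b≤ , _) = inj₁ (δ-adjacent x dx a<b b≤ f , δ-adjacent y dy a<b b≤ f)
        0≤chordSum : ∀ a b → onLevel v us a b ≡ true → 0ℚ ≤ℚ chordSum z a b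
        0≤chordSum a b h with onEdge h
        ... | inj₁ (ex , ey) = 0≤*⁻ 0<2ℚ (Q.≤-reflexive (sym (trans (2chordSum a b ex) ey)))
        ... | inj₂ d = 0≤*⁻ 0<2ℚ (subst (0ℚ ≤ℚ_) (sym (2chordSum a b (tight a b d))) (0≤δy a b d))
        0≤weighted : 0ℚ ≤ℚ weighted z v us
        0≤weighted = weighted-0≤ z tz v us s 0≤chordSum
        forward : pair c y ≡ pair c x → ∀ a b → diagonals v us a b ≡ true → δ y a b ≡ 0ℚ
        forward e a b d = trans (sym (2chordSum a b (tight a b d))) (trans (cong (2ℚ *ℚ_)
          (weighted≡0⇒≡0 z tz v us s 0≤chordSum (trans weighted≡ (trans (cong (pair c x -ℚ_) e) (Q.+-inverseʳ (pair c x)))) a b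
            (proj₂ (diagonals-true v us a b d)))) (Q.*-zeroʳ 2ℚ))
        backward : (∀ a b → diagonals v us a b ≡ true → δ y a b ≡ 0ℚ) → pair c y ≡ pair c x
        backward h = sym (diff≡0 (trans (sym weighted≡) (weighted-≡0 z tz v us s chordSum≡0)))
          where
          chordSum≡0 : ∀ a b → onLevel v us a b ≡ true → chordSum z a b ≡ 0ℚ
          chordSum≡0 a b k with onEdge k
          ... | inj₁ (ex , ey) = *≡0⁻ 0<2ℚ (trans (2chordSum a b ex) ey)
          ... | inj₂ d = *≡0⁻ 0<2ℚ (trans (2chordSum a b (tight a b d)) (h a b d))

  -- From the vector formulation of the polytope to slacks.

  sumℚ-total : ∀ (y : Vec ℚ n) → sumℚ (toList y) ≡ total (coord y)
  sumℚ-total y = trans (sumℚ-entry y) (sym (∑-shift 0 n (coord y)))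

  dot≡pair : ∀ (c y : Vec ℚ n) → dot c y ≡ pair (coord c) (coord y)
  dot≡pair c y = trans (dot-entry c y) (sym (∑-shift 0 n (λ j → coord c j *ℚ coord y j)))

  sumℚ-allFin : ∀ (f : Fin n → ℚ) g → (∀ i → f i ≡ g (suc (toℕ i))) → sumℚ (map f (allFin n)) ≡ ∑ 1 n g
  sumℚ-allFin f g e = trans (sumℚ-tabulate n f (λ i → i) (g ∘ suc) e) (sym (∑-shift 0 n g))

  coord-injective : ∀ (x y : Vec ℚ n) → (∀ j → 1 ≤ j → j ≤ n → coord x j ≡ coord y j) → x ≡ y
  coord-injective x y h = entry-injective x y λ i i<n → h (suc i) (s≤s z≤n) i<n

  2*threshold : 2ℚ *ℚ (+ℤ (n * suc n) / 2) ≡ ι n *ℚ (1ℚ +ℚ ι n)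
  2*threshold = trans (2*half (n * suc n)) (trans (ι-* n (suc n)) (cong (ι n *ℚ_) (ι-suc n)))

  InH⇒defect : ∀ y → InH y → defect (coord y) ≡ 0ℚ
  InH⇒defect y h = trans (cong (λ t → 2ℚ *ℚ t -ℚ ι n *ℚ (1ℚ +ℚ ι n)) (trans (sym (sumℚ-total y)) h))
    (trans (cong (_-ℚ ι n *ℚ (1ℚ +ℚ ι n)) 2*threshold) (Q.+-inverseʳ (ι n *ℚ (1ℚ +ℚ ι n))))

  defect⇒InH : ∀ y → defect (coord y) ≡ 0ℚ → InH y
  defect⇒InH y h = trans (sumℚ-total y) (diff≡0 (*≡0⁻ 0<2ℚ (trans (lem (total (coord y)) (+ℤ (n * suc n) / 2))
    (trans (cong (λ t → 2ℚ *ℚ total (coord y) -ℚ t) 2*threshold) h))))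
    where
    lem : ∀ s t → 2ℚ *ℚ (s -ℚ t) ≡ 2ℚ *ℚ s -ℚ 2ℚ *ℚ t
    lem = solve-∀ ℚ-ring

  halfValue : (ℕ → Bool) → Vec ℚ n → ℚ
  halfValue K y = ℕtoℚ (n ∸ countIn K 1 n) *ℚ sumℚ (map (λ i → if K (suc (toℕ i)) then lookup y i else 0ℚ) (allFin n))
    -ℚ ℕtoℚ (countIn K 1 n) *ℚ sumℚ (map (λ i → if K (suc (toℕ i)) then 0ℚ else lookup y i) (allFin n))
    +ℚ (+ℤ (n * countIn K 1 n * (n ∸ countIn K 1 n))) / 2

  -- As polynomials, the left side is the right side minus `k * defect`, so on H each half space
  -- says that a slack is nonnegative.
  halfValue≡δ : ∀ y {a b} → defect (coord y) ≡ 0ℚ → a < b → b ≤ top →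
                2ℚ *ℚ halfValue (inK 𝒜 a b) y ≡ ι n *ℚ δ (coord y) a b
  halfValue≡δ y {a} {b} e a<b b≤ = trans (cong₂ (λ s t → 2ℚ *ℚ (s -ℚ t +ℚ (+ℤ (n * k * (n ∸ k))) / 2))
      (cong₂ _*ℚ_ (trans (sym (ι≡ℕtoℚ (n ∸ k))) (ι-∸ k≤n)) sumIn) (cong₂ _*ℚ_ (sym (ι≡ℕtoℚ k)) sumOut))
    (trans (lem₁ ((ι n -ℚ ι k) *ℚ s) (ι k *ℚ (t -ℚ s)) ((+ℤ (n * k * (n ∸ k))) / 2))
    (trans (cong (λ h → 2ℚ *ℚ ((ι n -ℚ ι k) *ℚ s -ℚ ι k *ℚ (t -ℚ s)) +ℚ h) halves)
    (trans (lem₂ (ι n) (ι k) s t) (trans (cong (λ d → ι n *ℚ (2ℚ *ℚ s -ℚ ι k *ℚ (1ℚ +ℚ ι k)) -ℚ ι k *ℚ d) e)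
    (trans (trans (cong (λ u → ι n *ℚ (2ℚ *ℚ s -ℚ ι k *ℚ (1ℚ +ℚ ι k)) -ℚ u) (Q.*-zeroʳ (ι k))) (Q.+-identityʳ _))
      (cong (ι n *ℚ_) (sym (trans (δ≡sumK (coord y) a<b) (cong (λ u → 2ℚ *ℚ s -ℚ u) arcs)))))))))
    where
    K : ℕ → Bool
    K = inK 𝒜 a b
    k : ℕ
    k = countIn K 1 n
    s t : ℚ
    s = sumK (coord y) K
    t = total (coord y)
    k≤n : k ≤ n
    k≤n = subst (k ≤_) (countIn-complement K 1 n) (m≤m+n k _)
    arcs : (arc a b -ℚ 1ℚ) *ℚ arc a b ≡ ι k *ℚ (1ℚ +ℚ ι k)
    arcs = cong₂ _*ℚ_ (sym (card≡arc a<b b≤)) (trans (lem (arc a b)) (cong (1ℚ +ℚ_) (sym (card≡arc a<b b≤))))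
      where
      lem : ∀ x → x ≡ 1ℚ +ℚ (x -ℚ 1ℚ)
      lem = solve-∀ ℚ-ring
    halves : 2ℚ *ℚ ((+ℤ (n * k * (n ∸ k))) / 2) ≡ (ι n *ℚ ι k) *ℚ (ι n -ℚ ι k)
    halves = trans (2*half (n * k * (n ∸ k))) (trans (ι-* (n * k) (n ∸ k)) (cong₂ _*ℚ_ (ι-* n k) (ι-∸ k≤n)))
    sumIn : sumℚ (map (λ i → if K (suc (toℕ i)) then lookup y i else 0ℚ) (allFin n)) ≡ s
    sumIn = sumℚ-allFin _ (λ i → ind (K i) *ℚ coord y i) pointwise
      where
      pointwise : ∀ i → (if K (suc (toℕ i)) then lookup y i else 0ℚ) ≡ ind (K (suc (toℕ i))) *ℚ entry y (toℕ i)
      pointwise i with K (suc (toℕ i))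
      ... | true  = trans (entry-lookup y i) (sym (Q.*-identityˡ _))
      ... | false = sym (Q.*-zeroˡ (entry y (toℕ i)))
    sumOut : sumℚ (map (λ i → if K (suc (toℕ i)) then 0ℚ else lookup y i) (allFin n)) ≡ t -ℚ s
    sumOut = trans (sumℚ-allFin _ (λ i → coord y i -ℚ ind (K i) *ℚ coord y i) pointwise) (∑-sub 1 n (coord y) (λ i → ind (K i) *ℚ coord y i))
      where
      lem : ∀ x → 0ℚ ≡ x -ℚ 1ℚ *ℚ x
      lem = solve-∀ ℚ-ring
      pointwise : ∀ i → (if K (suc (toℕ i)) then 0ℚ else lookup y i) ≡ entry y (toℕ i) -ℚ ind (K (suc (toℕ i))) *ℚ entry y (toℕ i)
      pointwise i with K (suc (toℕ i))
      ... | true  = lem (entry y (toℕ i))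
      ... | false = trans (entry-lookup y i) (sym (trans (cong (λ z → entry y (toℕ i) -ℚ z) (Q.*-zeroˡ (entry y (toℕ i)))) (Q.+-identityʳ _)))
    lem₁ : ∀ u v h → 2ℚ *ℚ (u -ℚ v +ℚ h) ≡ 2ℚ *ℚ (u -ℚ v) +ℚ 2ℚ *ℚ h
    lem₁ = solve-∀ ℚ-ring
    lem₂ : ∀ n k s t → 2ℚ *ℚ ((n -ℚ k) *ℚ s -ℚ k *ℚ (t -ℚ s)) +ℚ (n *ℚ k) *ℚ (n -ℚ k) ≡
      n *ℚ (2ℚ *ℚ s -ℚ k *ℚ (1ℚ +ℚ k)) -ℚ k *ℚ (2ℚ *ℚ t -ℚ n *ℚ (1ℚ +ℚ n))
    lem₂ = solve-∀ ℚ-ring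

  0<ιn : 0ℚ <ℚ ι n
  0<ιn = subst (_<ℚ ι n) ι-0 (ι-mono-< 1≤n)

  Feasible : (ℕ → ℚ) → Set
  Feasible y = defect y ≡ 0ℚ × (∀ a b → IsDiagonal 𝒜 a b → 0ℚ ≤ℚ δ y a b)

  InP⇒Feasible : ∀ y → InP 𝒜 y → Feasible (coord y)
  InP⇒Feasible y (h , g) = e , λ { a b dg@(a<b , b≤ , _) →
    0≤*⁻ {ι n} {δ (coord y) a b} 0<ιn (subst (0ℚ ≤ℚ_) (halfValue≡δ y e a<b b≤)
      (0≤* {2ℚ} {halfValue (inK 𝒜 a b) y} (Q.<⇒≤ 0<2ℚ) (g a b dg))) }
    where
    e : defect (coord y) ≡ 0ℚ
    e = InH⇒defect y h

  Feasible⇒InP : ∀ y → Feasible (coord y) → InP 𝒜 y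
  Feasible⇒InP y (e , g) = defect⇒InH y e , λ { a b dg@(a<b , b≤ , _) →
    0≤*⁻ {2ℚ} {halfValue (inK 𝒜 a b) y} 0<2ℚ (subst (0ℚ ≤ℚ_) (sym (halfValue≡δ y e a<b b≤))
      (0≤* {ι n} {δ (coord y) a b} (Q.<⇒≤ 0<ιn) (g a b dg))) }

  coord-M : ∀ T j → 1 ≤ j → j ≤ n → coord (M 𝒜 T) j ≡ xℚ (proj₁ T) j
  coord-M T (suc i) _ i<n = entry-tabulate (λ i → xℚ (proj₁ T) (suc i)) i i<n

  module _ {y y′ : ℕ → ℚ} (h : ∀ j → 1 ≤ j → j ≤ n → y j ≡ y′ j) where

    pair-cong : ∀ c → pair c y ≡ pair c y′
    pair-cong c = ∑-cong 1 n λ { j 1≤j (s≤s j≤n) → cong (c j *ℚ_) (h j 1≤j j≤n) }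

    δ-cong : ∀ a b → δ y a b ≡ δ y′ a b
    δ-cong a b = trans (δ≡ y a b) (trans (cong₂ (λ s t → 2ℚ *ℚ (s -ℚ t) -ℚ (arc a b -ℚ 1ℚ) *ℚ arc a b) (pair-cong (R b)) (pair-cong (L a)))
      (sym (δ≡ y′ a b)))

    defect-cong : defect y ≡ defect y′
    defect-cong = cong (λ t → 2ℚ *ℚ t -ℚ ι n *ℚ (1ℚ +ℚ ι n)) (∑-cong 1 n λ { j 1≤j (s≤s j≤n) → h j 1≤j j≤n })

  -- Faces cut out by non-crossing sets.

  module _ (T : Triangulation 𝒜) where

    private
      nc = proj₁ (proj₂ T)
      mx = triangulation-maximal T

    M-defect : defect (coord (M 𝒜 T)) ≡ 0ℚ
    M-defect = trans (defect-cong (coord-M T)) (xℚ-defect (proj₁ T) nc mx)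

    M-tight : ∀ a b → proj₁ T a b ≡ true → δ (coord (M 𝒜 T)) a b ≡ 0ℚ
    M-tight a b t = trans (δ-cong (coord-M T) a b) (xℚ-tight (proj₁ T) nc mx t)

    M-strict : ∀ a b → IsDiagonal 𝒜 a b → proj₁ T a b ≡ false → 0ℚ <ℚ δ (coord (M 𝒜 T)) a b
    M-strict a b dg t = subst (0ℚ <ℚ_) (sym (δ-cong (coord-M T) a b)) (xℚ-strict (proj₁ T) nc mx dg t)

    M-InP : InP 𝒜 (M 𝒜 T)
    M-InP = Feasible⇒InP (M 𝒜 T) (M-defect , λ { a b (a<b , b≤ , _) →
      subst (0ℚ ≤ℚ_) (sym (δ-cong (coord-M T) a b)) (xℚ-0≤ (proj₁ T) nc mx a<b b≤) })

    M-unique : ∀ y → defect (coord y) ≡ 0ℚ → (∀ a b → proj₁ T a b ≡ true → δ (coord y) a b ≡ 0ℚ) → y ≡ M 𝒜 T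
    M-unique y e h = coord-injective y (M 𝒜 T) λ j 1≤j j≤n →
      trans (xℚ-unique (proj₁ T) nc mx (coord y) e h j 1≤j j≤n) (sym (coord-M T j 1≤j j≤n))

  face : NCSet 𝒜 → Vec ℚ n → Set
  face (S , _) y = InP 𝒜 y × (∀ a b → S a b ≡ true → δ (coord y) a b ≡ 0ℚ)

  face-nonempty : ∀ S (T : Triangulation 𝒜) → proj₁ S ⊆D proj₁ T → face S (M 𝒜 T)
  face-nonempty S T sub = M-InP T , λ a b s → M-tight T a b (sub a b s)

  face-vertex : ∀ (T : Triangulation 𝒜) y → face (proj₁ T , proj₁ (proj₂ T)) y ⇔ (y ≡ M 𝒜 T)
  face-vertex T y = mk⇔ (λ { (p , h) → M-unique T y (proj₁ (InP⇒Feasible y p)) h })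
    λ { refl → face-nonempty (proj₁ T , proj₁ (proj₂ T)) T (λ _ _ t → t) }

  module Supporting (S : DiagSet) (nc : IsNonCrossing 𝒜 S) where

    private
      diagonal : ∀ {a b} → S a b ≡ true → IsDiagonal 𝒜 a b
      diagonal = proj₁ nc _ _

    size : ℕ → ℕ → ℚ
    size a b = (arc a b -ℚ 1ℚ) *ℚ arc a b

    -- The sign suits the upper bound in `IsFace`: `level` minus this functional is the sum of the
    -- doubled slacks over `S`. On the polytope that sum is nonnegative, and it is zero exactly when
    -- every member of `S` is tight.
    normal : ℕ → ℚ
    normal j = ∑∑ (λ a b → (- 2ℚ) *ℚ (ind (S a b) *ℚ ind (inK 𝒜 a b j)))

    level : ℚ
    level = ∑∑ (λ a b → - (ind (S a b) *ℚ size a b))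

    gap : (ℕ → ℚ) → ℕ → ℕ → ℚ
    gap y a b = ind (S a b) *ℚ (2ℚ *ℚ sumK y (inK 𝒜 a b) -ℚ size a b)

    level-pair : ∀ y → level -ℚ pair normal y ≡ ∑∑ (gap y)
    level-pair y = trans (cong (λ p → level -ℚ p) swapped) (trans (sym (∑-sub 0 N (λ a → ∑ 0 N (f a)) (λ a → ∑ 0 N (g a))))
      (∑-cong 0 N λ a _ _ → trans (sym (∑-sub 0 N (f a) (g a)))
        (∑-cong 0 N λ b _ _ → lem (ind (S a b)) (sumK y (inK 𝒜 a b)) (size a b))))
      where
      f g : ℕ → ℕ → ℚ
      f a b = - (ind (S a b) *ℚ size a b)
      g a b = (- 2ℚ) *ℚ (ind (S a b) *ℚ sumK y (inK 𝒜 a b))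
      s : ℕ → ℕ → ℕ → ℚ
      s j a b = (- 2ℚ) *ℚ (ind (S a b) *ℚ ind (inK 𝒜 a b j))
      t : ℕ → ℕ → ℕ → ℚ
      t j a b = ((- 2ℚ) *ℚ ind (S a b)) *ℚ (ind (inK 𝒜 a b j) *ℚ y j)
      lem : ∀ i s k → (- (i *ℚ k)) -ℚ ((- 2ℚ) *ℚ (i *ℚ s)) ≡ i *ℚ (2ℚ *ℚ s -ℚ k)
      lem = solve-∀ ℚ-ring
      lem₂ : ∀ m i k z → z *ℚ (m *ℚ (i *ℚ k)) ≡ (m *ℚ i) *ℚ (k *ℚ z)
      lem₂ = solve-∀ ℚ-ring
      entry≡ : ∀ j → normal j *ℚ y j ≡ ∑∑ (t j)
      entry≡ j = trans (Q.*-comm (normal j) (y j)) (trans (sym (∑-* 0 N (y j) (λ a → ∑ 0 N (s j a))))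
        (∑-cong 0 N λ a _ _ → trans (sym (∑-* 0 N (y j) (s j a)))
          (∑-cong 0 N λ b _ _ → lem₂ (- 2ℚ) (ind (S a b)) (ind (inK 𝒜 a b j)) (y j))))
      swapped : pair normal y ≡ ∑∑ g
      swapped = trans (∑-cong 1 n λ j _ _ → entry≡ j) (trans (∑-swap 1 n 0 N (λ j a → ∑ 0 N (t j a)))
        (∑-cong 0 N λ a _ _ → trans (∑-swap 1 n 0 N (λ j b → t j a b))
          (∑-cong 0 N λ b _ _ → trans (∑-* 1 n ((- 2ℚ) *ℚ ind (S a b)) (λ j → ind (inK 𝒜 a b j) *ℚ y j))
            (Q.*-assoc (- 2ℚ) (ind (S a b)) (sumK y (inK 𝒜 a b))))))

    gap-true : ∀ y {a b} → S a b ≡ true → gap y a b ≡ δ y a b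
    gap-true y {a} {b} s = trans (cong (λ c → ind c *ℚ (2ℚ *ℚ sumK y (inK 𝒜 a b) -ℚ size a b)) s)
      (trans (Q.*-identityˡ _) (sym (δ≡sumK y (proj₁ (diagonal s)))))

    gap-false : ∀ y {a b} → S a b ≡ false → gap y a b ≡ 0ℚ
    gap-false y {a} {b} s = trans (cong (λ c → ind c *ℚ (2ℚ *ℚ sumK y (inK 𝒜 a b) -ℚ size a b)) s) (Q.*-zeroˡ (2ℚ *ℚ sumK y (inK 𝒜 a b) -ℚ size a b))

    0≤gap : ∀ {y} → Feasible y → ∀ a b → 0ℚ ≤ℚ gap y a b
    0≤gap {y} (_ , h) a b with bool (S a b)
    ... | inj₁ s = subst (0ℚ ≤ℚ_) (sym (gap-true y s)) (h a b (diagonal s))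
    ... | inj₂ s = Q.≤-reflexive (sym (gap-false y s))

    normalVec : Vec ℚ n
    normalVec = tabulate (λ i → normal (suc (toℕ i)))

    dot-normal : ∀ y → dot normalVec y ≡ pair normal (coord y)
    dot-normal y = trans (dot≡pair normalVec y) (∑-cong 1 n λ { (suc j) _ (s≤s j<n) →
      cong (_*ℚ coord y (suc j)) (entry-tabulate (λ i → normal (suc i)) j j<n) })

    0≤∑∑gap : ∀ {y} → Feasible y → 0ℚ ≤ℚ ∑∑ (gap y)
    0≤∑∑gap {y} h = ∑-0≤ 0 N {λ a → ∑ 0 N (gap y a)} λ a → ∑-0≤ 0 N {gap y a} (0≤gap h a)

    gaps≡0 : ∀ {y} → (∀ a b → S a b ≡ true → δ y a b ≡ 0ℚ) → ∑∑ (gap y) ≡ 0ℚ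
    gaps≡0 {y} h = ∑-zero 0 N {λ a → ∑ 0 N (gap y a)} λ a _ _ → ∑-zero 0 N {gap y a} λ b _ _ → zero-gap a b
      where
      zero-gap : ∀ a b → gap y a b ≡ 0ℚ
      zero-gap a b with bool (S a b)
      ... | inj₁ s = trans (gap-true y s) (h a b s)
      ... | inj₂ s = gap-false y s

    gaps≡0⇒δ≡0 : ∀ {y} → Feasible y → ∑∑ (gap y) ≡ 0ℚ → ∀ a b → S a b ≡ true → δ y a b ≡ 0ℚ
    gaps≡0⇒δ≡0 {y} h e a b s = trans (sym (gap-true y s))
      (∑≡0⇒≡0 0 N {gap y a} (0≤gap h a) row b z≤n (s≤s (proj₂ (Geometry.≤top S nc s))))
      where
      row : ∑ 0 N (gap y a) ≡ 0ℚ
      row = ∑≡0⇒≡0 0 N {λ a → ∑ 0 N (gap y a)} (λ a → ∑-0≤ 0 N {gap y a} (0≤gap h a)) e a z≤n (s≤s (proj₁ (Geometry.≤top S nc s)))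

    isFace : IsFace 𝒜 (face (S , nc))
    isFace = normalVec , level , supports , λ y → mk⇔ (to y) (from y)
      where
      supports : ∀ y → InP 𝒜 y → dot normalVec y ≤ℚ level
      supports y p = subst (_≤ℚ level) (sym (dot-normal y))
        (diff-0≤ (subst (0ℚ ≤ℚ_) (sym (level-pair (coord y))) (0≤∑∑gap (InP⇒Feasible y p))))
      to : ∀ y → face (S , nc) y → InP 𝒜 y × dot normalVec y ≡ level
      to y (p , h) = p , trans (dot-normal y) (sym (diff≡0 (trans (level-pair (coord y)) (gaps≡0 h))))
      from : ∀ y → InP 𝒜 y × dot normalVec y ≡ level → face (S , nc) y
      from y (p , e) = p , gaps≡0⇒δ≡0 (InP⇒Feasible y p) (trans (sym (level-pair (coord y)))
        (trans (cong (λ p → level -ℚ p) (trans (sym (dot-normal y)) e)) (Q.+-inverseʳ level)))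

  MaximizedBy : (ℕ → ℚ) → NCSet 𝒜 → Set
  MaximizedBy c S = ∀ (T : Triangulation 𝒜) → proj₁ S ⊆D proj₁ T → ∀ y → InP 𝒜 y →
    pair c (coord y) ≤ℚ pair c (coord (M 𝒜 T)) × (pair c (coord y) ≡ pair c (coord (M 𝒜 T)) ⇔ face S y)

  optimal⇒maximized : ∀ c S → Optimal c S → MaximizedBy c S
  optimal⇒maximized c S opt T sub y p = proj₁ o , mk⇔ (λ q → p , proj₁ (proj₂ o) q) (λ f → proj₂ (proj₂ o) (proj₂ f))
    where
    feas : Feasible (coord y)
    feas = InP⇒Feasible y p
    o : pair c (coord y) ≤ℚ pair c (coord (M 𝒜 T)) ×
        (pair c (coord y) ≡ pair c (coord (M 𝒜 T)) → ∀ a b → proj₁ S a b ≡ true → δ (coord y) a b ≡ 0ℚ) ×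
        ((∀ a b → proj₁ S a b ≡ true → δ (coord y) a b ≡ 0ℚ) → pair c (coord y) ≡ pair c (coord (M 𝒜 T)))
    o = opt (coord (M 𝒜 T)) (coord y) (M-defect T) (proj₁ feas) (λ a b s → M-tight T a b (sub a b s))
          (λ a b s → proj₂ feas a b (proj₁ (proj₂ S) a b s))

  face-optimal : ∀ c → Σ (NCSet 𝒜) (MaximizedBy c)
  face-optimal c = map₂ (λ {S} → optimal⇒maximized c S) (optimal-set c)

  -- Because `F` is nonempty, the bound `d` is attained on the polytope. It is therefore the
  -- maximum, which M(T) realises, and the points of value `d` are those tight on `S`.
  maximized⇒face : ∀ F → (face-F : IsFace 𝒜 F) → Σ (Vec ℚ n) F → ∀ S → MaximizedBy (coord (proj₁ face-F)) S →
                   (T : Triangulation 𝒜) → proj₁ S ⊆D proj₁ T → ∀ y → F y ⇔ face S y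
  maximized⇒face F (c , d , le , F⇔) (y₀ , Fy₀) S opt T sub y = mk⇔ to from
    where
    x : Vec ℚ n
    x = M 𝒜 T
    y₀∈ : InP 𝒜 y₀ × dot c y₀ ≡ d
    y₀∈ = Equivalence.to (F⇔ y₀) Fy₀
    pair-x : pair (coord c) (coord x) ≡ d
    pair-x = Q.≤-antisym (subst (_≤ℚ d) (dot≡pair c x) (le x (M-InP T)))
      (subst (_≤ℚ pair (coord c) (coord x)) (trans (sym (dot≡pair c y₀)) (proj₂ y₀∈)) (proj₁ (opt T sub y₀ (proj₁ y₀∈))))
    to : F y → face S y
    to Fy = Equivalence.to (proj₂ (opt T sub y (proj₁ y∈))) (trans (sym (dot≡pair c y)) (trans (proj₂ y∈) (sym pair-x)))
      where
      y∈ : InP 𝒜 y × dot c y ≡ d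
      y∈ = Equivalence.to (F⇔ y) Fy
    from : face S y → F y
    from f = Equivalence.from (F⇔ y) (proj₁ f , trans (dot≡pair c y) (trans (Equivalence.from (proj₂ (opt T sub y (proj₁ f))) f) pair-x))

  isFace⇒face : ∀ F → IsFace 𝒜 F → Σ (Vec ℚ n) F → Σ (NCSet 𝒜) λ S → ∀ y → F y ⇔ face S y
  isFace⇒face F face-F nonempty = chosen (face-optimal (coord (proj₁ face-F)))
    where
    chosen : Σ (NCSet 𝒜) (MaximizedBy (coord (proj₁ face-F))) → Σ (NCSet 𝒜) λ S → ∀ y → F y ⇔ face S y
    chosen (S , opt) = S , maximized⇒face F face-F nonempty S opt (proj₁ T-S) (proj₂ T-S)
      where
      T-S : Σ (Triangulation 𝒜) λ T → proj₁ S ⊆D proj₁ T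
      T-S = triangulate S

  -- The point M(R) would lie in the face of `S′`, hence in that of `S`, yet its slack at `a`-`b` is
  -- positive.
  avoiding⇒∈ : ∀ S S′ → (∀ y → face S′ y → face S y) → ∀ {a b} → proj₁ S a b ≡ true →
               ¬ Σ (NCSet 𝒜) (λ R → (proj₁ S′ ⊆D proj₁ R) × IsMaximal (proj₁ R) × proj₁ R a b ≡ false)
  avoiding⇒∈ S S′ inc {a} {b} s ((R , ncR) , sub , mx , r) = Q.<⇒≢ (M-strict R′ a b (proj₁ (proj₂ S) a b s) r)
    (sym (proj₂ (inc (M 𝒜 R′) (face-nonempty S′ R′ sub)) a b s))
    where
    R′ : Triangulation 𝒜
    R′ = R , ncR , Counting.maximal⇒card R ncR mx

  face-antitone : ∀ S S′ → (proj₁ S ⊆D proj₁ S′) ⇔ (∀ y → face S′ y → face S y)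
  face-antitone S S′ = mk⇔ (λ { sub y (p , h) → p , λ a b s → h a b (sub a b s) }) λ inc a b s → from inc a b s (bool (proj₁ S′ a b))
    where
    from : (∀ y → face S′ y → face S y) → ∀ a b → proj₁ S a b ≡ true → proj₁ S′ a b ≡ true ⊎ proj₁ S′ a b ≡ false → proj₁ S′ a b ≡ true
    from inc a b s (inj₁ s′) = s′
    from inc a b s (inj₂ s′) = ⊥-elim (avoiding⇒∈ S S′ inc s (avoiding S′ {a} {b} (proj₁ (proj₂ S) a b s) s′))

  -- Boundedness, combinatorial type and vertices.

  upperBound : ∀ c → Σ ℚ λ u → ∀ y → InP 𝒜 y → pair c (coord y) ≤ℚ u
  upperBound c = chosen (face-optimal c)
    where
    chosen : Σ (NCSet 𝒜) (MaximizedBy c) → Σ ℚ λ u → ∀ y → InP 𝒜 y → pair c (coord y) ≤ℚ u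
    chosen (S , opt) = pair c (coord (M 𝒜 (proj₁ T-S))) , λ y p → proj₁ (opt (proj₁ T-S) (proj₂ T-S) y p)
      where
      T-S : Σ (Triangulation 𝒜) λ T → proj₁ S ⊆D proj₁ T
      T-S = triangulate S

  -- Every linear functional attains its maximum at some M(T); this is applied to plus and minus
  -- each coordinate.
  bounded : Bounded 𝒜
  bounded = B , λ y p i → subst (λ t → - B ≤ℚ t × t ≤ℚ B) (sym (entry-lookup y i)) (bound y p (suc (toℕ i)) (s≤s z≤n) (Finₚ.toℕ<n i))
    where
    unit : ℚ → ℕ → ℕ → ℚ
    unit s j i = s *ℚ ind (i ≡ᵇ j)
    pair-unit : ∀ s j y → 1 ≤ j → j ≤ n → pair (unit s j) y ≡ s *ℚ y j
    pair-unit s j y 1≤j j≤n = trans (∑-cong 1 n λ i _ _ → Q.*-assoc s (ind (i ≡ᵇ j)) (y i))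
      (trans (∑-* 1 n s (λ i → ind (i ≡ᵇ j) *ℚ y i)) (cong (s *ℚ_) (sumK-singleton y j 1≤j j≤n)))
    hi lo : ℕ → ℚ
    hi j = proj₁ (upperBound (unit 1ℚ j))
    lo j = proj₁ (upperBound (unit (- 1ℚ) j))
    β : ℕ → ℚ
    β j = ℚ.∣ hi j ∣ +ℚ ℚ.∣ lo j ∣
    0≤β : ∀ j → 0ℚ ≤ℚ β j
    0≤β j = 0≤+ (Q.0≤∣p∣ (hi j)) (Q.0≤∣p∣ (lo j))
    -- A sum serves in place of a maximum, since it dominates each of its nonnegative terms.
    B : ℚ
    B = ∑ 1 n β
    ≤abs : ∀ p → p ≤ℚ ℚ.∣ p ∣
    ≤abs p with Q.≤-total 0ℚ p
    ... | inj₁ h = Q.≤-reflexive (sym (Q.0≤p⇒∣p∣≡p h))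
    ... | inj₂ h = Q.≤-trans h (Q.0≤∣p∣ p)
    bound : ∀ y → InP 𝒜 y → ∀ j → 1 ≤ j → j ≤ n → - B ≤ℚ coord y j × coord y j ≤ℚ B
    bound y p j 1≤j j≤n = subst (- B ≤ℚ_) (neg² (coord y j)) (Q.neg-antimono-≤ below-B) , above-B
      where
      neg² : ∀ t → - (- t) ≡ t
      neg² = solve-∀ ℚ-ring
      neg-one : ∀ t → (- 1ℚ) *ℚ t ≡ - t
      neg-one = solve-∀ ℚ-ring
      β≤B : β j ≤ℚ B
      β≤B = term≤∑ 1 n 0≤β j 1≤j (s≤s j≤n)
      above-B : coord y j ≤ℚ B
      above-B = Q.≤-trans (subst (_≤ℚ hi j) (trans (pair-unit 1ℚ j (coord y) 1≤j j≤n) (Q.*-identityˡ _)) (proj₂ (upperBound (unit 1ℚ j)) y p))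
        (Q.≤-trans (≤abs (hi j)) (Q.≤-trans (subst (_≤ℚ β j) (Q.+-identityʳ _) (Q.+-monoʳ-≤ ℚ.∣ hi j ∣ (Q.0≤∣p∣ (lo j)))) β≤B))
      below-B : - coord y j ≤ℚ B
      below-B = Q.≤-trans (subst (_≤ℚ lo j) (trans (pair-unit (- 1ℚ) j (coord y) 1≤j j≤n) (neg-one (coord y j))) (proj₂ (upperBound (unit (- 1ℚ) j)) y p))
        (Q.≤-trans (≤abs (lo j)) (Q.≤-trans (subst (_≤ℚ β j) (Q.+-identityˡ _) (Q.+-monoˡ-≤ ℚ.∣ lo j ∣ (Q.0≤∣p∣ (hi j)))) β≤B))

  combinatorialType : CombEquivAssociahedron 𝒜
  combinatorialType = face , (λ S → Supporting.isFace (proj₁ S) (proj₂ S) , nonempty S (triangulate S)) , isFace⇒face , face-antitone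
    where
    nonempty : ∀ S → Σ (Triangulation 𝒜) (λ T → proj₁ S ⊆D proj₁ T) → Σ (Vec ℚ n) (face S)
    nonempty S (T , sub) = M 𝒜 T , face-nonempty S T sub

  -- A one-point face is the face of some `S`, and it contains M(T) for any T extending `S`.
  -- Conversely the face of a triangulation consists of M(T) alone.
  vertices : ∀ (x : Vec ℚ n) → IsVertex 𝒜 x ⇔ Σ (Triangulation 𝒜) (λ T → x ≡ M 𝒜 T)
  vertices x = mk⇔ (λ v → to (isFace⇒face (λ y → y ≡ x) v (x , refl))) λ { (T , refl) → from T (Supporting.isFace (proj₁ T) (proj₁ (proj₂ T))) }
    where
    to : (Σ (NCSet 𝒜) λ S → ∀ y → y ≡ x ⇔ face S y) → Σ (Triangulation 𝒜) (λ T → x ≡ M 𝒜 T)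
    to (S , eq) = extend (triangulate S)
      where
      extend : Σ (Triangulation 𝒜) (λ T → proj₁ S ⊆D proj₁ T) → Σ (Triangulation 𝒜) (λ T → x ≡ M 𝒜 T)
      extend (T , sub) = T , sym (Equivalence.from (eq (M 𝒜 T)) (face-nonempty S T sub))
    from : ∀ T → IsFace 𝒜 (face (proj₁ T , proj₁ (proj₂ T))) → IsVertex 𝒜 (M 𝒜 T)
    from T (c , d , le , eq) = c , d , le , λ y → mk⇔ (λ e → Equivalence.to (eq y) (Equivalence.from (face-vertex T y) e))
                                                      (λ h → Equivalence.to (face-vertex T y) (Equivalence.from (eq y) h))

theorem2p12 : (n : ℕ) → 2 ≤ n → (𝒜 : Orientation n) →
    Bounded 𝒜
    × CombEquivAssociahedron 𝒜
    × (∀ (x : Vec ℚ n) → IsVertex 𝒜 x ⇔ Σ (Triangulation 𝒜) (λ T → x ≡ M 𝒜 T))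
theorem2p12 n 2≤n 𝒜 = bounded , combinatorialType , vertices
  where open Construction (<⇒≤ 2≤n) 𝒜
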